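{- Let $G$ be a (finite, simple) plane graph with minimum degree five that contains no $\langle 5,6,6,5,\infty\rangle$-star and no $\langle 5,6,7,5,23\rangle$-star. Then $G$ has a minor $5$-star of weight at most $45$ and height at most $17$.
   Context: A plane graph is a graph embedded in the plane without edge crossings; $\deg(v)$ denotes the degree of $v$ in $G$. For integers (or $\infty$) $\kappa_1,\dots,\kappa_5$, a $\langle \kappa_1,\kappa_2,\kappa_3,\kappa_4,\kappa_5\rangle$-star in $G$ is a vertex $v$ of degree exactly $5$ together with its five neighbors $v_1,\dots,v_5$, listed in the cyclic order around $v$ given by the embedding (starting at some neighbor, in either orientation), such that $\deg(v_i)\le \kappa_i$ for $i=1,\dots,5$; the entry $\infty$ means no restriction. A minor $5$-star is a $5$-vertex together with its five neighbors. The weight of a subgraph $H$ is $\sum_{v\in V(H)}\deg_G(v)$, and its height is $\max_{v\in V(H)}\deg_G(v)$. -}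

module Defs where

open import Data.Nat using (ℕ; zero; suc; _+_; _*_; _≤_; _<_)
import Data.Nat as ℕ
open import Data.Fin using (Fin; toℕ)
import Data.Fin as F
open import Data.Bool using (Bool; true; false; _∧_; _∨_; not; if_then_else_)
open import Data.Product using (Σ; ∃; _×_; _,_)
open import Data.Sum using (_⊎_)
open import Data.Unit using (⊤)
open import Relation.Binary.PropositionalEquality using (_≡_; _≢_)
open import Relation.Nullary.Decidable using (⌊_⌋)

iter : {A : Set} → ℕ → (A → A) → A → A
iter zero    f x = x
iter (suc k) f x = f (iter k f x)

countF : (N : ℕ) → (Fin N → Bool) → ℕ
countF zero    p = 0
countF (suc N) p = (if p F.zero then 1 else 0) + countF N (λ i → p (F.suc i))

allBelow : ℕ → (ℕ → Bool) → Bool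
allBelow zero    p = true
allBelow (suc k) p = allBelow k p ∧ p k

anyF : (N : ℕ) → (Fin N → Bool) → Bool
anyF zero    p = false
anyF (suc N) p = p F.zero ∨ anyF N (λ i → p (F.suc i))

eqF : {N : ℕ} → Fin N → Fin N → Bool
eqF i j = ⌊ i F.≟ j ⌋

data Bd : Set where
  fin : ℕ → Bd
  ∞   : Bd

_≤Bd_ : ℕ → Bd → Set
x ≤Bd fin k = x ≤ k
x ≤Bd ∞     = ⊤

-- Rotation systems (combinatorial embeddings of graphs).
-- Vertices are Fin n, darts (half-edges) are Fin D.
-- tail d : the vertex at which dart d starts,
-- rev d  : the reverse dart (other half of the same edge),
-- rot d  : the next dart around the vertex tail d in the cyclic
--          (say counterclockwise) order given by the embedding.

record RotSys : Set where
  field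
    n    : ℕ
    D    : ℕ
    tail : Fin D → Fin n
    rev  : Fin D → Fin D
    rot  : Fin D → Fin D

module _ (R : RotSys) where
  open RotSys R

  head : Fin D → Fin n
  head d = tail (rev d)

  deg : Fin n → ℕ
  deg v = countF D (λ d → eqF (tail d) v)

  -- face permutation; faces of the embedding = its orbits
  facePerm : Fin D → Fin D
  facePerm d = rot (rev d)

  faceRep : Fin D → Bool
  faceRep d = allBelow D (λ k → toℕ d ℕ.≤ᵇ toℕ (iter k facePerm d))

  faces : ℕ
  faces = countF D faceRep

  adj : Fin n → Fin n → Bool
  adj u v = anyF D (λ d → eqF (tail d) u ∧ eqF (head d) v)

  reach : ℕ → Fin n → Fin n → Bool
  reach zero    u v = eqF u v
  reach (suc k) u v = reach k u v ∨ anyF n (λ w → reach k u w ∧ adj w v)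

  compRep : Fin n → Bool
  compRep v = not (anyF n (λ u → (toℕ u ℕ.<ᵇ toℕ v) ∧ reach n u v))

  components : ℕ
  components = countF n compRep

  -- R describes a finite simple graph embedded in the plane:
  -- rev is a fixed-point-free involution, rot is a permutation of the
  -- darts whose cycles are exactly the sets of darts at each vertex,
  -- no loops, no multiple edges, and Euler's formula
  -- V - E + F = 2·(#components) holds (E = D/2), i.e. every component
  -- of the rotation system has genus 0.
  record IsSimplePlane : Set where
    field
      rev-invol : ∀ d → rev (rev d) ≡ d
      rot-inj   : ∀ d e → rot d ≡ rot e → d ≡ e
      rot-tail  : ∀ d → tail (rot d) ≡ tail d
      rot-cycle : ∀ d e → tail d ≡ tail e → ∃ λ k → iter k rot d ≡ e
      noLoop    : ∀ d → head d ≢ tail d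
      noMulti   : ∀ d e → tail d ≡ tail e → head d ≡ head e → d ≡ e
      euler     : 2 * n + 2 * faces ≡ D + 4 * components

  nb : Fin D → ℕ → Fin n
  nb d i = head (iter i rot d)

  -- ⟨κ1,...,κ5⟩-star centred at v: deg v = 5 and, for some starting
  -- neighbour (dart d at v) and some orientation, the i-th neighbour
  -- has degree ≤ κi.
  IsStar : Bd → Bd → Bd → Bd → Bd → Fin n → Set
  IsStar k1 k2 k3 k4 k5 v =
    deg v ≡ 5 × (Σ (Fin D) λ d → tail d ≡ v ×
      ( (deg (nb d 0) ≤Bd k1 × deg (nb d 1) ≤Bd k2 × deg (nb d 2) ≤Bd k3
          × deg (nb d 3) ≤Bd k4 × deg (nb d 4) ≤Bd k5)
      ⊎ (deg (nb d 0) ≤Bd k1 × deg (nb d 4) ≤Bd k2 × deg (nb d 3) ≤Bd k3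
          × deg (nb d 2) ≤Bd k4 × deg (nb d 1) ≤Bd k5)))

  HasStar : Bd → Bd → Bd → Bd → Bd → Set
  HasStar k1 k2 k3 k4 k5 = Σ (Fin n) λ v → IsStar k1 k2 k3 k4 k5 v

  starWeight : Fin n → Fin D → ℕ
  starWeight v d = deg v + deg (nb d 0) + deg (nb d 1) + deg (nb d 2)
                     + deg (nb d 3) + deg (nb d 4)

  HasMinor5Star : ℕ → ℕ → Set
  HasMinor5Star w h = Σ (Fin n) λ v → Σ (Fin D) λ d → tail d ≡ v ×
    deg v ≡ 5 × starWeight v d ≤ w ×
    (deg v ≤ h × deg (nb d 0) ≤ h × deg (nb d 1) ≤ h × deg (nb d 2) ≤ h
       × deg (nb d 3) ≤ h × deg (nb d 4) ≤ h)

{-# OPTIONS --safe #-}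
-- Discharging.  A d-vertex has charge d - 6, a k-gonal face 2k - 6; by Euler's formula the total is negative.
-- Charge moves to the 5-vertices, in units of 1/168.  A vertex of degree at least 10 splits its charge evenly among its
-- edges: a neighbour of degree 5 takes its share, any other neighbour passes half of it to either side of the edge, across
-- triangular corners only.  A corner of a larger face brings at least 84.  If the theorem fails, the 5-vertices that this
-- leaves in need have neighbours y, x, u, M, w in cyclic order with deg u = deg w = 5 and deg y in {7, 8, 9}, up to a few
-- petty exceptions.  Such a payee gets an extra amount from y; vertices of degree 7, 8, 9 hold back some charge for this.
-- Fix the orientation.  Consecutive neighbours of y are not both payees.  If the next but one neighbour is a payee too,
-- then its x has degree 5 and, next to u, another neighbour q of large degree, so u, being adjacent to both M and q, has
-- charge to spare and pays in place of y (or x does, if the corner between q and u is not triangular).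
-- Hence y pays at most a third of its neighbours in each of the two orientations, which it can afford.
module Submission where

open import Defs
open import Data.Nat
open import Data.Nat.Properties hiding (_≟_)
open import Data.Nat.DivMod using (_/_)
open import Data.Nat.Induction using (<-rec)
open import Data.Nat.Tactic.RingSolver using (solve-∀)
open import Data.Fin as F using (Fin; toℕ; zero; suc; fromℕ<)
open import Data.Fin.Properties as Fₚ using (any?; pigeonhole; toℕ-injective; toℕ-fromℕ<; toℕ<n)
open import Data.Fin.Permutation using (Permutation′; permutation)
open import Data.Bool using (Bool; true; false; _∧_; _∨_; not; if_then_else_; T; T?)
open import Data.Bool.Properties using (T-∧; T-∨; T-≡)
open import Data.Empty using (⊥; ⊥-elim)
open import Data.Unit using (tt)
open import Data.Sum using (_⊎_; inj₁; inj₂; [_,_]′)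
open import Data.Product using (Σ; ∃; _×_; _,_; proj₁; proj₂)
open import Function using (_∘_)
open import Function.Bundles using (Equivalence)
open import Relation.Nullary using (¬_; yes; no; Dec; _×-dec_)
open import Relation.Nullary.Decidable using (toWitness; fromWitness)
open import Relation.Binary.Definitions using (tri<; tri≈; tri>)
open import Relation.Binary.PropositionalEquality
open import Algebra.Properties.Semiring.Sum +-*-semiring
  using (sum; sum-cong-≗; ∑-distrib-+; ∑-comm; sum-permute; *-distribˡ-sum)

-- The constants come from configurations without slack. For `y = 7` and `x ≤ 6` the forbidden stars
-- force M to have degree at least 24, and an edge from a 24-vertex carries 126, so 42 is lacking;
-- nothing is gained by letting larger vertices send more, hence the truncation. The paying end is
-- exact as well: four payments of 42 use up the charge of a 7-vertex, four of 28 what an 8-vertex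
-- holds back, six of 12 what a 9-vertex holds back. So two payees at distance two around y, in the
-- same orientation, cannot both be served by y, which is the reason for passing one of the payments
-- on to u or x. Such a substitute can pay because a neighbour of degree at least 17 delivers at
-- least 84, half of what a 5-vertex needs. Two of these, or one of these and a corner of a larger
-- face, cover the need of the substitute, and whatever such a neighbour delivers beyond 84 is free
-- to be handed on. A 7-vertex also serves petty neighbours, so counting payees is not enough there
-- and the patterns around it are searched.

gate : Bool → ℕ → ℕ
gate true  n = n
gate false n = 0

infixr 3 _⇒_
_⇒_ : Bool → Bool → Bool
p ⇒ q = not p ∨ q

∧⁻ : ∀ {p q} → T (p ∧ q) → T p × T q
∧⁻ = Equivalence.to T-∧

∧⁺ : ∀ {p q} → T p → T q → T (p ∧ q)
∧⁺ tp tq = Equivalence.from T-∧ (tp , tq)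

⇒⁻ : ∀ {p q} → T (p ⇒ q) → T p → T q
⇒⁻ {true} t _ = t

¬⇒T-not : ∀ {p} → ¬ T p → T (not p)
¬⇒T-not {true} ¬t = ⊥-elim (¬t tt)
¬⇒T-not {false} _ = tt

T-not⇒¬ : ∀ {p} → T (not p) → ¬ T p
T-not⇒¬ {false} _ ()

allBelow-sound : ∀ k {p i} → T (allBelow k p) → i < k → T (p i)
allBelow-sound (suc k) {p} t i<1+k with m≤n⇒m<n∨m≡n (s≤s⁻¹ i<1+k) | ∧⁻ t
... | inj₁ i<k  | t′ , _ = allBelow-sound k {p} t′ i<k
... | inj₂ refl | _ , t′ = t′

-- Degrees around a 5-vertex: income and exhaustive search

-- Degrees are truncated at 24, so in a plane graph of minimum degree 5 they range over [5, 24].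
Deg : ℕ → Set
Deg x = 5 ≤ x × x ≤ 24

opaque
  allDeg : (ℕ → Bool) → Bool
  allDeg p = allBelow 20 λ i → p (5 + i)

  allDeg-sound : ∀ p {x} → T (allDeg p) → Deg x → T (p x)
  allDeg-sound p t (5≤x , x≤24) =
    subst (λ y → T (p y)) (m+[n∸m]≡n 5≤x)
      (allBelow-sound 20 {λ i → p (5 + i)} t (s≤s (∸-monoˡ-≤ 5 x≤24)))

-- half d is half of what a d-vertex sends along each of its edges, in units of 1/168 of a charge.
-- Vertices of degree 7, 8, 9 send less than the even share 84 (d - 6) / d, because they pay an extra amount amt to payees.
half : ℕ → ℕ
half zero = 0
half d@(suc _) =
  if d ≤ᵇ 7 then 0 else if d ≡ᵇ 8 then 14 else if d ≡ᵇ 9 then 24 else (84 * (d ∸ 6)) / d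

ge6 : ℕ → ℕ
ge6 n = gate (6 ≤ᵇ n) 1

-- Weight at most 45 minus the 5 of the centre leaves 40 for the neighbours.
light : (a b c d e : ℕ) → Bool
light a b c d e =
  (a + b + c + d + e ≤ᵇ 40) ∧ (a ≤ᵇ 17) ∧ (b ≤ᵇ 17) ∧ (c ≤ᵇ 17) ∧ (d ≤ᵇ 17) ∧ (e ≤ᵇ 17)

-- Both forbidden stars in one position; their first, second and fourth bounds agree. All thresholds
-- are at most 23, so truncated degrees decide them correctly.
starred : (a b c d e : ℕ) → Bool
starred a b c d e =
  (a ≤ᵇ 5) ∧ (b ≤ᵇ 6) ∧ (d ≤ᵇ 5) ∧ ((c ≤ᵇ 6) ∨ ((c ≤ᵇ 7) ∧ (e ≤ᵇ 23)))

starred⟲ : (a b c d e : ℕ) → Bool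
starred⟲ a b c d e =
  starred a b c d e ∨ starred b c d e a ∨ starred c d e a b ∨ starred d e a b c ∨ starred e a b c d

excluded : (a b c d e : ℕ) → Bool
excluded a b c d e = light a b c d e ∨ starred⟲ a b c d e ∨ starred⟲ a e d c b

-- What the neighbour of degree `b`, between neighbours of degrees `a` and `c`, brings to the centre
-- when both corners are triangular: the full share `2 * half b` of its own edge and half a share
-- from each edge to a side neighbour of degree at least 6.
base : ℕ → ℕ → ℕ → ℕ
base a b c = half b * (2 + (ge6 a + ge6 c))

-- The tight cases, as degrees of (y, x, u, M, w): (7,6,5,24,5) gets 126 + 42, (7,7,5,17,5) gets 108
-- + 30 + 30 as both 7-vertices pay, (8,5,5,18,5) gets 112 + 28 + 28, and (9,5,5,17,5) gets 108 + 48
-- + 12. In each case the sum is 168.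
amt : ℕ → ℕ → ℕ
amt y x =
  if y ≡ᵇ 7 then (if x ≤ᵇ 6 then 42 else if x ≡ᵇ 7 then 30 else 0)
  else if y ≡ᵇ 8 then 28 else if y ≡ᵇ 9 then 12 else 0

isPay : (y x u M w : ℕ) → Bool
isPay y x u M w = (7 ≤ᵇ y) ∧ (y ≤ᵇ 9) ∧ (w ≡ᵇ 5) ∧ (u ≡ᵇ 5) ∧ (6 ≤ᵇ M)

pay : (y x u M w : ℕ) → ℕ
pay y x u M w = gate (isPay y x u M w) (amt y x)

15-17 : ℕ → Bool
15-17 n = (15 ≤ᵇ n) ∧ (n ≤ᵇ 17)

petty½ : (a b c d : ℕ) → Bool
petty½ a b c d = (15-17 a ∧ (b ≡ᵇ 5) ∧ (c ≤ᵇ 7) ∧ (d ≤ᵇ 7))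
  ∨ (15-17 b ∧ (a ≡ᵇ 5) ∧ (6 ≤ᵇ c) ∧ (c ≤ᵇ 7) ∧ (d ≤ᵇ 7))
  ∨ (15-17 b ∧ (c ≡ᵇ 5) ∧ (6 ≤ᵇ a) ∧ (a ≤ᵇ 7) ∧ (d ≤ᵇ 7))

-- A petty 5-vertex just fails to get 168 from its one large neighbour and takes 6 from each 7-neighbour.
petty : (y a b c d : ℕ) → Bool
petty y a b c d = (y ≡ᵇ 7) ∧ (petty½ a b c d ∨ petty½ d c b a)

cyc : ∀ {A : Set} → ((a b c d e : A) → ℕ) → (a b c d e : A) → ℕ
cyc f a b c d e = f a b c d e + (f b c d e a + (f c d e a b + (f d e a b c + f e a b c d)))

income : (a b c d e : ℕ) → ℕ
income a b c d e = base e a b + (pay a b c d e + pay a e d c b)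

petties : (a b c d e : ℕ) → ℕ
petties a b c d e = gate (petty a b c d e) 6

sufficient : (a b c d e : ℕ) → Bool
sufficient a b c d e = (168 ≤ᵇ cyc income a b c d e) ∨ excluded a b c d e ∨
  (168 ≤ᵇ (cyc income a b c d e + cyc petties a b c d e))

base₁ : ℕ → ℕ → ℕ
base₁ a b = half b * (2 + ge6 a)

-- An exhaustive search over the degrees of the five neighbours; lower bounds for the income cut off most branches.
search₂ : (a b : ℕ) → Bool
search₃ : (a b e : ℕ) → Bool
search₄ : (a b e c : ℕ) → Bool
search₄ a b e c =
  (168 ≤ᵇ base e a b + (base a b c + (base₁ b c + base₁ a e))) ∨ allDeg (λ d → sufficient a b c d e)
search₃ a b e = (168 ≤ᵇ base e a b + (base₁ a b + base₁ a e)) ∨ allDeg (search₄ a b e)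
search₂ a b = (168 ≤ᵇ base₁ b a + base₁ a b) ∨ allDeg (search₃ a b)

opaque
  unfolding allDeg

  search-true : allDeg (λ a → allDeg (search₂ a)) ≡ true
  search-true = refl

∨⁻ : ∀ {p q} → T (p ∨ q) → T p ⊎ T q
∨⁻ = Equivalence.to T-∨

cyc-mono : ∀ {A : Set} {f g : (a b c d e : A) → ℕ} → (∀ a b c d e → f a b c d e ≤ g a b c d e) →
  ∀ a b c d e → cyc f a b c d e ≤ cyc g a b c d e
cyc-mono f≤g a b c d e = +-mono-≤ (f≤g a b c d e) (+-mono-≤ (f≤g b c d e a)
  (+-mono-≤ (f≤g c d e a b) (+-mono-≤ (f≤g d e a b c) (f≤g e a b c d))))

base₁≤ˡ : ∀ a b c → base₁ a b ≤ base a b c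
base₁≤ˡ a b c = *-monoʳ-≤ (half b) (+-monoʳ-≤ 2 (m≤m+n (ge6 a) (ge6 c)))

base₁≤ʳ : ∀ a b c → base₁ a b ≤ base c b a
base₁≤ʳ a b c = *-monoʳ-≤ (half b) (+-monoʳ-≤ 2 (m≤n+m (ge6 a) (ge6 c)))

cycBase : (a b c d e : ℕ) → ℕ
cycBase = cyc λ a b c d e → base e a b

cycBase≤ : ∀ a b c d e → cycBase a b c d e ≤ cyc income a b c d e + cyc petties a b c d e
cycBase≤ a b c d e = ≤-trans (cyc-mono (λ a b c d e → m≤m+n (base e a b) (pay a b c d e + pay a e d c b)) a b c d e) (m≤m+n _ _)

T⁺ : ∀ {b} → b ≡ true → T b
T⁺ = Equivalence.from T-≡

prune : ∀ {n m q} {P : Set} → (n ≤ m → P) → (T q → P) → T ((n ≤ᵇ m) ∨ q) → P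
prune {n} {m} done continue t = [ (λ n≤m → done (≤ᵇ⇒≤ n m n≤m)) , continue ]′ (∨⁻ {n ≤ᵇ m} t)

-- Follows the branch of the search that belongs to the given degrees. Every cut-off bound lies
-- below `cycBase`, because neighbours not yet chosen count as contributing nothing.
triangulated-income : ∀ {a b c d e} → Deg a → Deg b → Deg c → Deg d → Deg e → ¬ T (excluded a b c d e) →
  168 ≤ cyc income a b c d e + cyc petties a b c d e
triangulated-income {a} {b} {c} {d} {e} da db dc dd de ¬x =
  prune {m = base₁ b a + base₁ a b} {q = allDeg (search₃ a b)}
    (λ p → via p (+-mono-≤ (base₁≤ʳ b a e) (m≤n⇒m≤n+o _ (base₁≤ˡ a b c))))
    (λ t → prune {m = base e a b + (base₁ a b + base₁ a e)} {q = allDeg (search₄ a b e)}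
      (λ p → via p (+-monoʳ-≤ (base e a b) (+-mono-≤ (base₁≤ˡ a b c)
        (m≤n⇒m≤o+n (base b c d) (m≤n⇒m≤o+n (base c d e) (base₁≤ʳ a e d))))))
      (λ t → prune {m = base e a b + (base a b c + (base₁ b c + base₁ a e))} {q = allDeg λ d → sufficient a b c d e}
        (λ p → via p (+-monoʳ-≤ (base e a b) (+-monoʳ-≤ (base a b c) (+-mono-≤ (base₁≤ˡ b c d)
          (m≤n⇒m≤o+n (base c d e) (base₁≤ʳ a e d))))))
        (λ t → prune {m = cyc income a b c d e}
          {q = excluded a b c d e ∨ (168 ≤ᵇ (cyc income a b c d e + cyc petties a b c d e))}
          (m≤n⇒m≤n+o _)
          (λ t → [ (λ x → ⊥-elim (¬x x)) , ≤ᵇ⇒≤ 168 _ ]′ (∨⁻ {excluded a b c d e} t))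
          (allDeg-sound (λ d → sufficient a b c d e) t dd))
        (allDeg-sound (search₄ a b e) t dc))
      (allDeg-sound (search₃ a b) t de))
    (allDeg-sound (search₂ a) (allDeg-sound (λ a → allDeg (search₂ a)) (T⁺ search-true) da) db)
  where
  via : ∀ {m} → 168 ≤ m → m ≤ cycBase a b c d e → 168 ≤ cyc income a b c d e + cyc petties a b c d e
  via p q = ≤-trans p (≤-trans q (cycBase≤ a b c d e))

-- A corner of a face that is not a triangle brings 84, so the neighbours need to supply only the other half.
light₁ : ℕ → Bool
light₂ : (a b : ℕ) → Bool
light₃ : (a b c : ℕ) → Bool
light₄ : (a b c d : ℕ) → Bool
light₄ a b c d = (42 ≤ᵇ half a + (half b + (half c + half d))) ∨ allDeg λ e →
  (42 ≤ᵇ half a + (half b + (half c + (half d + half e)))) ∨ light a b c d e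
light₃ a b c = (42 ≤ᵇ half a + (half b + half c)) ∨ allDeg (light₄ a b c)
light₂ a b = (42 ≤ᵇ half a + half b) ∨ allDeg (light₃ a b)
light₁ a = (42 ≤ᵇ half a) ∨ allDeg (light₂ a)

cycHalf : (a b c d e : ℕ) → ℕ
cycHalf = cyc λ a b c d e → half a

opaque
  unfolding allDeg

  light₁-true : allDeg light₁ ≡ true
  light₁-true = refl

-- Counts direct shares only, so that nothing depends on which of the corners are triangular.
half-income : ∀ {a b c d e} → Deg a → Deg b → Deg c → Deg d → Deg e → ¬ T (light a b c d e) →
  42 ≤ cycHalf a b c d e
half-income {a} {b} {c} {d} {e} da db dc dd de ¬l =
  prune {m = half a} {q = allDeg (light₂ a)} (m≤n⇒m≤n+o _)
  (λ t → prune {m = half a + half b} {q = allDeg (light₃ a b)}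
    (λ p → ≤-trans p (+-monoʳ-≤ (half a) (m≤m+n _ _)))
  (λ t → prune {m = half a + (half b + half c)} {q = allDeg (light₄ a b c)}
    (λ p → ≤-trans p (+-monoʳ-≤ (half a) (+-monoʳ-≤ (half b) (m≤m+n _ _))))
  (λ t → prune {m = half a + (half b + (half c + half d))} {q = allDeg (λ e → (42 ≤ᵇ half a + (half b + (half c + (half d + half e)))) ∨ light a b c d e)}
    (λ p → ≤-trans p (+-monoʳ-≤ (half a) (+-monoʳ-≤ (half b) (+-monoʳ-≤ (half c) (m≤m+n _ _)))))
  (λ t → prune {m = half a + (half b + (half c + (half d + half e)))} {q = light a b c d e}
    (λ p → p) (λ l → ⊥-elim (¬l l))
  (allDeg-sound (λ e → (42 ≤ᵇ half a + (half b + (half c + (half d + half e)))) ∨ light a b c d e) t de))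
  (allDeg-sound (light₄ a b c) t dd))
  (allDeg-sound (light₃ a b) t dc))
  (allDeg-sound (light₂ a) t db))
  (allDeg-sound light₁ (T⁺ light₁-true) da)

-- Gifts made by 5-vertices

-- The share of one edge beyond 84, which is half of the need of a 5-vertex.
spare : ℕ → ℕ
spare n = 2 * half n ∸ 84

data Kind : Set where
  five mid big other : Kind

isMid : ℕ → Bool
isMid n = (7 ≤ᵇ n) ∧ (n ≤ᵇ 9)

-- The threshold 17 is the least degree M can have for a payee whose x has degree 5; it is attained
-- at `y = 9`.
kind : ℕ → Kind
kind n = if n ≡ᵇ 5 then five else if 17 ≤ᵇ n then big else if isMid n then mid else other

-- The two ways in which a 5-vertex u makes a gift to a neighbour v.
-- Either v and x are consecutive neighbours of u with large neighbours M and q on both sides,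
gift₁ : (M v x q : Kind) → ℕ
gift₁ big five five big = 1
gift₁ _   _    _    _   = 0

-- or v, y, s, q, u are the neighbours in cyclic order and the corner between q and u is not in a triangle.
gift₂ : (v y s q u : Kind) → Bool → ℕ
gift₂ five mid five big five true = 1
gift₂ _    _   _    _   _    _    = 0

-- The flag of a neighbour tells whether the corner between it and the next neighbour in rotation
-- order fails to be triangular.
Flagged : Set → Set
Flagged A = A × Bool

gifts : (a b c d e : Flagged ℕ) → ℕ
gifts (a , ta) (b , tb) (c , tc) (d , td) (e , te) =
  gift₁ (kind e) (kind a) (kind b) (kind c) * spare e + gift₁ (kind b) (kind a) (kind e) (kind d) * spare b +
  (gift₂ (kind a) (kind b) (kind c) (kind d) (kind e) td * spare d +
   -- Read backwards, the corner between `c` and `b` is the one flagged at `b`.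
   gift₂ (kind a) (kind e) (kind d) (kind c) (kind b) tb * spare c)

-- How many gifts are charged to the neighbour a.
count : (a b c d e : Flagged Kind) → ℕ
count (a , ta) (b , _) (c , _) (d , _) (e , te) =
  gift₁ a b c d + gift₁ a e d c + (gift₂ c d e a b ta + gift₂ d c b a e te)

isBig : Kind → ℕ
isBig big = 1
isBig _ = 0

opening : Bool → ℕ
opening t = gate t 1

large : (a b c d e : Flagged Kind) → ℕ
large (a , ta) _ _ _ _ = isBig a + opening ta

opaque
  allBool : (Bool → Bool) → Bool
  allBool p = p true ∧ p false

  allBool-sound : ∀ p → T (allBool p) → ∀ b → T (p b)
  allBool-sound p t true = proj₁ (∧⁻ t)
  allBool-sound p t false = proj₂ (∧⁻ {p true} t)

  allKind : (Kind → Bool) → Bool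
  allKind p = p five ∧ p mid ∧ p big ∧ p other

  allKind-sound : ∀ p → T (allKind p) → ∀ k → T (p k)
  allKind-sound p t five = proj₁ (∧⁻ t)
  allKind-sound p t mid = proj₁ (∧⁻ (proj₂ (∧⁻ {p five} t)))
  allKind-sound p t big = proj₁ (∧⁻ (proj₂ (∧⁻ {p mid} (proj₂ (∧⁻ {p five} t)))))
  allKind-sound p t other = proj₂ (∧⁻ {p big} (proj₂ (∧⁻ {p mid} (proj₂ (∧⁻ {p five} t)))))

allFlagged : (Flagged Kind → Bool) → Bool
allFlagged p = allKind λ k → allBool λ b → p (k , b)

allFlagged-sound : ∀ p → T (allFlagged p) → ∀ x → T (p x)
allFlagged-sound p t (k , b) = allBool-sound (λ b → p (k , b)) (allKind-sound (λ k → allBool λ b → p (k , b)) t k) b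

-- The first part prevents the spare amount of a neighbour from being given away twice. The second
-- says that a centre making gifts has at least two sources of 84, big neighbours or open corners.
countOk₀ : (a b c d e : Flagged Kind) → Bool
countOk₀ a b c d e = (count a b c d e ≤ᵇ isBig (proj₁ a)) ∧
  ((cyc count a b c d e ≡ᵇ 0) ∨ (2 ≤ᵇ cyc large a b c d e))

countOk₁ : (a b c d : Flagged Kind) → Bool
countOk₁ a b c d = allFlagged (countOk₀ a b c d)
countOk₂ : (a b c : Flagged Kind) → Bool
countOk₂ a b c = allFlagged (countOk₁ a b c)
countOk₃ : (a b : Flagged Kind) → Bool
countOk₃ a b = allFlagged (countOk₂ a b)
countOk₄ : Flagged Kind → Bool
countOk₄ a = allFlagged (countOk₃ a)

opaque
  unfolding allKind allBool

  countOk-true : allFlagged countOk₄ ≡ true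
  countOk-true = refl

countOk : ∀ a b c d e → T (countOk₀ a b c d e)
countOk a b c d e = allFlagged-sound (countOk₀ a b c d) (allFlagged-sound (countOk₁ a b c)
  (allFlagged-sound (countOk₂ a b) (allFlagged-sound (countOk₃ a)
  (allFlagged-sound countOk₄ (T⁺ countOk-true) a) b) c) d) e

count≤big : ∀ a b c d e → count a b c d e ≤ isBig (proj₁ a)
count≤big a b c d e = ≤ᵇ⇒≤ _ _ (proj₁ (∧⁻ {count a b c d e ≤ᵇ isBig (proj₁ a)} (countOk a b c d e)))

count-or-large : ∀ a b c d e → cyc count a b c d e ≡ 0 ⊎ 2 ≤ cyc large a b c d e
count-or-large a b c d e = [ (λ t → inj₁ (≡ᵇ⇒≡ (cyc count a b c d e) 0 t)) , (λ t → inj₂ (≤ᵇ⇒≤ 2 _ t)) ]′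
  (∨⁻ {cyc count a b c d e ≡ᵇ 0} (proj₂ (∧⁻ {count a b c d e ≤ᵇ isBig (proj₁ a)} (countOk a b c d e))))

sum5-rotate : ∀ a b c d e → a + (b + (c + (d + e))) ≡ b + (c + (d + (e + a)))
sum5-rotate = solve-∀

sum5-+ : ∀ a b c d e a′ b′ c′ d′ e′ → (a + a′) + ((b + b′) + ((c + c′) + ((d + d′) + (e + e′)))) ≡
  (a + (b + (c + (d + e)))) + (a′ + (b′ + (c′ + (d′ + e′))))
sum5-+ = solve-∀

sum5-* : ∀ k a b c d e → k * a + (k * b + (k * c + (k * d + k * e))) ≡ k * (a + (b + (c + (d + e))))
sum5-* = solve-∀

module _ {A : Set} where
  private F = (a b c d e : A) → ℕ

  cyc-cong : ∀ {f g : F} → (∀ a b c d e → f a b c d e ≡ g a b c d e) → ∀ a b c d e → cyc f a b c d e ≡ cyc g a b c d e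
  cyc-cong f≡g a b c d e = cong₂ _+_ (f≡g a b c d e) (cong₂ _+_ (f≡g b c d e a)
    (cong₂ _+_ (f≡g c d e a b) (cong₂ _+_ (f≡g d e a b c) (f≡g e a b c d))))

  cyc-+ : ∀ (f g : F) a b c d e →
    cyc (λ a b c d e → f a b c d e + g a b c d e) a b c d e ≡ cyc f a b c d e + cyc g a b c d e
  cyc-+ f g a b c d e = sum5-+ (f a b c d e) (f b c d e a) (f c d e a b) (f d e a b c) (f e a b c d)
    (g a b c d e) (g b c d e a) (g c d e a b) (g d e a b c) (g e a b c d)

  cyc-* : ∀ k (f : F) a b c d e → cyc (λ a b c d e → k * f a b c d e) a b c d e ≡ k * cyc f a b c d e
  cyc-* k f a b c d e = sum5-* k (f a b c d e) (f b c d e a) (f c d e a b) (f d e a b c) (f e a b c d)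

  cyc-rotate : ∀ (f : F) a b c d e → cyc (λ a b c d e → f b c d e a) a b c d e ≡ cyc f a b c d e
  cyc-rotate f a b c d e =
    sym (sum5-rotate (f a b c d e) (f b c d e a) (f c d e a b) (f d e a b c) (f e a b c d))

flag : Flagged ℕ → Flagged Kind
flag (a , t) = kind a , t

dues : (a b c d e : Flagged ℕ) → ℕ
dues a b c d e = count (flag a) (flag b) (flag c) (flag d) (flag e) * spare (proj₁ a)

-- Double counting: gifts sorted by recipient against gifts sorted by the neighbour they are charged
-- to. Each of the four terms is re-rooted at that neighbour, which leaves a cyclic sum unchanged.
cyc-gifts : ∀ a b c d e → cyc gifts a b c d e ≡ cyc dues a b c d e
cyc-gifts a b c d e = begin
  cyc gifts a b c d e
    ≡⟨ split (λ a b c d e → g₁ e a b c d) (λ a b c d e → g₂ b c d e a) (λ a b c d e → g₃ d e a b c) (λ a b c d e → g₄ c d e a b) ⟩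
  cyc (λ a b c d e → g₁ e a b c d) a b c d e + cyc (λ a b c d e → g₂ b c d e a) a b c d e +
  (cyc (λ a b c d e → g₃ d e a b c) a b c d e + cyc (λ a b c d e → g₄ c d e a b) a b c d e)
    ≡⟨ cong₂ _+_ (cong₂ _+_ (r⁴ g₁) (r g₂)) (cong₂ _+_ (r³ g₃) (r² g₄)) ⟩
  cyc g₁ a b c d e + cyc g₂ a b c d e + (cyc g₃ a b c d e + cyc g₄ a b c d e)
    ≡⟨ sym (split g₁ g₂ g₃ g₄) ⟩
  cyc (λ a b c d e → g₁ a b c d e + g₂ a b c d e + (g₃ a b c d e + g₄ a b c d e)) a b c d e
    ≡⟨ cyc-cong (λ (a , ta) (b , _) (c , _) (d , _) (e , te) → distrib (spare a)
        (gift₁ (kind a) (kind b) (kind c) (kind d)) (gift₁ (kind a) (kind e) (kind d) (kind c))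
        (gift₂ (kind c) (kind d) (kind e) (kind a) (kind b) ta) (gift₂ (kind d) (kind c) (kind b) (kind a) (kind e) te)) a b c d e ⟩
  cyc dues a b c d e ∎
  where
  open ≡-Reasoning
  g₁ g₂ g₃ g₄ : (a b c d e : Flagged ℕ) → ℕ
  g₁ (a , _) (b , _) (c , _) (d , _) (e , _) = gift₁ (kind a) (kind b) (kind c) (kind d) * spare a
  g₂ (a , _) (b , _) (c , _) (d , _) (e , _) = gift₁ (kind a) (kind e) (kind d) (kind c) * spare a
  g₃ (a , t) (b , _) (c , _) (d , _) (e , _) = gift₂ (kind c) (kind d) (kind e) (kind a) (kind b) t * spare a
  g₄ (a , _) (b , _) (c , _) (d , _) (e , t) = gift₂ (kind d) (kind c) (kind b) (kind a) (kind e) t * spare a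
  split : ∀ f₁ f₂ f₃ f₄ →
    cyc (λ a b c d e → f₁ a b c d e + f₂ a b c d e + (f₃ a b c d e + f₄ a b c d e)) a b c d e ≡
    cyc f₁ a b c d e + cyc f₂ a b c d e + (cyc f₃ a b c d e + cyc f₄ a b c d e)
  split f₁ f₂ f₃ f₄ = trans (cyc-+ (λ a b c d e → f₁ a b c d e + f₂ a b c d e) (λ a b c d e → f₃ a b c d e + f₄ a b c d e) a b c d e) (cong₂ _+_ (cyc-+ f₁ f₂ a b c d e) (cyc-+ f₃ f₄ a b c d e))
  r : ∀ f → cyc (λ a b c d e → f b c d e a) a b c d e ≡ cyc f a b c d e
  r f = cyc-rotate f a b c d e
  r² : ∀ f → cyc (λ a b c d e → f c d e a b) a b c d e ≡ cyc f a b c d e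
  r² f = trans (r (λ a b c d e → f b c d e a)) (r f)
  r³ : ∀ f → cyc (λ a b c d e → f d e a b c) a b c d e ≡ cyc f a b c d e
  r³ f = trans (r (λ a b c d e → f c d e a b)) (r² f)
  r⁴ : ∀ f → cyc (λ a b c d e → f e a b c d) a b c d e ≡ cyc f a b c d e
  r⁴ f = trans (r (λ a b c d e → f d e a b c)) (r³ f)
  distrib : ∀ s k l m n → k * s + l * s + (m * s + n * s) ≡ (k + l + (m + n)) * s
  distrib = solve-∀

opens : (a b c d e : Flagged ℕ) → ℕ
opens (_ , t) _ _ _ _ = opening t

twiceHalf : (a b c d e : Flagged ℕ) → ℕ
twiceHalf (a , _) _ _ _ _ = 2 * half a

halfBig : ℕ → Bool
halfBig a = 84 * isBig (kind a) ≤ᵇ 2 * half a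
opaque
  unfolding allDeg
  halfBig-true : allDeg halfBig ≡ true
  halfBig-true = refl

Deg₂ : Flagged ℕ → Set
Deg₂ (a , _) = Deg a

-- A big neighbour keeps 84 for the centre and gives away its spare amount at most once; the other
-- kinds are charged nothing.
due≤ : ∀ a b c d e → Deg₂ a → 84 * isBig (kind (proj₁ a)) + dues a b c d e ≤ 2 * half (proj₁ a)
due≤ a b c d e da = lemma (isBig (kind (proj₁ a))) (isBig≤1 (kind (proj₁ a)))
    (≤ᵇ⇒≤ _ _ (allDeg-sound halfBig (T⁺ halfBig-true) da))
    (count≤big (flag a) (flag b) (flag c) (flag d) (flag e))
  where
  isBig≤1 : ∀ k → isBig k ≤ 1
  isBig≤1 five = z≤n
  isBig≤1 mid = z≤n
  isBig≤1 big = ≤-refl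
  isBig≤1 other = z≤n
  lemma : ∀ i → i ≤ 1 → ∀ {g k} → 84 * i ≤ g → k ≤ i → 84 * i + k * (g ∸ 84) ≤ g
  lemma zero _ _ z≤n = z≤n
  lemma (suc zero) _ 84≤g z≤n = 84≤g
  lemma (suc zero) _ {g} 84≤g (s≤s z≤n) = ≤-reflexive (trans (cong (84 +_) (+-identityʳ (g ∸ 84))) (m+[n∸m]≡n 84≤g))
  lemma (suc (suc _)) (s≤s ())

counts : (a b c d e : Flagged ℕ) → ℕ
counts a b c d e = count (flag a) (flag b) (flag c) (flag d) (flag e)

bigs : (a b c d e : Flagged ℕ) → ℕ
bigs a _ _ _ _ = isBig (kind (proj₁ a))

cyc-dues-zero : ∀ a b c d e → cyc counts a b c d e ≡ 0 → cyc dues a b c d e ≡ 0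
cyc-dues-zero a b c d e none = zeros (counts a b c d e) (counts b c d e a) (counts c d e a b) (counts d e a b c) (counts e a b c d)
    (spare (proj₁ a)) (spare (proj₁ b)) (spare (proj₁ c)) (spare (proj₁ d)) (spare (proj₁ e)) none
  where
  zeros : ∀ k l m n o s s₁ s₂ s₃ s₄ → k + (l + (m + (n + o))) ≡ 0 →
    k * s + (l * s₁ + (m * s₂ + (n * s₃ + o * s₄))) ≡ 0
  zeros zero zero zero zero zero _ _ _ _ _ _ = refl

-- By `due≤` every big neighbour retains 84 after the gifts, and so does every open corner; two of
-- them make up 168.
gifts-affordable : ∀ a b c d e → Deg₂ a → Deg₂ b → Deg₂ c → Deg₂ d → Deg₂ e →
  168 + cyc gifts a b c d e ≤ cyc twiceHalf a b c d e + 84 * cyc opens a b c d e ⊎ cyc gifts a b c d e ≡ 0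
gifts-affordable a b c d e da db dc dd de =
  [ (λ none → inj₂ (trans (cyc-gifts a b c d e) (cyc-dues-zero a b c d e none)))
  , (λ two → inj₁ (enough two)) ]′ (count-or-large (flag a) (flag b) (flag c) (flag d) (flag e))
  where
  open ≤-Reasoning
  rearrange : ∀ {B O D} → D + 84 * (B + O) ≡ 84 * B + D + 84 * O
  rearrange {B} {O} {D} = eq B O D
    where
    eq : ∀ B O D → D + 84 * (B + O) ≡ 84 * B + D + 84 * O
    eq = solve-∀
  dues+bigs≤ : 84 * cyc bigs a b c d e + cyc dues a b c d e ≤ cyc twiceHalf a b c d e
  dues+bigs≤ = begin
    84 * cyc bigs a b c d e + cyc dues a b c d e
      ≡⟨ cong (_+ cyc dues a b c d e) (sym (cyc-* 84 bigs a b c d e)) ⟩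
    cyc (λ a b c d e → 84 * bigs a b c d e) a b c d e + cyc dues a b c d e
      ≡⟨ sym (cyc-+ (λ a b c d e → 84 * bigs a b c d e) dues a b c d e) ⟩
    cyc (λ a b c d e → 84 * bigs a b c d e + dues a b c d e) a b c d e
      ≤⟨ +-mono-≤ (due≤ a b c d e da) (+-mono-≤ (due≤ b c d e a db) (+-mono-≤ (due≤ c d e a b dc)
        (+-mono-≤ (due≤ d e a b c dd) (due≤ e a b c d de)))) ⟩
    cyc twiceHalf a b c d e ∎
  enough : 2 ≤ cyc (λ a b c d e → bigs a b c d e + opens a b c d e) a b c d e →
    168 + cyc gifts a b c d e ≤ cyc twiceHalf a b c d e + 84 * cyc opens a b c d e
  enough two = begin
    168 + cyc gifts a b c d e
      ≡⟨ cong (168 +_) (cyc-gifts a b c d e) ⟩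
    168 + cyc dues a b c d e
      ≤⟨ +-monoˡ-≤ (cyc dues a b c d e) (*-monoʳ-≤ 84 two) ⟩
    84 * cyc (λ a b c d e → bigs a b c d e + opens a b c d e) a b c d e + cyc dues a b c d e
      ≡⟨ +-comm _ (cyc dues a b c d e) ⟩
    cyc dues a b c d e + 84 * cyc (λ a b c d e → bigs a b c d e + opens a b c d e) a b c d e
      ≡⟨ cong (λ z → cyc dues a b c d e + 84 * z) (cyc-+ bigs opens a b c d e) ⟩
    cyc dues a b c d e + 84 * (cyc bigs a b c d e + cyc opens a b c d e)
      ≡⟨ rearrange {cyc bigs a b c d e} {cyc opens a b c d e} {cyc dues a b c d e} ⟩
    84 * cyc bigs a b c d e + cyc dues a b c d e + 84 * cyc opens a b c d e
      ≤⟨ +-monoˡ-≤ (84 * cyc opens a b c d e) dues+bigs≤ ⟩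
    cyc twiceHalf a b c d e + 84 * cyc opens a b c d e ∎

-- Degree bounds for payees and petty vertices

resolve : ∀ {p q} → T (p ∨ q) → ¬ T p → T q
resolve {false} t _ = t
resolve {true} _ ¬t = ⊥-elim (¬t tt)

bigᵇ giverᵇ : (y M : ℕ) → Bool
bigᵇ y M = isMid y ⇒ excluded y 5 5 M 5 ∨ (17 ≤ᵇ M)
giverᵇ y M = isMid y ⇒ excluded y 5 5 M 5 ∨ (amt y 5 ≤ᵇ spare M)

payee₂₄ᵇ : (x M : ℕ) → Bool
payee₂₄ᵇ x M = (x ≤ᵇ 6) ⇒ excluded 7 x 5 M 5 ∨ (24 ≤ᵇ M)

petty₁ᵇ : (c d M : ℕ) → Bool
petty₁ᵇ c d M = (24 ≤ᵇ M) ⇒ not (petty 7 5 M c d)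

petty₂ᵇ : (s q : ℕ) → Bool
petty₂ᵇ s q = petty 7 s q 5 5 ⇒ excluded 7 s q 5 5 ∨ (17 ≤ᵇ q)

petty₃ᵇ : (x M : ℕ) → Bool
petty₃ᵇ x M = (x ≤ᵇ 7) ⇒ not (petty 7 x 5 M 5)

opaque
  unfolding allDeg

  bigᵇ-true : allDeg (λ y → allDeg (bigᵇ y)) ≡ true
  bigᵇ-true = refl

  giverᵇ-true : allDeg (λ y → allDeg (giverᵇ y)) ≡ true
  giverᵇ-true = refl

  payee₂₄ᵇ-true : allDeg (λ x → allDeg (payee₂₄ᵇ x)) ≡ true
  payee₂₄ᵇ-true = refl

  petty₁ᵇ-true : allDeg (λ c → allDeg λ d → allDeg (petty₁ᵇ c d)) ≡ true
  petty₁ᵇ-true = refl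

  petty₂ᵇ-true : allDeg (λ s → allDeg (petty₂ᵇ s)) ≡ true
  petty₂ᵇ-true = refl

  petty₃ᵇ-true : allDeg (λ x → allDeg (petty₃ᵇ x)) ≡ true
  petty₃ᵇ-true = refl

all₂ : ∀ (p : ℕ → ℕ → Bool) → allDeg (λ x → allDeg (p x)) ≡ true → ∀ {x y} → Deg x → Deg y → T (p x y)
all₂ p eq {x} dx dy = allDeg-sound (p x) (allDeg-sound (λ x → allDeg (p x)) (T⁺ eq) dx) dy

payee-big : ∀ {y M} → Deg y → Deg M → T (isMid y) → ¬ T (excluded y 5 5 M 5) → 17 ≤ M
payee-big {y} {M} dy dM m ¬x = ≤ᵇ⇒≤ 17 M (resolve {excluded y 5 5 M 5} (⇒⁻ {isMid y} (all₂ bigᵇ bigᵇ-true dy dM) m) ¬x)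

-- For `y` = 7, 8, 9 the exclusions force `M` to be at least 24, 18, 17, with spare amounts 42, 28,
-- 24 against payments of 42, 28, 12.
payment≤spare : ∀ {y M} → Deg y → Deg M → T (isMid y) → ¬ T (excluded y 5 5 M 5) → amt y 5 ≤ spare M
payment≤spare {y} {M} dy dM m ¬x = ≤ᵇ⇒≤ (amt y 5) (spare M)
  (resolve {excluded y 5 5 M 5} (⇒⁻ {isMid y} (all₂ giverᵇ giverᵇ-true dy dM) m) ¬x)

payee₇-24 : ∀ {x M} → Deg x → Deg M → T (x ≤ᵇ 6) → ¬ T (excluded 7 x 5 M 5) → 24 ≤ M
payee₇-24 {x} {M} dx dM x≤6 ¬x = ≤ᵇ⇒≤ 24 M (resolve {excluded 7 x 5 M 5} (⇒⁻ {x ≤ᵇ 6} (all₂ payee₂₄ᵇ payee₂₄ᵇ-true dx dM) x≤6) ¬x)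

¬petty-24 : ∀ {M c d} → Deg M → Deg c → Deg d → 24 ≤ M → ¬ T (petty 7 5 M c d)
¬petty-24 {M} {c} {d} dM dc dd 24≤M = T-not⇒¬ (⇒⁻ {24 ≤ᵇ M}
  (allDeg-sound (petty₁ᵇ c d) (all₂ (λ c d → allDeg (petty₁ᵇ c d)) petty₁ᵇ-true dc dd) dM) (≤⇒≤ᵇ 24≤M))

-- The weight bound leaves only the degrees 7, 7, 17, 5, 5.
petty-17 : ∀ {s q} → Deg s → Deg q → T (petty 7 s q 5 5) → ¬ T (excluded 7 s q 5 5) → 17 ≤ q
petty-17 {s} {q} ds dq p ¬x = ≤ᵇ⇒≤ 17 q (resolve {excluded 7 s q 5 5} (⇒⁻ {petty 7 s q 5 5} (all₂ petty₂ᵇ petty₂ᵇ-true ds dq) p) ¬x)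

¬petty-payee : ∀ {x M} → Deg x → Deg M → x ≤ 7 → ¬ T (petty 7 x 5 M 5)
¬petty-payee {x} dx dM x≤7 = T-not⇒¬ (⇒⁻ {x ≤ᵇ 7} (all₂ petty₃ᵇ petty₃ᵇ-true dx dM) (≤⇒≤ᵇ x≤7))

-- Demands around a 7-vertex

-- The demands of the neighbours of a 7-vertex on that vertex:
-- payees R₆, R₇ with one orientation, payees L₆, L₇ with the other (the index bounds the degree of x), petty vertices, or no demand.
data Demand : Set where
  idle R₆ R₇ L₆ L₇ scant : Demand

demand : Demand → ℕ
demand idle  = 0
demand R₆  = 42
demand R₇ = 30
demand L₆  = 42
demand L₇ = 30
demand scant  = 6

right left : Demand → Bool
right R₆ = true
right R₇ = true
right _ = false
left L₆ = true
left L₇ = true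
left _ = false

isR₆ isR₇ isL₆ isL₇ isScant active : Demand → Bool
isR₆ R₆ = true
isR₆ _ = false
isR₇ R₇ = true
isR₇ _ = false
isL₆ L₆ = true
isL₆ _ = false
isL₇ L₇ = true
isL₇ _ = false
isScant scant = true
isScant _ = false
active idle = false
active _ = true

-- Compatibility at distance two and one, with `b` after `a` in rotation order. The neighbour before
-- an `R₇` and the one after an `L₇` is the vertex x of degree 7, which demands nothing.
next₂ next₁ : (a b : Demand) → Bool
next₂ a b = not (right a ∧ right b) ∧ not (left a ∧ left b)
next₁ a b = next₂ a b ∧ not (isR₆ a ∧ isScant b) ∧ not (isScant a ∧ isR₆ b) ∧ not (isL₆ a ∧ isScant b) ∧
  not (isScant a ∧ isL₆ b) ∧ not (active a ∧ isR₇ b) ∧ not (isL₇ a ∧ active b)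

opaque
  allDemand : (Demand → Bool) → Bool
  allDemand p = p idle ∧ p R₆ ∧ p R₇ ∧ p L₆ ∧ p L₇ ∧ p scant

  allDemand-sound : ∀ p → T (allDemand p) → ∀ s → T (p s)
  allDemand-sound p t = λ
    { idle → proj₁ (∧⁻ t)
    ; R₆ → proj₁ (∧⁻ t₁)
    ; R₇ → proj₁ (∧⁻ t₂)
    ; L₆ → proj₁ (∧⁻ t₃)
    ; L₇ → proj₁ (∧⁻ t₄)
    ; scant → proj₂ (∧⁻ {p L₇} t₄) }
    where
    t₁ : T (p R₆ ∧ p R₇ ∧ p L₆ ∧ p L₇ ∧ p scant)
    t₁ = proj₂ (∧⁻ {p idle} t)
    t₂ : T (p R₇ ∧ p L₆ ∧ p L₇ ∧ p scant)
    t₂ = proj₂ (∧⁻ {p R₆} t₁)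
    t₃ : T (p L₆ ∧ p L₇ ∧ p scant)
    t₃ = proj₂ (∧⁻ {p R₇} t₂)
    t₄ : T (p L₇ ∧ p scant)
    t₄ = proj₂ (∧⁻ {p L₆} t₃)

module Heptagon where
  h₇ : (a b c d e f g : Demand) → Bool
  h₇ a b c d e f g = next₁ f g ∧ next₂ e g ⇒ next₁ g a ∧ next₂ f a ∧ next₂ g b ⇒
    demand a + (demand b + (demand c + (demand d + (demand e + (demand f + demand g))))) ≤ᵇ 168
  h₆ : (a b c d e f : Demand) → Bool
  h₆ a b c d e f = next₁ e f ∧ next₂ d f ⇒ allDemand (h₇ a b c d e f)
  h₅ : (a b c d e : Demand) → Bool
  h₅ a b c d e = next₁ d e ∧ next₂ c e ⇒ allDemand (h₆ a b c d e)
  h₄ : (a b c d : Demand) → Bool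
  h₄ a b c d = next₁ c d ∧ next₂ b d ⇒ allDemand (h₅ a b c d)
  h₃ : (a b c : Demand) → Bool
  h₃ a b c = next₁ b c ∧ next₂ a c ⇒ allDemand (h₄ a b c)
  h₂ : (a b : Demand) → Bool
  h₂ a b = next₁ a b ⇒ allDemand (h₃ a b)
  h₁ : Demand → Bool
  h₁ a = allDemand (h₂ a)

  opaque
    unfolding allDemand

    h₁-true : allDemand h₁ ≡ true
    h₁-true = refl

open Heptagon

-- Payees of one orientation are at distance at least three, so there are at most two of them, and
-- 168 = 4 · 42 is reached without petty vertices. These fit in only because they are never next to
-- a demand of 42, and a demand of 30 forces an idle neighbour.
heptagon : ∀ a b c d e f g →
  T (next₁ a b) → T (next₁ b c) → T (next₁ c d) → T (next₁ d e) → T (next₁ e f) → T (next₁ f g) → T (next₁ g a) →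
  T (next₂ a c) → T (next₂ b d) → T (next₂ c e) → T (next₂ d f) → T (next₂ e g) → T (next₂ f a) → T (next₂ g b) →
  demand a + (demand b + (demand c + (demand d + (demand e + (demand f + demand g))))) ≤ 168
heptagon a b c d e f g ab bc cd de ef fg ga ac bd ce df eg fa gb = ≤ᵇ⇒≤ _ 168 t₇′
  where
  t₂ : T (allDemand (h₃ a b))
  t₂ = ⇒⁻ {next₁ a b} (allDemand-sound (h₂ a) (allDemand-sound h₁ (T⁺ h₁-true) a) b) ab
  t₃ : T (allDemand (h₄ a b c))
  t₃ = ⇒⁻ {next₁ b c ∧ next₂ a c} (allDemand-sound (h₃ a b) t₂ c) (∧⁺ bc ac)
  t₄ : T (allDemand (h₅ a b c d))
  t₄ = ⇒⁻ {next₁ c d ∧ next₂ b d} (allDemand-sound (h₄ a b c) t₃ d) (∧⁺ cd bd)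
  t₅ : T (allDemand (h₆ a b c d e))
  t₅ = ⇒⁻ {next₁ d e ∧ next₂ c e} (allDemand-sound (h₅ a b c d) t₄ e) (∧⁺ de ce)
  t₆ : T (allDemand (h₇ a b c d e f))
  t₆ = ⇒⁻ {next₁ e f ∧ next₂ d f} (allDemand-sound (h₆ a b c d e) t₅ f) (∧⁺ ef df)
  t₇ : T (next₁ g a ∧ next₂ f a ∧ next₂ g b ⇒
    demand a + (demand b + (demand c + (demand d + (demand e + (demand f + demand g))))) ≤ᵇ 168)
  t₇ = ⇒⁻ {next₁ f g ∧ next₂ e g} (allDemand-sound (h₇ a b c d e f) t₆ g) (∧⁺ fg eg)
  t₇′ : T (demand a + (demand b + (demand c + (demand d + (demand e + (demand f + demand g))))) ≤ᵇ 168)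
  t₇′ = ⇒⁻ {next₁ g a ∧ next₂ f a ∧ next₂ g b} t₇ (∧⁺ ga (∧⁺ fa gb))

-- Even shares of large vertices

affordᵇ : ℕ → Bool
affordᵇ d = (6 ≤ᵇ d) ⇒ (1008 + d * (2 * half d) ≤ᵇ 168 * d)

opaque
  unfolding allDeg

  affordᵇ-true : allDeg affordᵇ ≡ true
  affordᵇ-true = refl

-- For `x = 42` the coefficients become 1008, 126 = `2 * half 24` and 168: this is the budget at
-- degree `24 + k`, with the share frozen at that of degree 24.
large-affordable : ∀ x k → 24 * x + (24 + k) * (3 * x) ≤ 4 * x * (24 + k)
large-affordable x k = ≤-trans (m≤m+n (24 * x + (24 + k) * (3 * x)) (k * x)) (≤-reflexive (eq x k))
  where
  eq : ∀ x k → 24 * x + (24 + k) * (3 * x) + k * x ≡ 4 * x * (24 + k)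
  eq = solve-∀

half-affordable : ∀ d → 6 ≤ d → 1008 + d * (2 * half (d ⊓ 24)) ≤ 168 * d
half-affordable d 6≤d = [ small , (λ 24≤d → subst Affordable (m+[n∸m]≡n {24} {d} 24≤d) (huge (d ∸ 24))) ]′ (≤-total d 24)
  where
  Affordable : ℕ → Set
  Affordable d = 1008 + d * (2 * half (d ⊓ 24)) ≤ 168 * d
  small : d ≤ 24 → Affordable d
  small d≤24 = subst (λ t → 1008 + d * (2 * half t) ≤ 168 * d) (sym (m≤n⇒m⊓n≡m d≤24))
    (≤ᵇ⇒≤ (1008 + d * (2 * half d)) (168 * d)
      (⇒⁻ {6 ≤ᵇ d} (allDeg-sound affordᵇ (T⁺ affordᵇ-true) (≤-trans (n≤1+n 5) 6≤d , d≤24)) (≤⇒≤ᵇ 6≤d)))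
  huge : ∀ k → Affordable (24 + k)
  huge k = subst (λ t → 1008 + (24 + k) * (2 * half t) ≤ 168 * (24 + k)) (sym (m≥n⇒m⊓n≡n (m≤m+n 24 k))) (large-affordable 42 k)

giver₂ᵇ big₂ᵇ : (y M : ℕ) → Bool
giver₂ᵇ y M = isMid y ⇒ excluded y 5 M 5 5 ∨ (amt y 5 ≤ᵇ spare M)
big₂ᵇ y M = isMid y ⇒ excluded y 5 M 5 5 ∨ (17 ≤ᵇ M)

opaque
  unfolding allDeg

  giver₂ᵇ-true : allDeg (λ y → allDeg (giver₂ᵇ y)) ≡ true
  giver₂ᵇ-true = refl

  big₂ᵇ-true : allDeg (λ y → allDeg (big₂ᵇ y)) ≡ true
  big₂ᵇ-true = refl

-- The same bounds for a second arrangement, which occurs around x (with q in the role of `M`) and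
-- around w.
payment≤spare₂ : ∀ {y M} → Deg y → Deg M → T (isMid y) → ¬ T (excluded y 5 M 5 5) → amt y 5 ≤ spare M
payment≤spare₂ {y} {M} dy dM m ¬x = ≤ᵇ⇒≤ (amt y 5) (spare M)
  (resolve {excluded y 5 M 5 5} (⇒⁻ {isMid y} (all₂ giver₂ᵇ giver₂ᵇ-true dy dM) m) ¬x)

payee-big₂ : ∀ {y M} → Deg y → Deg M → T (isMid y) → ¬ T (excluded y 5 M 5 5) → 17 ≤ M
payee-big₂ {y} {M} dy dM m ¬x = ≤ᵇ⇒≤ 17 M
  (resolve {excluded y 5 M 5 5} (⇒⁻ {isMid y} (all₂ big₂ᵇ big₂ᵇ-true dy dM) m) ¬x)

-- From degrees to kinds

kind-big : ∀ {q} → 17 ≤ q → kind q ≡ big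
kind-big {q} 17≤q = subst (λ q → kind q ≡ big) (m+[n∸m]≡n 17≤q) refl

kind-mid : ∀ {y} → T (isMid y) → kind y ≡ mid
kind-mid {7} _ = refl
kind-mid {8} _ = refl
kind-mid {9} _ = refl
kind-mid {suc (suc (suc (suc (suc (suc (suc (suc (suc (suc _)))))))))} t with () ← t

gift₁≤ : ∀ {z M v x q} → 17 ≤ M → v ≡ 5 → x ≡ 5 → 17 ≤ q → z ≤ spare M →
  z ≤ gift₁ (kind M) (kind v) (kind x) (kind q) * spare M
gift₁≤ {z} {M} {q = q} 17≤M refl refl 17≤q z≤ =
  subst₂ (λ k l → z ≤ gift₁ k five five l * spare M) (sym (kind-big 17≤M)) (sym (kind-big 17≤q))
    (≤-trans z≤ (≤-reflexive (sym (+-identityʳ (spare M)))))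

gift₂≤ : ∀ {z v y s q u t} → v ≡ 5 → T (isMid y) → s ≡ 5 → 17 ≤ q → u ≡ 5 → T t → z ≤ spare q →
  z ≤ gift₂ (kind v) (kind y) (kind s) (kind q) (kind u) t * spare q
gift₂≤ {z} {y = y} {q = q} {t = true} refl m refl 17≤q refl _ z≤ =
  subst₂ (λ k l → z ≤ gift₂ five k five l five true * spare q) (sym (kind-mid {y} m)) (sym (kind-big 17≤q))
    (≤-trans z≤ (≤-reflexive (sym (+-identityʳ (spare q)))))

-- Finite sums and orbits

gate-≤ : ∀ b n → gate b n ≤ n
gate-≤ true n = ≤-refl
gate-≤ false n = z≤n

gate-bound : ∀ {b a m} → (T b → a ≤ m) → gate b a ≤ m
gate-bound {true} f = f tt
gate-bound {false} f = z≤n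

gate-mono : ∀ b {m k} → (T b → m ≤ k) → gate b m ≤ gate b k
gate-mono true f = f tt
gate-mono false f = z≤n

gate-+ : ∀ b m k → gate b (m + k) ≡ gate b m + gate b k
gate-+ true m k = refl
gate-+ false m k = refl

gate-* : ∀ b k m → gate b (k * m) ≡ k * gate b m
gate-* true k m = refl
gate-* false k m = sym (*-zeroʳ k)

sum-mono : ∀ {n} {f g : Fin n → ℕ} → (∀ i → f i ≤ g i) → sum f ≤ sum g
sum-mono {zero} _ = z≤n
sum-mono {suc n} f≤g = +-mono-≤ (f≤g zero) (sum-mono (f≤g ∘ suc))

sum-zero : ∀ n → sum {n} (λ _ → 0) ≡ 0
sum-zero zero = refl
sum-zero (suc n) = sum-zero n

eqF⁻ : ∀ {n} {i j : Fin n} → T (eqF i j) → i ≡ j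
eqF⁻ = toWitness

eqF⁺ : ∀ {n} {i j : Fin n} → i ≡ j → T (eqF i j)
eqF⁺ = fromWitness

T-iff : ∀ {p q} → (T p → T q) → (T q → T p) → p ≡ q
T-iff {true} {true} _ _ = refl
T-iff {false} {false} _ _ = refl
T-iff {true} {false} f _ = ⊥-elim (f tt)
T-iff {false} {true} _ g = ⊥-elim (g tt)

eqF-sym : ∀ {n} (i j : Fin n) → eqF i j ≡ eqF j i
eqF-sym i j = T-iff (λ t → eqF⁺ (sym (eqF⁻ {i = i} t))) (λ t → eqF⁺ (sym (eqF⁻ {i = j} t)))

gate-true : ∀ {p n} → T p → gate p n ≡ n
gate-true {true} _ = refl

gate-false : ∀ {p n} → ¬ T p → gate p n ≡ 0
gate-false {true} ¬t = ⊥-elim (¬t tt)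
gate-false {false} _ = refl

sum-single : ∀ {n} (j : Fin n) (f : Fin n → ℕ) → sum (λ i → gate (eqF i j) (f i)) ≡ f j
sum-single {suc n} zero f = trans (cong (f zero +_) (sum-zero n)) (+-identityʳ (f zero))
sum-single {suc n} (suc j) f =
  trans (sum-cong-≗ (λ i → cong (λ b → gate b (f (suc i))) (T-iff (λ t → eqF⁺ (Fₚ.suc-injective (eqF⁻ {i = suc i} {suc j} t))) (λ t → eqF⁺ {i = suc i} (cong suc (eqF⁻ t))))))
    (sum-single j (f ∘ suc))

countF-sum : ∀ n p → countF n p ≡ sum {n} (λ i → gate (p i) 1)
countF-sum zero p = refl
countF-sum (suc n) p with p zero
... | true  = cong suc (countF-sum n (p ∘ suc))
... | false = countF-sum n (p ∘ suc)

-- Each `f (g i)` is spread out as a sum supported at the single point `g i`; exchanging the sums,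
-- injectivity leaves one term in each column of the image.
sum-image : ∀ {k n} (g : Fin k → Fin n) (p : Fin n → Bool) (f : Fin n → ℕ) →
  (∀ i j → g i ≡ g j → i ≡ j) → (∀ i → T (p (g i))) → (∀ x → T (p x) → ∃ λ i → g i ≡ x) →
  sum (λ i → f (g i)) ≡ sum (λ x → gate (p x) (f x))
sum-image {k} {n} g p f g-inj g∈p p⊆g = begin
  sum (λ i → f (g i))                                ≡⟨ sum-cong-≗ (λ i → sym (sum-single (g i) f)) ⟩
  sum (λ i → sum (λ x → gate (eqF x (g i)) (f x)))    ≡⟨ ∑-comm (λ i x → gate (eqF x (g i)) (f x)) ⟩
  sum (λ x → sum (λ i → gate (eqF x (g i)) (f x)))    ≡⟨ sum-cong-≗ column ⟩
  sum (λ x → gate (p x) (f x)) ∎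
  where
  open ≡-Reasoning
  column : ∀ x → sum (λ i → gate (eqF x (g i)) (f x)) ≡ gate (p x) (f x)
  column x with p x in px
  ... | true with p⊆g x (subst T (sym px) tt)
  ...   | j , refl = trans (sum-cong-≗ (λ i → cong (λ b → gate b (f (g j)))
            (T-iff (λ t → eqF⁺ (sym (g-inj j i (eqF⁻ t)))) (λ t → eqF⁺ (cong g (sym (eqF⁻ t)))))))
          (sum-single j (λ _ → f (g j)))
  column x | false = trans (sum-cong-≗ (λ i → gate-false (λ t → subst T px (subst (T ∘ p) (sym (eqF⁻ t)) (g∈p i))))) (sum-zero k)

least : ∀ {P : ℕ → Set} → (∀ k → Dec (P k)) → ∀ n → P n → ∃ λ m → P m × (∀ k → k < m → ¬ P k)
least {P} P? = <-rec _ step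
  where
  step : ∀ n → (∀ {m} → m < n → P m → ∃ λ l → P l × (∀ k → k < l → ¬ P k)) → P n → ∃ λ l → P l × (∀ k → k < l → ¬ P k)
  step n rec pn with anyUpTo? P? n
  ... | yes (m , m<n , pm) = rec m<n pm
  ... | no none = n , pn , λ k k<n pk → none (k , k<n , pk)

module _ {A : Set} (f : A → A) where

  iter-suc : ∀ k x → iter k f (f x) ≡ f (iter k f x)
  iter-suc zero x = refl
  iter-suc (suc k) x = cong f (iter-suc k x)

  iter-+ : ∀ m k x → iter (m + k) f x ≡ iter m f (iter k f x)
  iter-+ zero k x = refl
  iter-+ (suc m) k x = cong f (iter-+ m k x)

  iter-* : ∀ m k x → iter k f x ≡ x → iter (m * k) f x ≡ x
  iter-* zero k x eq = refl
  iter-* (suc m) k x eq = trans (iter-+ k (m * k) x) (trans (cong (iter k f) (iter-* m k x eq)) eq)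

  iter-cancel : (∀ x y → f x ≡ f y → x ≡ y) → ∀ k {x y} → iter k f x ≡ iter k f y → x ≡ y
  iter-cancel inj zero eq = eq
  iter-cancel inj (suc k) eq = iter-cancel inj k (inj _ _ eq)

  iter-period : (∀ x y → f x ≡ f y → x ≡ y) → ∀ {i j} x → i ≤ j → iter i f x ≡ iter j f x → iter (j ∸ i) f x ≡ x
  iter-period inj {i} {j} x i≤j eq = sym (iter-cancel inj i
    (trans eq (trans (cong (λ l → iter l f x) (sym (m+[n∸m]≡n i≤j))) (iter-+ i (j ∸ i) x))))

  iter-drop : ∀ {p k x} → p ≤ k → iter p f x ≡ x → iter (k ∸ p) f x ≡ iter k f x
  iter-drop {p} {k} {x} p≤k eq = trans (cong (iter (k ∸ p) f) (sym eq))
    (trans (sym (iter-+ (k ∸ p) p x)) (cong (λ l → iter l f x) (m∸n+n≡m p≤k)))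

module Orbit {N : ℕ} (f : Fin N → Fin N) (f-inj : ∀ x y → f x ≡ f y → x ≡ y) where

  period : ∀ x → ∃ λ p → 1 ≤ p × p ≤ N × iter p f x ≡ x
  period x with pigeonhole (n<1+n N) (λ i → iter (toℕ i) f x)
  ... | i , j , i<j , eq = toℕ j ∸ toℕ i , m<n⇒0<n∸m i<j ,
    ≤-trans (m∸n≤m (toℕ j) (toℕ i)) (s≤s⁻¹ (toℕ<n j)) , iter-period f f-inj x (<⇒≤ i<j) eq

  -- `faceRep` compares a dart with finitely many iterates only; this shows that they exhaust the
  -- orbit.
  reach-below : ∀ x m → ∃ λ k → k < N × iter k f x ≡ iter m f x
  reach-below x m with period x | least (λ k → iter k f x F.≟ iter m f x) m refl
  ... | p , 1≤p , p≤N , fᵖ | k , eq , k-least = k , ≰⇒> N≰k , eq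
    where
    N≰k : ¬ (N ≤ k)
    N≰k N≤k = k-least (k ∸ p) (∸-monoʳ-< {m = k} {n = p} {o = 0} 1≤p (≤-trans p≤N N≤k)) (trans (iter-drop f (≤-trans p≤N N≤k) fᵖ) eq)

  reach-back : ∀ x m → ∃ λ k → iter k f (iter m f x) ≡ x
  reach-back x m with period x
  -- Together with the `m` steps already made this completes `m` full periods.
  ... | p@(suc p′) , 1≤p , p≤N , fᵖ = m * p ∸ m ,
    trans (sym (iter-+ f (m * p ∸ m) m x)) (trans (cong (λ l → iter l f x) (m∸n+n≡m (m≤m*n m p))) (iter-* f m p x fᵖ))

private
  atMostOne : ∀ a b c d w → ¬ (T a × T b) → ¬ (T a × T c) → ¬ (T a × T d) → ¬ (T b × T c) → ¬ (T b × T d) → ¬ (T c × T d) →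
    gate a w + gate b w + gate c w + gate d w ≤ w
  atMostOne true true c d w ¬ab _ _ _ _ _ = ⊥-elim (¬ab (tt , tt))
  atMostOne true false true d w _ ¬ac _ _ _ _ = ⊥-elim (¬ac (tt , tt))
  atMostOne true false false true w _ _ ¬ad _ _ _ = ⊥-elim (¬ad (tt , tt))
  atMostOne true false false false w _ _ _ _ _ _ = ≤-reflexive (eq w)
    where
    eq : ∀ w → w + 0 + 0 + 0 ≡ w
    eq = solve-∀
  atMostOne false true true d w _ _ _ ¬bc _ _ = ⊥-elim (¬bc (tt , tt))
  atMostOne false true false true w _ _ _ _ ¬bd _ = ⊥-elim (¬bd (tt , tt))
  atMostOne false true false false w _ _ _ _ _ _ = ≤-reflexive (eq w)
    where
    eq : ∀ w → w + 0 + 0 ≡ w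
    eq = solve-∀
  atMostOne false false true true w _ _ _ _ _ ¬cd = ⊥-elim (¬cd (tt , tt))
  atMostOne false false true false w _ _ _ _ _ _ = ≤-reflexive (+-identityʳ w)
  atMostOne false false false true w _ _ _ _ _ _ = ≤-refl
  atMostOne false false false false w _ _ _ _ _ _ = z≤n

countF-pos : ∀ n p v → T (p v) → 1 ≤ countF n p
countF-pos (suc n) p zero t with p zero
... | true = s≤s z≤n
countF-pos (suc n) p (suc v) t = m≤n⇒m≤o+n (if p zero then 1 else 0) (countF-pos n (p ∘ suc) v t)

anyF⁻ : ∀ n p → T (anyF n p) → ∃ λ i → T (p i)
anyF⁻ (suc n) p t with p zero in eq
... | true = zero , subst T (sym eq) tt
... | false with anyF⁻ n (p ∘ suc) t
...   | i , q = suc i , q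

-- Rotation systems, faces and Euler's formula

module Map (G : RotSys) (plane : IsSimplePlane G) (minDeg : ∀ v → 5 ≤ deg G v) where
  open RotSys G public
  open IsSimplePlane plane public

  -- If `k` steps lead from `rot d` back to `d`, then `k` steps from `d` lead to the predecessor of
  -- `d`.
  rot⁻¹ : Fin D → Fin D
  rot⁻¹ d = iter (proj₁ (rot-cycle (rot d) d (rot-tail d))) rot d

  rot-rot⁻¹ : ∀ d → rot (rot⁻¹ d) ≡ d
  rot-rot⁻¹ d = trans (sym (iter-suc rot (proj₁ (rot-cycle (rot d) d (rot-tail d))) d)) (proj₂ (rot-cycle (rot d) d (rot-tail d)))

  rot⁻¹-rot : ∀ d → rot⁻¹ (rot d) ≡ d
  rot⁻¹-rot d = rot-inj _ _ (rot-rot⁻¹ (rot d))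

  rot⁻¹-tail : ∀ d → tail (rot⁻¹ d) ≡ tail d
  rot⁻¹-tail d = trans (sym (rot-tail (rot⁻¹ d))) (cong tail (rot-rot⁻¹ d))

  rotₚ revₚ : Permutation′ D
  rotₚ = permutation rot rot⁻¹ rot-rot⁻¹ rot⁻¹-rot
  revₚ = permutation rev rev rev-invol rev-invol

  sum-rot : ∀ (f : Fin D → ℕ) → sum (λ d → f (rot d)) ≡ sum f
  sum-rot f = sym (sum-permute f rotₚ)

  sum-rev : ∀ (f : Fin D → ℕ) → sum (λ d → f (rev d)) ≡ sum f
  sum-rev f = sym (sum-permute f revₚ)

  sum-rot⁻¹ : ∀ (f : Fin D → ℕ) → sum (λ d → f (rot⁻¹ d)) ≡ sum f
  sum-rot⁻¹ f = trans (sym (sum-rot (λ d → f (rot⁻¹ d)))) (sum-cong-≗ (λ d → cong f (rot⁻¹-rot d)))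

  at : Fin n → (Fin D → ℕ) → ℕ
  at v f = sum (λ d → gate (eqF (tail d) v) (f d))

  sum-at : ∀ f → sum (λ v → at v f) ≡ sum f
  sum-at f = trans (sym (∑-comm (λ d v → gate (eqF (tail d) v) (f d))))
    (sum-cong-≗ (λ d → trans (sum-cong-≗ (λ v → cong (λ b → gate b (f d)) (eqF-sym (tail d) v)))
      (sum-single (tail d) (λ _ → f d))))

  deg-at : ∀ v → deg G v ≡ at v (λ _ → 1)
  deg-at v = countF-sum D (λ d → eqF (tail d) v)

  iter-tail : ∀ k d → tail (iter k rot d) ≡ tail d
  iter-tail zero d = refl
  iter-tail (suc k) d = trans (rot-tail (iter k rot d)) (iter-tail k d)

  record Turn (e : Fin D) (p : ℕ) : Set where
    field
      closed   : iter p rot e ≡ e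
      distinct : ∀ i j → i < p → j < p → iter i rot e ≡ iter j rot e → i ≡ j
      total    : ∀ f → at (tail e) f ≡ sum {p} (λ i → f (iter (toℕ i) rot e))

  turn′ : ∀ e → ∃ λ p → Turn e p
  turn′ e with rot-cycle (rot e) e (rot-tail e)
  ... | k₀ , eq₀ with least (λ k → iter (suc k) rot e F.≟ e) k₀ (trans (sym (iter-suc rot k₀ e)) eq₀)
  ... | m , eq , m-least = p , record { closed = eq ; distinct = distinct ; total = total }
    where
    p = suc m
    ordered : ∀ i j → i < j → j < p → iter i rot e ≢ iter j rot e
    ordered i j i<j j<p eq′ with j ∸ i in j∸i | m<n⇒0<n∸m i<j | iter-period rot rot-inj e (<⇒≤ i<j) eq′ | m∸n≤m j i
    ... | suc k | _ | again | k<j = m-least k (≤-trans k<j (s≤s⁻¹ j<p)) again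
    distinct : ∀ i j → i < p → j < p → iter i rot e ≡ iter j rot e → i ≡ j
    distinct i j i<p j<p eq′ with <-cmp i j
    ... | tri< i<j _ _ = ⊥-elim (ordered i j i<j j<p eq′)
    ... | tri≈ _ i≡j _ = i≡j
    ... | tri> _ _ j<i = ⊥-elim (ordered j i j<i i<p (sym eq′))
    reached : ∀ d → T (eqF (tail d) (tail e)) → ∃ λ (i : Fin p) → iter (toℕ i) rot e ≡ d
    reached d t with rot-cycle e d (sym (eqF⁻ t))
    ... | k , eq″ with least (λ k → iter k rot e F.≟ d) k eq″
    ... | l , eqₗ , l-least = fromℕ< l<p , trans (cong (λ i → iter i rot e) (toℕ-fromℕ< l<p)) eqₗ
      where
      l<p : l < p
      l<p = ≰⇒> λ p≤l → l-least (l ∸ p) (∸-monoʳ-< {m = l} {n = p} {o = 0} (s≤s z≤n) p≤l) (trans (iter-drop rot p≤l eq) eqₗ)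
    total : ∀ f → at (tail e) f ≡ sum {p} (λ i → f (iter (toℕ i) rot e))
    total f = sym (sum-image (λ (i : Fin p) → iter (toℕ i) rot e) (λ d → eqF (tail d) (tail e)) f
      (λ i j eq′ → toℕ-injective (distinct (toℕ i) (toℕ j) (toℕ<n i) (toℕ<n j) eq′))
      (λ i → eqF⁺ (iter-tail (toℕ i) e)) reached)

  turn : ∀ e → Turn e (deg G (tail e))
  turn e with turn′ e
  ... | p , t = subst (Turn e) (sym deg≡p) t
    where
    sum-one : ∀ p → sum {p} (λ _ → 1) ≡ p
    sum-one zero = refl
    sum-one (suc p) = cong suc (sum-one p)
    deg≡p : deg G (tail e) ≡ p
    deg≡p = trans (deg-at (tail e)) (trans (Turn.total t (λ _ → 1)) (sum-one p))

  rot-moves : ∀ d → rot d ≢ d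
  rot-moves d eq with Turn.distinct (turn d) 1 0 (≤-trans (s≤s (s≤s z≤n)) (minDeg (tail d))) (≤-trans (s≤s z≤n) (minDeg (tail d))) eq
  ... | ()

  ψ : Fin D → Fin D
  ψ = facePerm G

  ψ-inj : ∀ x y → ψ x ≡ ψ y → x ≡ y
  ψ-inj x y eq = trans (sym (rev-invol x)) (trans (cong rev (rot-inj _ _ eq)) (rev-invol y))

  open Orbit ψ ψ-inj

  ψ-tail : ∀ d → tail (ψ d) ≡ head G d
  ψ-tail d = rot-tail (rev d)

  ψ¹≢ : ∀ d → ψ d ≢ d
  ψ¹≢ d eq = noLoop d (trans (sym (ψ-tail d)) (cong tail eq))

  -- The two sides of a face of length two would be parallel edges. They coincide by `noMulti`, so
  -- `rot` fixes a dart, which the minimum degree forbids.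
  ψ²≢ : ∀ d → ψ (ψ d) ≢ d
  ψ²≢ d eq = rot-moves (rev d) (trans (sym (rev-invol (ψ d))) (cong rev
    (noMulti (rev (ψ d)) d (trans (sym (ψ-tail (ψ d))) (cong tail eq))
      (trans (cong tail (rev-invol (ψ d))) (ψ-tail d)))))

  face-open : Fin D → Bool
  face-open d = not (eqF (ψ (ψ (ψ d))) d)

  face-open-ψ : ∀ d → face-open (ψ d) ≡ face-open d
  face-open-ψ d = cong not (T-iff (λ t → eqF⁺ (ψ-inj _ _ (eqF⁻ t))) (λ t → eqF⁺ (cong ψ (eqF⁻ t))))

  rep : Fin D → Bool
  rep = faceRep G

  rep-min : ∀ d m → T (rep d) → toℕ d ≤ toℕ (iter m ψ d)
  rep-min d m t with reach-below d m
  ... | k , k<D , eq = subst (λ e → toℕ d ≤ toℕ e) eq (≤ᵇ⇒≤ _ _ (allBelow-sound D {λ k → toℕ d ≤ᵇ toℕ (iter k ψ d)} t k<D))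

  rep-unique : ∀ d m → T (rep d) → T (rep (iter m ψ d)) → iter m ψ d ≡ d
  rep-unique d m t t′ with reach-back d m
  ... | k , eq = toℕ-injective (≤-antisym (subst (λ e → toℕ (iter m ψ d) ≤ toℕ e) eq (rep-min (iter m ψ d) k t′)) (rep-min d m t))

  weight : Fin D → ℕ
  weight d = 3 + gate (not (face-open d)) 1

  weight-ψ : ∀ d → weight (ψ d) ≡ weight d
  weight-ψ d = cong (λ b → 3 + gate (not b) 1) (face-open-ψ d)

  -- Every face has weight at least 12: a triangle has three darts of weight 4, any other face at least four darts of weight 3.
  12*faces : 12 * faces G ≤ sum weight
  12*faces = begin
    12 * faces G
      ≡⟨ cong (12 *_) (countF-sum D rep) ⟩
    12 * sum (λ d → gate (rep d) 1)
      ≡⟨ *-distribˡ-sum 12 (λ d → gate (rep d) 1) ⟩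
    sum (λ d → 12 * gate (rep d) 1)
      ≡⟨ sum-cong-≗ twelve ⟩
    sum (λ d → A d + A d + A d + B d)
      ≡⟨ distrib₄ A A A B ⟩
    sum A + sum A + sum A + sum B
      ≡⟨ cong₂ _+_ (cong₂ _+_ (cong (sum A +_) (sym (sum-ψ A))) (sym (trans (sum-ψ (λ d → A (ψ d))) (sum-ψ A))))
           (sym (trans (sum-ψ (λ d → B (ψ (ψ d)))) (trans (sum-ψ (λ d → B (ψ d))) (sum-ψ B)))) ⟩
    sum A + sum (λ d → A (ψ d)) + sum (λ d → A (ψ (ψ d))) + sum (λ d → B (ψ (ψ (ψ d))))
      ≡⟨ sym (distrib₄ A (λ d → A (ψ d)) (λ d → A (ψ (ψ d))) (λ d → B (ψ (ψ (ψ d))))) ⟩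
    sum (λ d → A d + A (ψ d) + A (ψ (ψ d)) + B (ψ (ψ (ψ d))))
      ≤⟨ sum-mono once ⟩
    sum weight ∎
    where
    open ≤-Reasoning
    A B : Fin D → ℕ
    A d = gate (rep d) (weight d)
    B d = gate (rep d ∧ face-open d) (weight d)
    sum-ψ : ∀ f → sum (λ d → f (ψ d)) ≡ sum f
    sum-ψ f = trans (sum-rev (λ d → f (rot d))) (sum-rot f)
    distrib₄ : ∀ (f g h k : Fin D → ℕ) → sum (λ d → f d + g d + h d + k d) ≡ sum f + sum g + sum h + sum k
    distrib₄ f g h k = trans (∑-distrib-+ (λ d → f d + g d + h d) k) (cong (_+ sum k)
      (trans (∑-distrib-+ (λ d → f d + g d) h) (cong (_+ sum h) (∑-distrib-+ f g))))
    twelve : ∀ d → 12 * gate (rep d) 1 ≡ A d + A d + A d + B d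
    twelve d with rep d | face-open d
    ... | true | true = refl
    ... | true | false = refl
    ... | false | _ = refl
    -- The shifts charge a representative to darts up to three steps before it. A face has only one
    -- representative, so a dart charged twice would have two equal iterates among those considered;
    -- lengths one and two are impossible, and length three is ruled out where `B` counts.
    once : ∀ d → A d + A (ψ d) + A (ψ (ψ d)) + B (ψ (ψ (ψ d))) ≤ weight d
    once d = ≤-trans (≤-reflexive (cong₂ _+_ (cong₂ _+_ (cong (A d +_) (cong (gate (rep (ψ d))) (w 1)))
        (cong (gate (rep (ψ (ψ d)))) (w 2))) (cong (gate (rep (ψ (ψ (ψ d))) ∧ face-open (ψ (ψ (ψ d))))) (w 3))))
      (atMostOne (rep d) (rep (ψ d)) (rep (ψ (ψ d))) (rep (ψ (ψ (ψ d))) ∧ face-open (ψ (ψ (ψ d)))) (weight d)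
        (λ (t , t′) → ψ¹≢ d (rep-unique d 1 t t′))
        (λ (t , t′) → ψ²≢ d (rep-unique d 2 t t′))
        (λ (t , t′) → not-3 (proj₂ (∧⁻ {rep (ψ (ψ (ψ d)))} t′)) (rep-unique d 3 t (proj₁ (∧⁻ t′))))
        (λ (t , t′) → ψ¹≢ (ψ d) (rep-unique (ψ d) 1 t t′))
        (λ (t , t′) → ψ²≢ (ψ d) (rep-unique (ψ d) 2 t (proj₁ (∧⁻ t′))))
        (λ (t , t′) → ψ¹≢ (ψ (ψ d)) (rep-unique (ψ (ψ d)) 1 t (proj₁ (∧⁻ t′)))))
      where
      w : ∀ k → weight (iter k ψ d) ≡ weight d
      w zero = refl
      w (suc k) = trans (weight-ψ (iter k ψ d)) (w k)
      not-3 : T (face-open (ψ (ψ (ψ d)))) → ψ (ψ (ψ d)) ≢ d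
      not-3 t eq = T-not⇒¬ t (eqF⁺ (cong (λ e → ψ (ψ (ψ e))) eq))

  openCorners : ℕ
  openCorners = sum (λ d → gate (face-open d) 1)

  -- Since `D` is the sum of all degrees, this is the total charge doubled: `2 (deg - 6)` over the
  -- vertices plus 1 for each open corner is at most -24. Weight and openness of a dart add up to 4,
  -- so 12 times the number of faces is at most `4 * D` minus `openCorners`.
  euler-bound : 0 < n → 2 * D + openCorners + 24 ≤ 12 * n
  euler-bound 0<n = +-cancelʳ-≤ (12 * faces G) _ _ (begin
    2 * D + openCorners + 24 + 12 * faces G
      ≤⟨ +-monoʳ-≤ (2 * D + openCorners + 24) 12*faces ⟩
    2 * D + openCorners + 24 + sum weight
      ≡⟨ eq₁ D openCorners (sum weight) ⟩
    2 * D + (sum weight + openCorners) + 24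
      ≡⟨ cong (λ x → 2 * D + x + 24) (trans (sym (∑-distrib-+ weight (λ d → gate (face-open d) 1))) (trans (sum-cong-≗ four) (sum-const D))) ⟩
    2 * D + 4 * D + 24 * 1
      ≤⟨ +-monoʳ-≤ (2 * D + 4 * D) (*-monoʳ-≤ 24 components-pos) ⟩
    2 * D + 4 * D + 24 * components G
      ≡⟨ eq₂ D (components G) ⟩
    6 * (D + 4 * components G)
      ≡⟨ cong (6 *_) (sym euler) ⟩
    6 * (2 * n + 2 * faces G)
      ≡⟨ eq₃ n (faces G) ⟩
    12 * n + 12 * faces G ∎)
    where
    open ≤-Reasoning
    eq₁ : ∀ d o w → 2 * d + o + 24 + w ≡ 2 * d + (w + o) + 24
    eq₁ = solve-∀
    eq₂ : ∀ d c → 2 * d + 4 * d + 24 * c ≡ 6 * (d + 4 * c)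
    eq₂ = solve-∀
    eq₃ : ∀ v f → 6 * (2 * v + 2 * f) ≡ 12 * v + 12 * f
    eq₃ = solve-∀
    four : ∀ d → weight d + gate (face-open d) 1 ≡ 4
    four d with face-open d
    ... | true = refl
    ... | false = refl
    sum-const : ∀ k → sum {k} (λ _ → 4) ≡ 4 * k
    sum-const zero = refl
    sum-const (suc k) = trans (cong (4 +_) (sum-const k)) (sym (*-suc 4 k))
    components-pos : 1 ≤ components G
    -- The vertex with the least index represents its component.
    components-pos = countF-pos n (compRep G) (fromℕ< 0<n) (¬⇒T-not λ t → no-smaller (anyF⁻ n _ t))
      where
      no-smaller : ¬ (∃ λ u → T ((toℕ u <ᵇ toℕ (fromℕ< 0<n)) ∧ reach G n u (fromℕ< 0<n)))
      no-smaller (u , t) = n≮0 (subst (toℕ u <_) (toℕ-fromℕ< 0<n)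
        (<ᵇ⇒< (toℕ u) (toℕ (fromℕ< 0<n)) (proj₁ (∧⁻ {toℕ u <ᵇ toℕ (fromℕ< 0<n)} t))))

∨ˡ : ∀ {p q} → T p → T (p ∨ q)
∨ˡ {true} _ = tt

∨ʳ : ∀ {p q} → T q → T (p ∨ q)
∨ʳ {true} _ = tt
∨ʳ {false} t = t

excluded-cong : ∀ {a a′ b b′ c c′ d d′ e e′} → a ≡ a′ → b ≡ b′ → c ≡ c′ → d ≡ d′ → e ≡ e′ →
  excluded a b c d e ≡ excluded a′ b′ c′ d′ e′
excluded-cong refl refl refl refl refl = refl

petty-cong : ∀ {a a′ b b′ c c′ d d′ e e′} → a ≡ a′ → b ≡ b′ → c ≡ c′ → d ≡ d′ → e ≡ e′ →
  petty a b c d e ≡ petty a′ b′ c′ d′ e′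
petty-cong refl refl refl refl refl = refl

-- Triangular corners in either orientation

module Corner {D n : ℕ} (tail : Fin D → Fin n) (rev σ σ⁻¹ : Fin D → Fin D)
  (rev-invol : ∀ d → rev (rev d) ≡ d) (σ-σ⁻¹ : ∀ d → σ (σ⁻¹ d) ≡ d) (σ⁻¹-σ : ∀ d → σ⁻¹ (σ d) ≡ d)
  (σ-tail : ∀ d → tail (σ d) ≡ tail d) where

  -- The corner between c and σ c lies in a triangle.
  Triangle : Fin D → Set
  Triangle c = rev (σ (rev (σ (rev (σ c))))) ≡ c

  open? : Fin D → Bool
  open? c = not (eqF (rev (σ (rev (σ (rev (σ c)))))) c)

  closed : ∀ {c} → ¬ T (open? c) → Triangle c
  closed {c} t with eqF (rev (σ (rev (σ (rev (σ c)))))) c in eq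
  ... | true = eqF⁻ (subst T (sym eq) tt)
  ... | false = ⊥-elim (t tt)

  closed⁺ : ∀ {c} → Triangle c → ¬ T (open? c)
  closed⁺ tri t = T-not⇒¬ t (eqF⁺ tri)

  σ⁻¹-tail : ∀ d → tail (σ⁻¹ d) ≡ tail d
  σ⁻¹-tail d = trans (sym (σ-tail (σ⁻¹ d))) (cong tail (σ-σ⁻¹ d))

  σ⁻¹-rev : ∀ {c} → Triangle c → σ⁻¹ (rev c) ≡ rev (σ (rev (σ c)))
  σ⁻¹-rev {c} tri = trans (cong (λ e → σ⁻¹ (rev e)) (sym tri)) (trans (cong σ⁻¹ (rev-invol _)) (σ⁻¹-σ _))

  -- The third side of the triangle as seen from the head of `c`; `head-σ-rev` is the view from the
  -- head of `σ c`.
  head-σ⁻¹-rev : ∀ {c} → Triangle c → tail (rev (σ⁻¹ (rev c))) ≡ tail (rev (σ c))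
  head-σ⁻¹-rev {c} tri = trans (cong (λ e → tail (rev e)) (σ⁻¹-rev tri))
    (trans (cong tail (rev-invol _)) (σ-tail (rev (σ c))))

  head-σ-rev : ∀ {c} → Triangle c → tail (rev (σ (rev (σ c)))) ≡ tail (rev c)
  head-σ-rev {c} tri = trans (cong tail (sym (σ⁻¹-rev tri))) (σ⁻¹-tail (rev c))

  head-σ-rev′ : ∀ {d} → Triangle (σ⁻¹ d) → tail (rev (σ (rev d))) ≡ tail (rev (σ⁻¹ d))
  head-σ-rev′ {d} tri = trans (cong (λ e → tail (rev (σ (rev e)))) (sym (σ-σ⁻¹ d))) (head-σ-rev tri)

  -- The same triangle traversed the other way round, so both orientations agree on which corners
  -- are triangular.
  mirror : ∀ {c} → Triangle c → rev (σ⁻¹ (rev (σ⁻¹ (rev (σ⁻¹ (σ c)))))) ≡ σ c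
  mirror {c} tri = begin
    rev (σ⁻¹ (rev (σ⁻¹ (rev (σ⁻¹ (σ c))))))       ≡⟨ cong (λ e → rev (σ⁻¹ (rev (σ⁻¹ (rev e))))) (σ⁻¹-σ c) ⟩
    rev (σ⁻¹ (rev (σ⁻¹ (rev c))))                 ≡⟨ cong (λ e → rev (σ⁻¹ (rev e))) (σ⁻¹-rev tri) ⟩
    rev (σ⁻¹ (rev (rev (σ (rev (σ c))))))         ≡⟨ cong (λ e → rev (σ⁻¹ e)) (rev-invol _) ⟩
    rev (σ⁻¹ (σ (rev (σ c))))                     ≡⟨ cong rev (σ⁻¹-σ _) ⟩
    rev (rev (σ c))                               ≡⟨ rev-invol _ ⟩
    σ c                                           ∎
    where open ≡-Reasoning

-- Payees, exempt payees and hubs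

module Degrees (G : RotSys) (minDeg : ∀ v → 5 ≤ deg G v) where
  open RotSys G

  H : Fin n → ℕ
  H v = deg G v ⊓ 24

  h : Fin D → ℕ
  h d = H (head G d)

  H-Deg : ∀ v → Deg (H v)
  H-Deg v = ⊓-glb (minDeg v) (s≤s (s≤s (s≤s (s≤s (s≤s z≤n))))) , m⊓n≤n (deg G v) 24

  below-24 : ∀ {v} → H v ≤ 23 → H v ≡ deg G v
  below-24 {v} H≤23 with ≤-total (deg G v) 24
  ... | inj₁ d≤24 = m≤n⇒m⊓n≡m d≤24
  ... | inj₂ 24≤d = ⊥-elim (<⇒≱ (s≤s H≤23) (≤-reflexive (sym (m≥n⇒m⊓n≡n 24≤d))))

  H≡⇒deg≡ : ∀ {v k} → k ≤ 23 → H v ≡ k → deg G v ≡ k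
  H≡⇒deg≡ {v} k≤23 eq = trans (sym (below-24 {v} (≤-trans (≤-reflexive eq) k≤23))) eq

  deg≡⇒H≡ : ∀ {v k} → k ≤ 24 → deg G v ≡ k → H v ≡ k
  deg≡⇒H≡ k≤24 eq = trans (cong (_⊓ 24) eq) (m≤n⇒m⊓n≡m k≤24)

  5≤23 : 5 ≤ 23
  5≤23 = s≤s (s≤s (s≤s (s≤s (s≤s z≤n))))

  5≤24 : 5 ≤ 24
  5≤24 = s≤s (s≤s (s≤s (s≤s (s≤s z≤n))))

  five? : Fin D → Bool
  five? d = deg G (tail d) ≡ᵇ 5

  -- One of the two orientations of the plane: σ is the rotation or its inverse.
  module Side (rev-invol : ∀ d → rev (rev d) ≡ d)
    (σ σ⁻¹ : Fin D → Fin D) (σ-σ⁻¹ : ∀ d → σ (σ⁻¹ d) ≡ d) (σ⁻¹-σ : ∀ d → σ⁻¹ (σ d) ≡ d)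
    (σ-tail : ∀ d → tail (σ d) ≡ tail d) (σ⁵ : ∀ d → deg G (tail d) ≡ 5 → σ (σ (σ (σ (σ d)))) ≡ d)
    (tri? : Fin n → Bool) (tri-corner : ∀ c → T (tri? (tail c)) → rev (σ (rev (σ (rev (σ c))))) ≡ c)
    (allowed : ∀ d → deg G (tail d) ≡ 5 → ¬ T (excluded (h d) (h (σ d)) (h (σ (σ d))) (h (σ⁻¹ (σ⁻¹ d))) (h (σ⁻¹ d))))
    where

    open Corner tail rev σ σ⁻¹ rev-invol σ-σ⁻¹ σ⁻¹-σ σ-tail public

    σ³ : ∀ d → deg G (tail d) ≡ 5 → σ (σ (σ d)) ≡ σ⁻¹ (σ⁻¹ d)
    σ³ d d5 = trans (sym (σ⁻¹-σ _)) (cong σ⁻¹ (trans (sym (σ⁻¹-σ _)) (cong σ⁻¹ (σ⁵ d d5))))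

    tail-σ² : ∀ d → tail (σ (σ d)) ≡ tail d
    tail-σ² d = trans (σ-tail (σ d)) (σ-tail d)

    -- The vertex tail d is a payee of y = head d; here σ d, σ (σ d), σ⁻¹ (σ⁻¹ d), σ⁻¹ d lead to x, u, M, w.
    payee? : Fin D → Bool
    payee? d = five? d ∧ (tri? (tail d) ∧ isPay (h d) (h (σ d)) (h (σ (σ d))) (h (σ⁻¹ (σ⁻¹ d))) (h (σ⁻¹ d)))

    -- The darts from x = head (σ d) to its neighbours q and s.
    toQ toS : Fin D → Fin D
    toQ d = σ⁻¹ (σ⁻¹ (rev (σ d)))
    toS d = σ (σ (rev (σ d)))

    -- Exempt payees are paid by u, or by x if the corner between q and u is not triangular, instead of y.
    exempt? : Fin D → Bool
    exempt? d = (h (σ d) ≡ᵇ 5) ∧ ((17 ≤ᵇ h (toQ d)) ∧ (not (open? (toQ d)) ∨ (h (toS d) ≡ᵇ 5)))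

    hub? : Fin D → Bool
    hub? d = payee? d ∧ not (exempt? d)

    paid fromHub fromU fromX : Fin D → ℕ
    paid d = gate (payee? d) (amt (h d) (h (σ d)))
    fromHub d = gate (hub? d) (amt (h d) (h (σ d)))
    fromU d = gate (payee? d ∧ (exempt? d ∧ not (open? (toQ d)))) (amt (h d) (h (σ d)))
    fromX d = gate (payee? d ∧ (exempt? d ∧ open? (toQ d))) (amt (h d) (h (σ d)))

    paid-split : ∀ d → paid d ≡ fromHub d + (fromU d + fromX d)
    paid-split d = split (payee? d) (exempt? d) (open? (toQ d)) (amt (h d) (h (σ d)))
      where
      split : ∀ p e o a → gate p a ≡ gate (p ∧ not e) a + (gate (p ∧ (e ∧ not o)) a + gate (p ∧ (e ∧ o)) a)
      split false _ _ _ = refl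
      split true false _ a = sym (+-identityʳ a)
      split true true false a = sym (+-identityʳ a)
      split true true true a = refl

    record Payee (d : Fin D) : Set where
      field
        deg5 : deg G (tail d) ≡ 5
        tri  : T (tri? (tail d))
        mid-y : T (isMid (h d))
        w≡5  : h (σ⁻¹ d) ≡ 5
        u≡5  : h (σ (σ d)) ≡ 5
        6≤M  : 6 ≤ h (σ⁻¹ (σ⁻¹ d))

      corner : ∀ {c} → tail c ≡ tail d → Triangle c
      corner {c} eq = tri-corner c (subst (λ v → T (tri? v)) (sym eq) tri)

    payee⁻ : ∀ {d} → T (payee? d) → Payee d
    payee⁻ {d} t with ∧⁻ {five? d} t
    ... | t₅ , t with ∧⁻ {tri? (tail d)} t
    ... | t△ , t with ∧⁻ {7 ≤ᵇ h d} t
    ... | t₇ , t with ∧⁻ {h d ≤ᵇ 9} t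
    ... | t₉ , t with ∧⁻ {h (σ⁻¹ d) ≡ᵇ 5} t
    ... | tw , t with ∧⁻ {h (σ (σ d)) ≡ᵇ 5} t
    ... | tu , tM = record
      { deg5 = ≡ᵇ⇒≡ _ 5 t₅ ; tri = t△ ; mid-y = ∧⁺ {7 ≤ᵇ h d} t₇ t₉
      ; w≡5 = ≡ᵇ⇒≡ _ 5 tw ; u≡5 = ≡ᵇ⇒≡ _ 5 tu ; 6≤M = ≤ᵇ⇒≤ 6 _ tM }

    record Exempt (d : Fin D) : Set where
      field
        x≡5  : h (σ d) ≡ 5
        17≤q : 17 ≤ h (toQ d)
        closed-or-s≡5 : ¬ T (open? (toQ d)) ⊎ h (toS d) ≡ 5

    exempt⁻ : ∀ {d} → T (exempt? d) → Exempt d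
    exempt⁻ {d} t with ∧⁻ {h (σ d) ≡ᵇ 5} t
    ... | tx , t with ∧⁻ {17 ≤ᵇ h (toQ d)} t
    ... | tq , t = record { x≡5 = ≡ᵇ⇒≡ _ 5 tx ; 17≤q = ≤ᵇ⇒≤ 17 _ tq
      ; closed-or-s≡5 = [ (λ t → inj₁ (T-not⇒¬ t)) , (λ t → inj₂ (≡ᵇ⇒≡ _ 5 t)) ]′ (∨⁻ {not (open? (toQ d))} t) }

    exempt⁺ : ∀ {d} → Exempt d → T (exempt? d)
    exempt⁺ {d} e = ∧⁺ (≡⇒≡ᵇ _ 5 x≡5) (∧⁺ (≤⇒≤ᵇ 17≤q)
        ([ (λ ¬o → ∨ˡ (¬⇒T-not ¬o)) , (λ s≡5 → ∨ʳ {not (open? (toQ d))} (≡⇒≡ᵇ _ 5 s≡5)) ]′ closed-or-s≡5))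
      where open Exempt e

    H-tail : ∀ {d} → Payee d → ∀ {c} → tail c ≡ tail d → H (tail c) ≡ 5
    H-tail p eq = trans (cong H eq) (deg≡⇒H≡ 5≤24 (Payee.deg5 p))

    allowed-payee : ∀ {d} → Payee d → ¬ T (excluded (h d) (h (σ d)) 5 (h (σ⁻¹ (σ⁻¹ d))) 5)
    allowed-payee {d} p = subst₂ (λ u w → ¬ T (excluded (h d) (h (σ d)) u (h (σ⁻¹ (σ⁻¹ d))) w)) u≡5 w≡5 (allowed d deg5)
      where open Payee p

    -- Here `c` leads from u to the payee v. The triangles at v place M before v and x after v
    -- around u, and the closed corner between q and u at x places q after x, as `gift₁` requires.
    fromU≤ : ∀ d {c} → c ≡ rev (σ (σ d)) →
      fromU d ≤ gift₁ (kind (h (σ⁻¹ c))) (kind (h c)) (kind (h (σ c))) (kind (h (σ (σ c)))) * spare (h (σ⁻¹ c))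
    fromU≤ d refl = gate-bound λ t → bound (payee⁻ (proj₁ (∧⁻ {payee? d} t)))
        (exempt⁻ (proj₁ (∧⁻ {exempt? d} (proj₂ (∧⁻ {payee? d} t)))))
        (closed (T-not⇒¬ (proj₂ (∧⁻ {exempt? d} (proj₂ (∧⁻ {payee? d} t))))))
      where
      c = rev (σ (σ d))
      bound : Payee d → Exempt d → Triangle (toQ d) →
        amt (h d) (h (σ d)) ≤ gift₁ (kind (h (σ⁻¹ c))) (kind (h c)) (kind (h (σ c))) (kind (h (σ (σ c)))) * spare (h (σ⁻¹ c))
      bound p e △ = gift₁≤ (subst (17 ≤_) (sym hM) (payee-big (H-Deg _) (H-Deg _) mid-y allowed′))
          (H-tail p (trans (cong tail (rev-invol (σ (σ d)))) (tail-σ² d)))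
          (trans (cong H (trans (head-σ-rev (corner (σ-tail d))) refl)) x≡5)
          (subst (17 ≤_) (sym hq) 17≤q)
          (subst₂ (λ x M → amt (h d) x ≤ spare M) (sym x≡5) (sym hM) (payment≤spare (H-Deg _) (H-Deg _) mid-y allowed′))
        where
        open Payee p
        open Exempt e
        hM : h (σ⁻¹ c) ≡ h (σ⁻¹ (σ⁻¹ d))
        hM = trans (cong H (head-σ⁻¹-rev (corner (tail-σ² d)))) (cong h (σ³ d deg5))
        hq : h (σ (σ c)) ≡ h (toQ d)
        hq = trans (cong (λ e → h (σ e)) (trans (sym (rev-invol (σ c))) (cong rev
               (trans (sym (σ⁻¹-rev (corner (σ-tail d)))) (sym (σ-σ⁻¹ _)))))) (cong H (head-σ-rev △))
        allowed′ : ¬ T (excluded (h d) 5 5 (h (σ⁻¹ (σ⁻¹ d))) 5)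
        allowed′ = subst (λ x → ¬ T (excluded (h d) x 5 (h (σ⁻¹ (σ⁻¹ d))) 5)) x≡5 (allowed-payee p)

    fromU-five : ∀ d {c} → c ≡ rev (σ (σ d)) → deg G (tail c) ≢ 5 → fromU d ≡ 0
    fromU-five d refl ≢5 = gate-false λ t → ≢5 (H≡⇒deg≡ 5≤23 (Payee.u≡5 (payee⁻ {d} (proj₁ (∧⁻ {payee? d} t)))))

    -- Here `c` leads from x to the payee v. Since x has degree 5, its neighbours in order are
    -- exactly v, y, s, q, u, as `gift₂` requires.
    fromX≤ : ∀ d {c} → c ≡ rev (σ d) →
      fromX d ≤ gift₂ (kind (h c)) (kind (h (σ c))) (kind (h (σ (σ c)))) (kind (h (σ⁻¹ (σ⁻¹ c)))) (kind (h (σ⁻¹ c))) (open? (σ⁻¹ (σ⁻¹ c)))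
        * spare (h (σ⁻¹ (σ⁻¹ c)))
    fromX≤ d refl = gate-bound λ t → bound (payee⁻ (proj₁ (∧⁻ {payee? d} t)))
        (exempt⁻ (proj₁ (∧⁻ {exempt? d} (proj₂ (∧⁻ {payee? d} t)))))
        (proj₂ (∧⁻ {exempt? d} (proj₂ (∧⁻ {payee? d} t))))
      where
      c = rev (σ d)
      bound : Payee d → Exempt d → T (open? (toQ d)) → amt (h d) (h (σ d)) ≤
        gift₂ (kind (h c)) (kind (h (σ c))) (kind (h (σ (σ c)))) (kind (h (σ⁻¹ (σ⁻¹ c)))) (kind (h (σ⁻¹ c))) (open? (σ⁻¹ (σ⁻¹ c)))
        * spare (h (σ⁻¹ (σ⁻¹ c)))
      bound p e o = gift₂≤ {y = h (σ c)} hv (subst (λ y → T (isMid y)) (sym hy) mid-y) s≡5 17≤q hu o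
          (subst (λ x → amt (h d) x ≤ spare (h (toQ d))) (sym x≡5) (payment≤spare₂ (H-Deg _) (H-Deg _) mid-y allowed′))
        where
        open Payee p
        open Exempt e
        s≡5 : h (toS d) ≡ 5
        s≡5 = [ (λ ¬o → ⊥-elim (¬o o)) , (λ eq → eq) ]′ closed-or-s≡5
        hv : h c ≡ 5
        hv = H-tail p (trans (cong tail (rev-invol (σ d))) (σ-tail d))
        hy : h (σ c) ≡ h d
        hy = cong H (head-σ-rev (corner refl))
        hu : h (σ⁻¹ c) ≡ 5
        hu = trans (cong H (head-σ⁻¹-rev (corner (σ-tail d)))) u≡5
        deg-x : deg G (tail (σ c)) ≡ 5
        deg-x = H≡⇒deg≡ 5≤23 (trans (cong H (σ-tail c)) x≡5)
        allowed′ : ¬ T (excluded (h d) 5 (h (toQ d)) 5 5)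
        allowed′ t = allowed (σ c) deg-x (subst T (sym (excluded-cong hy s≡5
            (cong h (σ³ c (trans (cong (deg G) (sym (σ-tail c))) deg-x)))
            (trans (cong (λ e → h (σ⁻¹ e)) (σ⁻¹-σ c)) hu) (trans (cong h (σ⁻¹-σ c)) hv))) t)

    fromX-five : ∀ d {c} → c ≡ rev (σ d) → deg G (tail c) ≢ 5 → fromX d ≡ 0
    fromX-five d refl ≢5 = gate-false λ t → ≢5 (H≡⇒deg≡ 5≤23
      (Exempt.x≡5 (exempt⁻ {d} (proj₁ (∧⁻ {exempt? d} (proj₂ (∧⁻ {payee? d} t)))))))

    hub⁻ : ∀ {d} → T (hub? d) → Payee d × ¬ T (exempt? d)
    hub⁻ {d} t = payee⁻ (proj₁ (∧⁻ {payee? d} t)) , T-not⇒¬ (proj₂ (∧⁻ {payee? d} t))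

    -- The dart c leads from y to a payee, and σ c from y to the neighbour w of that payee.
    module Hub {c : Fin D} (payee : Payee (rev c)) where
      open Payee payee

      d = rev c

      rev-σ : rev (σ c) ≡ σ⁻¹ (rev (σ⁻¹ d))
      rev-σ = trans (cong (λ e → rev (σ e)) (sym (rev-invol c)))
        (trans (cong (λ e → rev (σ (rev e))) (sym (σ-σ⁻¹ d))) (sym (σ⁻¹-rev (corner (σ⁻¹-tail d)))))

      σ-rev-σ : σ (rev (σ c)) ≡ rev (σ⁻¹ d)
      σ-rev-σ = trans (cong σ rev-σ) (σ-σ⁻¹ _)

      h-σ-rev-σ : h (σ (rev (σ c))) ≡ 5
      h-σ-rev-σ = trans (cong h σ-rev-σ) (H-tail payee (trans (cong tail (rev-invol (σ⁻¹ d))) (σ⁻¹-tail d)))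

      h-σ²-rev-σ : h (σ (σ (rev (σ c)))) ≡ h (σ⁻¹ (σ⁻¹ d))
      h-σ²-rev-σ = trans (cong (λ e → h (σ e)) σ-rev-σ)
        (cong H (head-σ-rev′ (corner (trans (σ⁻¹-tail (σ⁻¹ d)) (σ⁻¹-tail d)))))

      deg-w : deg G (tail (rev (σ c))) ≡ 5
      deg-w = H≡⇒deg≡ 5≤23 (trans (cong H (trans (sym (σ-tail _)) (cong tail σ-rev-σ))) w≡5)

      h-σ⁻¹ : h (σ⁻¹ c) ≡ h (σ d)
      h-σ⁻¹ = trans (cong (λ e → h (σ⁻¹ e)) (sym (rev-invol c))) (cong H (head-σ⁻¹-rev (corner refl)))

      h-rev : h (rev (σ c)) ≡ h (rev c)
      h-rev = cong H (trans (cong tail (rev-invol (σ c))) (trans (σ-tail c) (cong tail (sym (rev-invol c)))))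

      rev-σ⁻¹ : rev (σ⁻¹ c) ≡ σ (rev (σ d))
      rev-σ⁻¹ = trans (cong (λ e → rev (σ⁻¹ e)) (sym (rev-invol c)))
        (trans (cong rev (σ⁻¹-rev (corner refl))) (rev-invol _))

    -- The next neighbour of y is w, and the vertex M of the first payee takes the place of u for w;
    -- but M has degree at least 6.
    hub-step₁ : ∀ {c} → T (hub? (rev c)) → ¬ T (hub? (rev (σ c)))
    hub-step₁ {c} t t′ = <⇒≢ {5} {h (σ⁻¹ (σ⁻¹ (rev c)))} (Payee.6≤M payee) (trans (sym (Payee.u≡5 payee′)) h-σ²-rev-σ)
      where
      payee = proj₁ (hub⁻ {rev c} t)
      payee′ = proj₁ (hub⁻ {rev (σ c)} t′)
      open Hub payee

    -- For the later payee, w is x, M is q and the earlier payee is s. As s has degree 5, the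
    -- exemption holds whether or not the corner between q and u is triangular.
    hub-step₂ : ∀ {c} → T (hub? (rev c)) → ¬ T (hub? (rev (σ (σ c))))
    hub-step₂ {c} t t″ = proj₂ (hub⁻ {d₂} t″) (exempt⁺ record
        { x≡5 = hx ; 17≤q = subst (17 ≤_) (sym (trans (cong h toQ≡) h-σ²-rev-σ)) 17≤M
        ; closed-or-s≡5 = inj₂ (trans (cong h toS≡) h-σ-rev-σ) })
      where
      payee = proj₁ (hub⁻ {rev c} t)
      payee″ = proj₁ (hub⁻ {rev (σ (σ c))} t″)
      open Hub payee
      open Payee payee
      d₁ = rev (σ c)
      d₂ = rev (σ (σ c))
      rev-σ-d₂ : rev (σ d₂) ≡ σ⁻¹ d₁
      rev-σ-d₂ = trans (sym (σ⁻¹-σ _)) (cong σ⁻¹ (trans (sym (rev-invol _)) (cong rev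
        (trans (sym (σ⁻¹-rev (Payee.corner payee″ refl))) (trans (cong σ⁻¹ (rev-invol (σ (σ c)))) (σ⁻¹-σ (σ c)))))))
      toQ≡ : toQ d₂ ≡ σ (σ d₁)
      toQ≡ = trans (cong (λ e → σ⁻¹ (σ⁻¹ e)) rev-σ-d₂) (trans (cong σ⁻¹ (sym (σ³ d₁ deg-w))) (σ⁻¹-σ _))
      toS≡ : toS d₂ ≡ σ d₁
      toS≡ = trans (cong (λ e → σ (σ e)) rev-σ-d₂) (cong σ (σ-σ⁻¹ d₁))
      hx : h (σ d₂) ≡ 5
      hx = trans (cong H (trans (cong tail rev-σ-d₂) (σ⁻¹-tail d₁))) (deg≡⇒H≡ 5≤24 deg-w)
      h-σ⁻¹-d₁ : h (σ⁻¹ d₁) ≡ 5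
      h-σ⁻¹-d₁ = trans (cong h (sym rev-σ-d₂)) (H-tail payee″ (trans (cong tail (rev-invol (σ d₂))) (σ-tail d₂)))
      h-σ⁻²-d₁ : h (σ⁻¹ (σ⁻¹ d₁)) ≡ 5
      h-σ⁻²-d₁ = trans (cong (λ e → h (σ⁻¹ e)) (sym rev-σ-d₂))
        (trans (cong H (head-σ⁻¹-rev (Payee.corner payee″ (σ-tail d₂)))) (Payee.u≡5 payee″))
      17≤M : 17 ≤ h (σ⁻¹ (σ⁻¹ d))
      -- The degrees around w, starting at y, are those of y, 5, M, 5, 5.
      17≤M = payee-big₂ (H-Deg _) (H-Deg _) mid-y λ t → allowed d₁ deg-w
        (subst T (sym (excluded-cong h-rev h-σ-rev-σ h-σ²-rev-σ h-σ⁻²-d₁ h-σ⁻¹-d₁)) t)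

    module Heptagonal (petty? : Fin D → Bool) (petty-deg : ∀ {d} → T (petty? d) → deg G (tail d) ≡ 5)
      (petty-tri : ∀ {d} → T (petty? d) → T (tri? (tail d)))
      (petty-view : ∀ {d} → T (petty? d) → T (petty (h d) (h (σ d)) (h (σ (σ d))) (h (σ⁻¹ (σ⁻¹ d))) (h (σ⁻¹ d)))) where

      module _ {c : Fin D} (t : T (hub? (rev c))) (y≡7 : h (rev c) ≡ 7) where
        private payee = proj₁ (hub⁻ {rev c} t)
        open Hub payee
        open Payee payee

        allowed₇ : ¬ T (excluded 7 (h (σ d)) 5 (h (σ⁻¹ (σ⁻¹ d))) 5)
        allowed₇ = subst (λ y → ¬ T (excluded y (h (σ d)) 5 (h (σ⁻¹ (σ⁻¹ d))) 5)) y≡7 (allowed-payee payee)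

        hub-¬petty : h (σ d) ≤ 7 → ¬ T (petty? d)
        hub-¬petty x≤7 p = ¬petty-payee (H-Deg _) (H-Deg _) x≤7
          (subst T (petty-cong y≡7 (refl {x = h (σ d)}) u≡5 (refl {x = h (σ⁻¹ (σ⁻¹ d))}) w≡5) (petty-view p))

        -- Here M has degree at least 24 and is a neighbour of w too, whereas the large neighbour of
        -- a petty vertex has degree at most 17.
        hub-¬petty-next : h (σ d) ≤ 6 → ¬ T (petty? (rev (σ c)))
        hub-¬petty-next x≤6 p = ¬petty-24 (H-Deg _) (H-Deg _) (H-Deg _)
          (payee₇-24 (H-Deg _) (H-Deg _) (≤⇒≤ᵇ x≤6) allowed₇)
          (subst T (petty-cong (trans h-rev y≡7) h-σ-rev-σ h-σ²-rev-σ (refl {x = h (σ⁻¹ (σ⁻¹ (rev (σ c))))}) (refl {x = h (σ⁻¹ (rev (σ c)))})) (petty-view p))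

        -- The previous neighbour is x. If it were petty, its neighbours v and u of degree 5 would
        -- force q to have degree at least 17 by `petty-17`, and all corners at x are triangular:
        -- the payee would be exempt.
        hub-¬petty-prev : ¬ T (petty? (rev (σ⁻¹ c)))
        hub-¬petty-prev p = proj₂ (hub⁻ {d} t) (exempt⁺ record
            { x≡5 = trans (cong H (trans (sym (σ-tail (rev (σ d)))) (cong tail (sym rev-σ⁻¹)))) (deg≡⇒H≡ 5≤24 (petty-deg p))
            ; 17≤q = subst (17 ≤_) (cong h q≡) (petty-17 (H-Deg _) (H-Deg _) petty′ allowed′)
            ; closed-or-s≡5 = inj₁ (closed⁺ (tri-corner _ (subst (λ v → T (tri? v))
                (trans (sym (tail-σ² e)) (cong tail q≡)) (petty-tri p)))) })
          where
          e = rev (σ⁻¹ c)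
          deg-x : deg G (tail (rev (σ d))) ≡ 5
          deg-x = trans (cong (deg G) (trans (sym (σ-tail _)) (cong tail (sym rev-σ⁻¹)))) (petty-deg p)
          q≡ : σ (σ e) ≡ toQ d
          q≡ = trans (cong (λ e → σ (σ e)) rev-σ⁻¹) (σ³ (rev (σ d)) deg-x)
          σ⁻¹e : σ⁻¹ e ≡ rev (σ d)
          σ⁻¹e = trans (cong σ⁻¹ rev-σ⁻¹) (σ⁻¹-σ _)
          hy : h e ≡ 7
          hy = trans (cong H (trans (cong tail (rev-invol (σ⁻¹ c))) (trans (σ⁻¹-tail c) (cong tail (sym (rev-invol c)))))) y≡7
          hu : h (σ⁻¹ (σ⁻¹ e)) ≡ 5
          hu = trans (cong (λ e → h (σ⁻¹ e)) σ⁻¹e) (trans (cong H (head-σ⁻¹-rev (corner (σ-tail d)))) u≡5)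
          hv : h (σ⁻¹ e) ≡ 5
          hv = trans (cong h σ⁻¹e) (H-tail payee (trans (cong tail (rev-invol (σ d))) (σ-tail d)))
          petty′ : T (petty 7 (h (σ e)) (h (σ (σ e))) 5 5)
          petty′ = subst T (petty-cong hy (refl {x = h (σ e)}) (refl {x = h (σ (σ e))}) hu hv) (petty-view p)
          allowed′ : ¬ T (excluded 7 (h (σ e)) (h (σ (σ e))) 5 5)
          allowed′ t = allowed e (petty-deg p) (subst T (sym (excluded-cong hy (refl {x = h (σ e)}) (refl {x = h (σ (σ e))}) hu hv)) t)

∨-case : ∀ {p q} {P : Set} → (T p → P) → (T q → P) → T (p ∨ q) → P
∨-case {p} f g t = [ f , g ]′ (∨⁻ {p} t)

sum-term : ∀ {n} (f : Fin n → ℕ) i → f i ≤ sum f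
sum-term f zero = m≤m+n (f zero) _
sum-term f (suc i) = m≤n⇒m≤o+n (f zero) (sum-term (λ i → f (suc i)) i)

minor? : ∀ G w h → Dec (HasMinor5Star G w h)
minor? G w h = any? λ v → any? λ d → tail d F.≟ v ×-dec (deg G v ≟ 5 ×-dec (starWeight G v d ≤? w ×-dec
    (deg G v ≤? h ×-dec (deg G (nb G d 0) ≤? h ×-dec (deg G (nb G d 1) ≤? h ×-dec (deg G (nb G d 2) ≤? h ×-dec
      (deg G (nb G d 3) ≤? h ×-dec deg G (nb G d 4) ≤? h)))))))
  where
  open RotSys G

-- A hypothetical counterexample and its forbidden wheels

module Counterexample (G : RotSys) (plane : IsSimplePlane G) (minDeg : ∀ v → 5 ≤ deg G v)
  (¬star₁ : ¬ HasStar G (fin 5) (fin 6) (fin 6) (fin 5) ∞)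
  (¬star₂ : ¬ HasStar G (fin 5) (fin 6) (fin 7) (fin 5) (fin 23))
  (¬minor : ¬ HasMinor5Star G 45 17) where

  open Map G plane minDeg
  open Degrees G minDeg

  -- The darts are parameters tied by equations, so that re-rooting at the next dart is a mere
  -- permutation of the fields; iterates of `rot` would close up only after rewriting.
  record Pentagon (a b c d e : Fin D) : Set where
    constructor pentagon
    field
      deg5 : deg G (tail a) ≡ 5
      ab : rot a ≡ b
      bc : rot b ≡ c
      cd : rot c ≡ d
      de : rot d ≡ e
      ea : rot e ≡ a

    ae : rot⁻¹ a ≡ e
    ae = trans (cong rot⁻¹ (sym ea)) (rot⁻¹-rot e)

    tail-b : tail b ≡ tail a
    tail-b = trans (cong tail (sym ab)) (rot-tail a)

  turn-pentagon : ∀ {a b c d e} → Pentagon a b c d e → Pentagon b c d e a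
  turn-pentagon p@(pentagon deg5 ab bc cd de ea) = pentagon (trans (cong (deg G) (Pentagon.tail-b p)) deg5) bc cd de ea ab

  rot⁵ : ∀ d → deg G (tail d) ≡ 5 → rot (rot (rot (rot (rot d)))) ≡ d
  rot⁵ d d5 = trans (cong (λ k → iter k rot d) (sym d5)) (Turn.closed (turn d))

  at-dart : ∀ d → deg G (tail d) ≡ 5 → Pentagon d (rot d) (rot (rot d)) (rot (rot (rot d))) (rot (rot (rot (rot d))))
  at-dart d d5 = pentagon d5 refl refl refl refl (rot⁵ d d5)

  H≤⇒deg≤ : ∀ {v k} → k ≤ 23 → T (H v ≤ᵇ k) → deg G v ≤ k
  H≤⇒deg≤ {v} {k} k≤23 t = subst (_≤ k) (below-24 {v} (≤-trans H≤k k≤23)) H≤k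
    where H≤k = ≤ᵇ⇒≤ (H v) k t

  module _ {a b c d e : Fin D} (p : Pentagon a b c d e) where
    open Pentagon p

    private
      nb≡ : (P : Fin n → Fin n → Fin n → Fin n → Fin n → Set) → P (head G a) (head G b) (head G c) (head G d) (head G e) →
        P (nb G a 0) (nb G a 1) (nb G a 2) (nb G a 3) (nb G a 4)
      nb≡ P x = lemma ab bc cd de x
        where
        lemma : ∀ {b c d e} → rot a ≡ b → rot b ≡ c → rot c ≡ d → rot d ≡ e →
          P (head G a) (head G b) (head G c) (head G d) (head G e) → P (nb G a 0) (nb G a 1) (nb G a 2) (nb G a 3) (nb G a 4)
        lemma refl refl refl refl x = x

    ¬starred : ¬ T (starred (h a) (h b) (h c) (h d) (h e))
    ¬starred t with ∧⁻ {h a ≤ᵇ 5} t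
    ... | ta , t with ∧⁻ {h b ≤ᵇ 6} t
    ... | tb , t with ∧⁻ {h d ≤ᵇ 5} t
    ... | td , t with ∨⁻ {h c ≤ᵇ 6} t
    ... | inj₁ tc = ¬star₁ (tail a , deg5 , a , refl , inj₁ (nb≡ (λ a b c d e → deg G a ≤ 5 × deg G b ≤ 6 × deg G c ≤ 6 × deg G d ≤ 5 × deg G e ≤Bd ∞)
      (H≤⇒deg≤ (m≤m+n 5 18) ta , H≤⇒deg≤ (m≤m+n 6 17) tb , H≤⇒deg≤ (m≤m+n 6 17) tc , H≤⇒deg≤ (m≤m+n 5 18) td , tt)))
    ... | inj₂ t with ∧⁻ {h c ≤ᵇ 7} t
    ... | tc , te = ¬star₂ (tail a , deg5 , a , refl , inj₁ (nb≡ (λ a b c d e → deg G a ≤ 5 × deg G b ≤ 6 × deg G c ≤ 7 × deg G d ≤ 5 × deg G e ≤ 23)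
      (H≤⇒deg≤ (m≤m+n 5 18) ta , H≤⇒deg≤ (m≤m+n 6 17) tb , H≤⇒deg≤ (m≤m+n 7 16) tc , H≤⇒deg≤ (m≤m+n 5 18) td , H≤⇒deg≤ ≤-refl te)))

    ¬starred′ : ¬ T (starred (h a) (h e) (h d) (h c) (h b))
    ¬starred′ t with ∧⁻ {h a ≤ᵇ 5} t
    ... | ta , t with ∧⁻ {h e ≤ᵇ 6} t
    ... | te , t with ∧⁻ {h c ≤ᵇ 5} t
    ... | tc , t with ∨⁻ {h d ≤ᵇ 6} t
    ... | inj₁ td = ¬star₁ (tail a , deg5 , a , refl , inj₂ (nb≡ (λ a b c d e → deg G a ≤ 5 × deg G e ≤ 6 × deg G d ≤ 6 × deg G c ≤ 5 × deg G b ≤Bd ∞)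
      (H≤⇒deg≤ (m≤m+n 5 18) ta , H≤⇒deg≤ (m≤m+n 6 17) te , H≤⇒deg≤ (m≤m+n 6 17) td , H≤⇒deg≤ (m≤m+n 5 18) tc , tt)))
    ... | inj₂ t with ∧⁻ {h d ≤ᵇ 7} t
    ... | td , tb = ¬star₂ (tail a , deg5 , a , refl , inj₂ (nb≡ (λ a b c d e → deg G a ≤ 5 × deg G e ≤ 6 × deg G d ≤ 7 × deg G c ≤ 5 × deg G b ≤ 23)
      (H≤⇒deg≤ (m≤m+n 5 18) ta , H≤⇒deg≤ (m≤m+n 6 17) te , H≤⇒deg≤ (m≤m+n 7 16) td , H≤⇒deg≤ (m≤m+n 5 18) tc , H≤⇒deg≤ ≤-refl tb)))

    ¬light : ¬ T (light (h a) (h b) (h c) (h d) (h e))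
    ¬light t with ∧⁻ {h a + h b + h c + h d + h e ≤ᵇ 40} t
    ... | ts , t with ∧⁻ {h a ≤ᵇ 17} t
    ... | ta , t with ∧⁻ {h b ≤ᵇ 17} t
    ... | tb , t with ∧⁻ {h c ≤ᵇ 17} t
    ... | tc , t with ∧⁻ {h d ≤ᵇ 17} t
    ... | td , te = ¬minor (tail a , a , refl , deg5 ,
        subst (_≤ 45) (cong (λ z → z + deg G (nb G a 0) + deg G (nb G a 1) + deg G (nb G a 2) + deg G (nb G a 3) + deg G (nb G a 4)) (sym deg5)) weight≤ ,
        ≤-trans (≤-reflexive deg5) (m≤m+n 5 12) ,
        nb≡ (λ a b c d e → deg G a ≤ 17 × deg G b ≤ 17 × deg G c ≤ 17 × deg G d ≤ 17 × deg G e ≤ 17) (le ta , le tb , le tc , le td , le te))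
      where
      le : ∀ {v} → T (H v ≤ᵇ 17) → deg G v ≤ 17
      le = H≤⇒deg≤ (m≤m+n 17 6)
      eq : ∀ {v} → T (H v ≤ᵇ 17) → H v ≡ deg G v
      eq {v} t = below-24 {v} (≤-trans (≤ᵇ⇒≤ (H v) 17 t) (m≤m+n 17 6))
      weight≤ : 5 + deg G (nb G a 0) + deg G (nb G a 1) + deg G (nb G a 2) + deg G (nb G a 3) + deg G (nb G a 4) ≤ 45
      weight≤ = +-monoʳ-≤ 5 (nb≡ (λ a b c d e → deg G a + deg G b + deg G c + deg G d + deg G e ≤ 40)
        (subst (_≤ 40) (cong₂ _+_ (cong₂ _+_ (cong₂ _+_ (cong₂ _+_ (eq ta) (eq tb)) (eq tc)) (eq td)) (eq te))
          (≤ᵇ⇒≤ (h a + h b + h c + h d + h e) 40 ts)))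

  module _ {a b c d e : Fin D} (p : Pentagon a b c d e) where
    private
      p₁ = turn-pentagon p
      p₂ = turn-pentagon p₁
      p₃ = turn-pentagon p₂
      p₄ = turn-pentagon p₃

    ¬starred⟲ : ¬ T (starred⟲ (h a) (h b) (h c) (h d) (h e))
    ¬starred⟲ = ∨-case {starred (h a) (h b) (h c) (h d) (h e)} (¬starred p)
      (∨-case {starred (h b) (h c) (h d) (h e) (h a)} (¬starred p₁)
      (∨-case {starred (h c) (h d) (h e) (h a) (h b)} (¬starred p₂)
      (∨-case {starred (h d) (h e) (h a) (h b) (h c)} (¬starred p₃) (¬starred p₄))))

    ¬starred⟲′ : ¬ T (starred⟲ (h a) (h e) (h d) (h c) (h b))
    ¬starred⟲′ = ∨-case {starred (h a) (h e) (h d) (h c) (h b)} (¬starred′ p)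
      (∨-case {starred (h e) (h d) (h c) (h b) (h a)} (¬starred′ p₄)
      (∨-case {starred (h d) (h c) (h b) (h a) (h e)} (¬starred′ p₃)
      (∨-case {starred (h c) (h b) (h a) (h e) (h d)} (¬starred′ p₂) (¬starred′ p₁))))

    ¬excluded : ¬ T (excluded (h a) (h b) (h c) (h d) (h e))
    ¬excluded = ∨-case {light (h a) (h b) (h c) (h d) (h e)} (¬light p)
      (∨-case {starred⟲ (h a) (h b) (h c) (h d) (h e)} ¬starred⟲ ¬starred⟲′)

    ¬excluded′ : ¬ T (excluded (h a) (h e) (h d) (h c) (h b))
    ¬excluded′ = ∨-case {light (h a) (h e) (h d) (h c) (h b)} (λ t → ¬light p (light-sym {h a} {h e} {h d} {h c} {h b} t))
      (∨-case {starred⟲ (h a) (h e) (h d) (h c) (h b)} ¬starred⟲′ ¬starred⟲)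
      where
      reverse-sum : ∀ a b c d e → a + b + c + d + e ≡ a + e + d + c + b
      reverse-sum = solve-∀
      light-sym : ∀ {a b c d e} → T (light a b c d e) → T (light a e d c b)
      light-sym {a} {b} {c} {d} {e} t with ∧⁻ {a + b + c + d + e ≤ᵇ 40} t
      ... | ts , t with ∧⁻ {a ≤ᵇ 17} t
      ... | ta , t with ∧⁻ {b ≤ᵇ 17} t
      ... | tb , t with ∧⁻ {c ≤ᵇ 17} t
      ... | tc , t with ∧⁻ {d ≤ᵇ 17} t
      ... | td , te = ∧⁺ {a + e + d + c + b ≤ᵇ 40} (subst (λ s → T (s ≤ᵇ 40)) (reverse-sum a b c d e) ts) (∧⁺ {a ≤ᵇ 17} ta (∧⁺ {e ≤ᵇ 17} te (∧⁺ {d ≤ᵇ 17} td (∧⁺ {c ≤ᵇ 17} tc tb))))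

  module Openᴿ = Corner tail rev rot rot⁻¹ rev-invol rot-rot⁻¹ rot⁻¹-rot rot-tail
  module Openᴸ = Corner tail rev rot⁻¹ rot rev-invol rot⁻¹-rot rot-rot⁻¹ rot⁻¹-tail

  opened : Fin D → ℕ
  opened d = gate (Openᴿ.open? d) 1

  triangulated? : Fin n → Bool
  triangulated? v = at v opened ≡ᵇ 0

  triangleᴿ : ∀ c → T (triangulated? (tail c)) → Openᴿ.Triangle c
  triangleᴿ c t = Openᴿ.closed λ o → n≮0 (≤-trans
    (≤-reflexive (sym (trans (gate-true {eqF (tail c) (tail c)} (eqF⁺ refl)) (gate-true o))))
    (≤-trans (sum-term (λ d → gate (eqF (tail d) (tail c)) (opened d)) c) (≤-reflexive (≡ᵇ⇒≡ (at (tail c) opened) 0 t))))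

  flip-triangle : ∀ {c} → Openᴿ.Triangle (rot⁻¹ c) → Openᴸ.Triangle c
  flip-triangle {c} tri = subst Openᴸ.Triangle (rot-rot⁻¹ c) (Openᴿ.mirror tri)

  flip-triangle⁻ : ∀ {c} → Openᴸ.Triangle c → Openᴿ.Triangle (rot⁻¹ c)
  flip-triangle⁻ {c} tri = Openᴸ.mirror tri

  openᴸ : ∀ c → Openᴸ.open? c ≡ Openᴿ.open? (rot⁻¹ c)
  openᴸ c = cong not (T-iff (λ t → eqF⁺ (flip-triangle⁻ (eqF⁻ t))) (λ t → eqF⁺ (flip-triangle (eqF⁻ t))))

  rot⁻⁵ : ∀ d → deg G (tail d) ≡ 5 → rot⁻¹ (rot⁻¹ (rot⁻¹ (rot⁻¹ (rot⁻¹ d)))) ≡ d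
  rot⁻⁵ d d5 = trans (cong (λ e → rot⁻¹ (rot⁻¹ (rot⁻¹ (rot⁻¹ (rot⁻¹ e))))) (sym (rot⁵ d d5)))
    (trans (step³ (rot (rot d))) (trans (cong rot⁻¹ (rot⁻¹-rot (rot d))) (rot⁻¹-rot d)))
    where
    step³ : ∀ x → rot⁻¹ (rot⁻¹ (rot⁻¹ (rot⁻¹ (rot⁻¹ (rot (rot (rot x))))))) ≡ rot⁻¹ (rot⁻¹ x)
    step³ x = cong (λ e → rot⁻¹ (rot⁻¹ e)) (trans (cong (λ e → rot⁻¹ (rot⁻¹ e)) (rot⁻¹-rot (rot (rot x))))
      (trans (cong rot⁻¹ (rot⁻¹-rot (rot x))) (rot⁻¹-rot x)))

  pentagonʰ : ∀ {a b c d e} (P : (x y z u v : ℕ) → Set) → Pentagon a b c d e → P (h a) (h b) (h c) (h d) (h e) →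
    P (h a) (h (rot a)) (h (rot (rot a))) (h (rot⁻¹ (rot⁻¹ a))) (h (rot⁻¹ a))
  pentagonʰ {a} P (pentagon _ refl refl refl refl ea) x =
    subst₂ (λ d e → P (h a) (h (rot a)) (h (rot (rot a))) (h d) (h e))
      (sym (trans (cong rot⁻¹ ae) (rot⁻¹-rot _))) (sym ae) x
    where
    ae : rot⁻¹ a ≡ rot (rot (rot (rot a)))
    ae = trans (cong rot⁻¹ (sym ea)) (rot⁻¹-rot _)

  allowedᴿ : ∀ d → deg G (tail d) ≡ 5 → ¬ T (excluded (h d) (h (rot d)) (h (rot (rot d))) (h (rot⁻¹ (rot⁻¹ d))) (h (rot⁻¹ d)))
  allowedᴿ d d5 = pentagonʰ (λ x y z u v → ¬ T (excluded x y z u v)) (at-dart d d5) (¬excluded (at-dart d d5))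

  allowedᴸ : ∀ d → deg G (tail d) ≡ 5 → ¬ T (excluded (h d) (h (rot⁻¹ d)) (h (rot⁻¹ (rot⁻¹ d))) (h (rot (rot d))) (h (rot d)))
  allowedᴸ d d5 = pentagonʰ (λ x y z u v → ¬ T (excluded x v u z y)) (at-dart d d5) (¬excluded′ (at-dart d d5))

  triangleᴸ : ∀ c → T (triangulated? (tail c)) → Openᴸ.Triangle c
  triangleᴸ c t = flip-triangle (triangleᴿ (rot⁻¹ c) (subst (λ v → T (triangulated? v)) (sym (rot⁻¹-tail c)) t))

  module Right = Side rev-invol rot rot⁻¹ rot-rot⁻¹ rot⁻¹-rot rot-tail rot⁵ triangulated? triangleᴿ allowedᴿ
  module Left = Side rev-invol rot⁻¹ rot rot⁻¹-rot rot-rot⁻¹ rot⁻¹-tail rot⁻⁵ triangulated?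
    triangleᴸ allowedᴸ

  petty? : Fin D → Bool
  petty? d = five? d ∧ (triangulated? (tail d) ∧ petty (h d) (h (rot d)) (h (rot (rot d))) (h (rot⁻¹ (rot⁻¹ d))) (h (rot⁻¹ d)))

  petty-five : ∀ {d} → T (petty? d) → deg G (tail d) ≡ 5
  petty-five {d} t = ≡ᵇ⇒≡ (deg G (tail d)) 5 (proj₁ (∧⁻ {five? d} t))

  petty-triangulated : ∀ {d} → T (petty? d) → T (triangulated? (tail d))
  petty-triangulated {d} t = proj₁ (∧⁻ {triangulated? (tail d)} (proj₂ (∧⁻ {five? d} t)))

  petty-view : ∀ {d} → T (petty? d) → T (petty (h d) (h (rot d)) (h (rot (rot d))) (h (rot⁻¹ (rot⁻¹ d))) (h (rot⁻¹ d)))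
  petty-view {d} t = proj₂ (∧⁻ {triangulated? (tail d)} (proj₂ (∧⁻ {five? d} t)))

  petty-seven : ∀ {d} → T (petty? d) → h d ≡ 7
  petty-seven {d} t = ≡ᵇ⇒≡ (h d) 7 (proj₁ (∧⁻ {h d ≡ᵇ 7} (petty-view t)))

  -- Amounts received and sent

  -- Indexed by the dart from the receiving 5-vertex to the neighbour on whose account it receives,
  -- even if u or x makes the payment.
  direct bonusᴿ bonusᴸ fromPetty receive : Fin D → ℕ
  direct d = gate (five? d) (2 * half (h d))
  bonusᴿ d = gate (five? d ∧ (not (Openᴿ.open? d) ∧ (6 ≤ᵇ h (rot d)))) (half (h d))
  bonusᴸ d = gate (five? d ∧ (not (Openᴸ.open? d) ∧ (6 ≤ᵇ h (rot⁻¹ d)))) (half (h d))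
  fromPetty d = gate (petty? d) 6
  receive d = (direct d + (bonusᴿ d + bonusᴸ d)) + ((Right.paid d + Left.paid d) + fromPetty d)

  -- Indexed by the dart leaving the payer. The shifts in `donations` solve `c = rev (σ (σ d))` and
  -- `c = rev (σ d)` for the dart `d` of the payee, with `σ` either rotation.
  direct↑ bonus↑ demands donations send : Fin D → ℕ
  direct↑ c = gate (deg G (head G c) ≡ᵇ 5) (2 * half (H (tail c)))
  bonus↑ c = gate (6 ≤ᵇ h c) (half (H (tail c)))
  demands c = (Right.fromHub (rev c) + Left.fromHub (rev c)) + fromPetty (rev c)
  donations c = (Right.fromU (rot⁻¹ (rot⁻¹ (rev c))) + Left.fromU (rot (rot (rev c)))) +
    (Right.fromX (rot⁻¹ (rev c)) + Left.fromX (rot (rev c)))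
  send c = (direct↑ c + (bonus↑ c + bonus↑ c)) + (demands c + donations c)

  direct-sent : sum direct ≡ sum direct↑
  direct-sent = trans (sum-cong-≗ λ d → cong (λ e → gate (deg G (tail e) ≡ᵇ 5) (2 * half (h d))) (sym (rev-invol d))) (sum-rev direct↑)

  -- In a triangle the dart `rot⁻¹ (rev d)` runs along the opposite side, from the large neighbour
  -- to the head of `rot d`, and one of its two halves is this bonus. Halves next to an open corner,
  -- or towards a vertex of another degree, are not claimed, hence the inequality.
  bonusᴿ-sent : sum bonusᴿ ≤ sum bonus↑
  bonusᴿ-sent = ≤-trans (sum-mono pointwise)
    (≤-reflexive (trans (sum-rev (λ d → bonus↑ (rot⁻¹ d))) (sum-rot⁻¹ bonus↑)))
    where
    pointwise : ∀ d → bonusᴿ d ≤ bonus↑ (rot⁻¹ (rev d))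
    pointwise d = gate-bound λ t → bound (proj₂ (∧⁻ {five? d} t))
      where
      bound : T (not (Openᴿ.open? d) ∧ (6 ≤ᵇ h (rot d))) → half (h d) ≤ bonus↑ (rot⁻¹ (rev d))
      bound t = ≤-reflexive (sym (trans (gate-true (subst (λ v → T (6 ≤ᵇ H v)) (sym (Openᴿ.head-σ⁻¹-rev tri)) (proj₂ (∧⁻ {not (Openᴿ.open? d)} t))))
          (cong (λ v → half (H v)) (rot⁻¹-tail (rev d)))))
        where tri = Openᴿ.closed (T-not⇒¬ (proj₁ (∧⁻ {not (Openᴿ.open? d)} t)))

  bonusᴸ-sent : sum bonusᴸ ≤ sum bonus↑
  bonusᴸ-sent = ≤-trans (sum-mono pointwise)
    (≤-reflexive (trans (sum-rev (λ d → bonus↑ (rot d))) (sum-rot bonus↑)))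
    where
    pointwise : ∀ d → bonusᴸ d ≤ bonus↑ (rot (rev d))
    pointwise d = gate-bound λ t → bound (proj₂ (∧⁻ {five? d} t))
      where
      bound : T (not (Openᴸ.open? d) ∧ (6 ≤ᵇ h (rot⁻¹ d))) → half (h d) ≤ bonus↑ (rot (rev d))
      bound t = ≤-reflexive (sym (trans (gate-true (subst (λ v → T (6 ≤ᵇ H v)) (sym (Openᴸ.head-σ⁻¹-rev tri)) (proj₂ (∧⁻ {not (Openᴸ.open? d)} t))))
          (cong (λ v → half (H v)) (rot-tail (rev d)))))
        where tri = Openᴸ.closed (T-not⇒¬ (proj₁ (∧⁻ {not (Openᴸ.open? d)} t)))

  sum-+₃ : ∀ (f g k : Fin D → ℕ) → sum (λ d → f d + (g d + k d)) ≡ sum f + (sum g + sum k)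
  sum-+₃ f g k = trans (∑-distrib-+ f (λ d → g d + k d)) (cong (sum f +_) (∑-distrib-+ g k))

  paidᴿ-sent : sum Right.paid ≡
    sum (λ c → Right.fromHub (rev c)) + (sum (λ c → Right.fromU (rot⁻¹ (rot⁻¹ (rev c)))) + sum (λ c → Right.fromX (rot⁻¹ (rev c))))
  paidᴿ-sent = trans (sum-cong-≗ Right.paid-split) (trans (sum-+₃ Right.fromHub Right.fromU Right.fromX)
    (cong₂ _+_ (sym (sum-rev Right.fromHub)) (cong₂ _+_
      (sym (trans (sum-rev (λ d → Right.fromU (rot⁻¹ (rot⁻¹ d)))) (trans (sum-rot⁻¹ (λ d → Right.fromU (rot⁻¹ d))) (sum-rot⁻¹ Right.fromU))))
      (sym (trans (sum-rev (λ d → Right.fromX (rot⁻¹ d))) (sum-rot⁻¹ Right.fromX))))))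

  paidᴸ-sent : sum Left.paid ≡
    sum (λ c → Left.fromHub (rev c)) + (sum (λ c → Left.fromU (rot (rot (rev c)))) + sum (λ c → Left.fromX (rot (rev c))))
  paidᴸ-sent = trans (sum-cong-≗ Left.paid-split) (trans (sum-+₃ Left.fromHub Left.fromU Left.fromX)
    (cong₂ _+_ (sym (sum-rev Left.fromHub)) (cong₂ _+_
      (sym (trans (sum-rev (λ d → Left.fromU (rot (rot d)))) (trans (sum-rot (λ d → Left.fromU (rot d))) (sum-rot Left.fromU))))
      (sym (trans (sum-rev (λ d → Left.fromX (rot d))) (sum-rot Left.fromX))))))

  received≤sent : sum receive ≤ sum send
  received≤sent = begin
    sum receive
      ≡⟨ trans (∑-distrib-+ (λ d → direct d + (bonusᴿ d + bonusᴸ d)) (λ d → (Right.paid d + Left.paid d) + fromPetty d))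
           (cong₂ _+_ (sum-+₃ direct bonusᴿ bonusᴸ)
             (trans (∑-distrib-+ (λ d → Right.paid d + Left.paid d) fromPetty) (cong (_+ sum fromPetty) (∑-distrib-+ Right.paid Left.paid)))) ⟩
    (sum direct + (sum bonusᴿ + sum bonusᴸ)) + ((sum Right.paid + sum Left.paid) + sum fromPetty)
      ≤⟨ +-mono-≤ (+-mono-≤ (≤-reflexive direct-sent) (+-mono-≤ bonusᴿ-sent bonusᴸ-sent))
           (≤-reflexive (cong₂ _+_ (cong₂ _+_ paidᴿ-sent paidᴸ-sent) (sym (sum-rev fromPetty)))) ⟩
    (sum direct↑ + (sum bonus↑ + sum bonus↑)) +
      (((hr + (ur + xr)) + (hl + (ul + xl))) + sum (λ c → fromPetty (rev c)))
      ≡⟨ cong ((sum direct↑ + (sum bonus↑ + sum bonus↑)) +_) (rearrange hr ur xr hl ul xl (sum (λ c → fromPetty (rev c)))) ⟩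
    (sum direct↑ + (sum bonus↑ + sum bonus↑)) + (((hr + hl) + sum (λ c → fromPetty (rev c))) + ((ur + ul) + (xr + xl)))
      ≡⟨ sym (trans (∑-distrib-+ (λ c → direct↑ c + (bonus↑ c + bonus↑ c)) (λ c → demands c + donations c))
           (cong₂ _+_ (sum-+₃ direct↑ bonus↑ bonus↑) (trans (∑-distrib-+ demands donations) (cong₂ _+_
             (trans (∑-distrib-+ (λ c → Right.fromHub (rev c) + Left.fromHub (rev c)) (λ c → fromPetty (rev c)))
               (cong (_+ sum (λ c → fromPetty (rev c))) (∑-distrib-+ (λ c → Right.fromHub (rev c)) (λ c → Left.fromHub (rev c)))))
             (trans (∑-distrib-+ (λ c → Right.fromU (rot⁻¹ (rot⁻¹ (rev c))) + Left.fromU (rot (rot (rev c))))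
                 (λ c → Right.fromX (rot⁻¹ (rev c)) + Left.fromX (rot (rev c))))
               (cong₂ _+_ (∑-distrib-+ (λ c → Right.fromU (rot⁻¹ (rot⁻¹ (rev c)))) (λ c → Left.fromU (rot (rot (rev c)))))
                 (∑-distrib-+ (λ c → Right.fromX (rot⁻¹ (rev c))) (λ c → Left.fromX (rot (rev c)))))))))) ⟩
    sum send ∎
    where
    open ≤-Reasoning
    hr = sum (λ c → Right.fromHub (rev c))
    hl = sum (λ c → Left.fromHub (rev c))
    ur = sum (λ c → Right.fromU (rot⁻¹ (rot⁻¹ (rev c))))
    ul = sum (λ c → Left.fromU (rot (rot (rev c))))
    xr = sum (λ c → Right.fromX (rot⁻¹ (rev c)))
    xl = sum (λ c → Left.fromX (rot (rev c)))
    rearrange : ∀ hr ur xr hl ul xl p → ((hr + (ur + xr)) + (hl + (ul + xl))) + p ≡ ((hr + hl) + p) + ((ur + ul) + (xr + xl))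
    rearrange = solve-∀

  -- The balance of a 5-vertex

  at-mono : ∀ {v} {f g : Fin D → ℕ} → (∀ d → tail d ≡ v → f d ≤ g d) → at v f ≤ at v g
  at-mono {v} f≤g = sum-mono λ d → gate-mono (eqF (tail d) v) λ t → f≤g d (eqF⁻ t)

  at-+ : ∀ v f g → at v (λ d → f d + g d) ≡ at v f + at v g
  at-+ v f g = trans (sum-cong-≗ (λ d → gate-+ (eqF (tail d) v) (f d) (g d)))
    (∑-distrib-+ (λ d → gate (eqF (tail d) v) (f d)) (λ d → gate (eqF (tail d) v) (g d)))

  at-* : ∀ v k f → at v (λ d → k * f d) ≡ k * at v f
  at-* v k f = trans (sum-cong-≗ (λ d → gate-* (eqF (tail d) v) k (f d))) (sym (*-distribˡ-sum k (λ d → gate (eqF (tail d) v) (f d))))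

  at-rot : ∀ v f → at v (λ d → f (rot d)) ≡ at v f
  at-rot v f = trans (sum-cong-≗ (λ d → cong (λ w → gate (eqF w v) (f (rot d))) (sym (rot-tail d)))) (sum-rot (λ d → gate (eqF (tail d) v) (f d)))

  at-rot⁻¹ : ∀ v f → at v (λ d → f (rot⁻¹ d)) ≡ at v f
  at-rot⁻¹ v f = trans (sum-cong-≗ (λ d → cong (λ w → gate (eqF w v) (f (rot⁻¹ d))) (sym (rot⁻¹-tail d)))) (sum-rot⁻¹ (λ d → gate (eqF (tail d) v) (f d)))

  at-five : ∀ {a b c d e} → Pentagon a b c d e → ∀ f → at (tail a) f ≡ cyc (λ a _ _ _ _ → f a) a b c d e
  at-five {a} (pentagon deg5 refl refl refl refl _) f =
    trans (subst (λ k → at (tail a) f ≡ sum {k} (λ i → f (iter (toℕ i) rot a))) deg5 (Turn.total (turn a) f))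
      (drop-zero (f a) (f (rot a)) (f (rot (rot a))) (f (rot (rot (rot a)))) (f (rot (rot (rot (rot a))))))
    where
    drop-zero : ∀ k l m n o → k + (l + (m + (n + (o + 0)))) ≡ k + (l + (m + (n + o)))
    drop-zero = solve-∀

  flagged : Fin D → Flagged ℕ
  flagged d = h d , Openᴿ.open? d

  module _ {f : Fin D → ℕ} {g : (a b c d e : Flagged ℕ) → ℕ} where

    at≤cyc : (∀ {a b c d e} → Pentagon a b c d e → f a ≤ g (flagged a) (flagged b) (flagged c) (flagged d) (flagged e)) →
      ∀ {a b c d e} → Pentagon a b c d e → at (tail a) f ≤ cyc g (flagged a) (flagged b) (flagged c) (flagged d) (flagged e)
    at≤cyc f≤g p = ≤-trans (≤-reflexive (at-five p f)) (+-mono-≤ (f≤g p) (+-mono-≤ (f≤g p₁) (+-mono-≤ (f≤g p₂) (+-mono-≤ (f≤g p₃) (f≤g p₄)))))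
      where
      p₁ = turn-pentagon p
      p₂ = turn-pentagon p₁
      p₃ = turn-pentagon p₂
      p₄ = turn-pentagon p₃

    cyc≤at : ∀ {a b c d e} → Pentagon a b c d e →
      (∀ {a′ b′ c′ d′ e′} → Pentagon a′ b′ c′ d′ e′ → tail a′ ≡ tail a → g (flagged a′) (flagged b′) (flagged c′) (flagged d′) (flagged e′) ≤ f a′) →
      cyc g (flagged a) (flagged b) (flagged c) (flagged d) (flagged e) ≤ at (tail a) f
    cyc≤at p g≤f = ≤-trans (+-mono-≤ (g≤f p refl) (+-mono-≤ (g≤f p₁ t₁) (+-mono-≤ (g≤f p₂ t₂) (+-mono-≤ (g≤f p₃ t₃) (g≤f p₄ t₄)))))
        (≤-reflexive (sym (at-five p f)))
      where
      p₁ = turn-pentagon p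
      p₂ = turn-pentagon p₁
      p₃ = turn-pentagon p₂
      p₄ = turn-pentagon p₃
      t₁ = Pentagon.tail-b p
      t₂ = trans (Pentagon.tail-b p₁) t₁
      t₃ = trans (Pentagon.tail-b p₂) t₂
      t₄ = trans (Pentagon.tail-b p₃) t₃

  h-rev : ∀ c → h (rev c) ≡ H (tail c)
  h-rev c = cong (λ e → H (tail e)) (rev-invol c)

  demands-zero : ∀ c → ¬ T (isMid (H (tail c))) → demands c ≡ 0
  demands-zero c ¬mid = cong₂ _+_ (cong₂ _+_
      (gate-false λ t → ¬mid′ (Right.Payee.mid-y (proj₁ (Right.hub⁻ t))))
      (gate-false λ t → ¬mid′ (Left.Payee.mid-y (proj₁ (Left.hub⁻ t)))))
      (gate-false λ t → seven (petty-seven t))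
    where
    ¬mid′ : ¬ T (isMid (h (rev c)))
    ¬mid′ = subst (λ k → ¬ T (isMid k)) (sym (h-rev c)) ¬mid
    seven : h (rev c) ≢ 7
    seven eq = ¬mid′ (subst (λ k → T (isMid k)) (sym eq) tt)

  donations-zero : ∀ c → deg G (tail c) ≢ 5 → donations c ≡ 0
  donations-zero c ≢5 = cong₂ _+_
      (cong₂ _+_ (Right.fromU-five _ (sym (trans (cong rev (trans (cong rot (rot-rot⁻¹ _)) (rot-rot⁻¹ _))) (rev-invol c))) ≢5)
        (Left.fromU-five _ (sym (trans (cong rev (trans (cong rot⁻¹ (rot⁻¹-rot _)) (rot⁻¹-rot _))) (rev-invol c))) ≢5))
      (cong₂ _+_ (Right.fromX-five _ (sym (trans (cong rev (rot-rot⁻¹ _)) (rev-invol c))) ≢5)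
        (Left.fromX-five _ (sym (trans (cong rev (rot⁻¹-rot _)) (rev-invol c))) ≢5))

  -- As `half 5 = 0` and demands concern degrees 7 to 9 only, a 5-vertex sends nothing but
  -- donations.
  send≤gifts : ∀ {a b c d e} → Pentagon a b c d e → send a ≤ gifts (flagged a) (flagged b) (flagged c) (flagged d) (flagged e)
  send≤gifts {a} p@(pentagon deg5 refl refl refl refl ea) = begin
    send a
      ≡⟨ cong (_+ (demands a + donations a)) (cong₂ _+_ (zero-half (deg G (head G a) ≡ᵇ 5) (λ H → 2 * half H) refl)
           (cong₂ _+_ (zero-half (6 ≤ᵇ h a) half refl) (zero-half (6 ≤ᵇ h a) half refl))) ⟩
    demands a + donations a
      ≡⟨ cong (_+ donations a) (demands-zero a (subst (λ H → ¬ T (isMid H)) (sym H5) λ ())) ⟩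
    donations a
      ≤⟨ +-mono-≤ (+-mono-≤ u₁ u₂) (+-mono-≤ x₁ x₂) ⟩
    gifts (flagged a) (flagged (rot a)) (flagged (rot (rot a))) (flagged d′) (flagged e′) ∎
    where
    open ≤-Reasoning
    d′ = rot (rot (rot a))
    e′ = rot d′
    H5 : H (tail a) ≡ 5
    H5 = deg≡⇒H≡ 5≤24 deg5
    zero-half : ∀ b (f : ℕ → ℕ) → f 5 ≡ 0 → gate b (f (H (tail a))) ≡ 0
    zero-half b f eq = trans (cong (λ H → gate b (f H)) H5) (trans (cong (gate b) eq) (gate-zero b))
      where
      gate-zero : ∀ b → gate b 0 ≡ 0
      gate-zero true = refl
      gate-zero false = refl
    e≡ : rot⁻¹ a ≡ e′
    e≡ = Pentagon.ae p
    d≡ : rot⁻¹ (rot⁻¹ a) ≡ d′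
    d≡ = trans (cong rot⁻¹ e≡) (rot⁻¹-rot d′)
    u₁ : Right.fromU (rot⁻¹ (rot⁻¹ (rev a))) ≤ gift₁ (kind (h e′)) (kind (h a)) (kind (h (rot a))) (kind (h (rot (rot a)))) * spare (h e′)
    u₁ = subst (λ e → Right.fromU (rot⁻¹ (rot⁻¹ (rev a))) ≤ gift₁ (kind (h e)) (kind (h a)) (kind (h (rot a))) (kind (h (rot (rot a)))) * spare (h e)) e≡
      (Right.fromU≤ (rot⁻¹ (rot⁻¹ (rev a))) (sym (trans (cong rev (trans (cong rot (rot-rot⁻¹ _)) (rot-rot⁻¹ _))) (rev-invol a))))
    u₂ : Left.fromU (rot (rot (rev a))) ≤ gift₁ (kind (h (rot a))) (kind (h a)) (kind (h e′)) (kind (h d′)) * spare (h (rot a))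
    u₂ = subst₂ (λ e d → Left.fromU (rot (rot (rev a))) ≤ gift₁ (kind (h (rot a))) (kind (h a)) (kind (h e)) (kind (h d)) * spare (h (rot a))) e≡ d≡
      (Left.fromU≤ (rot (rot (rev a))) (sym (trans (cong rev (trans (cong rot⁻¹ (rot⁻¹-rot _)) (rot⁻¹-rot _))) (rev-invol a))))
    x₁ : Right.fromX (rot⁻¹ (rev a)) ≤ gift₂ (kind (h a)) (kind (h (rot a))) (kind (h (rot (rot a)))) (kind (h d′)) (kind (h e′)) (Openᴿ.open? d′) * spare (h d′)
    x₁ = subst₂ (λ e d → Right.fromX (rot⁻¹ (rev a)) ≤ gift₂ (kind (h a)) (kind (h (rot a))) (kind (h (rot (rot a)))) (kind (h d)) (kind (h e)) (Openᴿ.open? d) * spare (h d)) e≡ d≡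
      (Right.fromX≤ (rot⁻¹ (rev a)) (sym (trans (cong rev (rot-rot⁻¹ _)) (rev-invol a))))
    x₂ : Left.fromX (rot (rev a)) ≤ gift₂ (kind (h a)) (kind (h e′)) (kind (h d′)) (kind (h (rot (rot a)))) (kind (h (rot a))) (Openᴿ.open? (rot a)) * spare (h (rot (rot a)))
    x₂ = subst (λ o → Left.fromX (rot (rev a)) ≤ gift₂ (kind (h a)) (kind (h e′)) (kind (h d′)) (kind (h (rot (rot a)))) (kind (h (rot a))) o * spare (h (rot (rot a))))
      (trans (openᴸ (rot (rot a))) (cong Openᴿ.open? (rot⁻¹-rot (rot a))))
      (subst₂ (λ e d → Left.fromX (rot (rev a)) ≤ gift₂ (kind (h a)) (kind (h e)) (kind (h d)) (kind (h (rot (rot a)))) (kind (h (rot a))) (Openᴸ.open? (rot (rot a))) * spare (h (rot (rot a)))) e≡ d≡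
        (Left.fromX≤ (rot (rev a)) (sym (trans (cong rev (rot⁻¹-rot _)) (rev-invol a)))))

  direct-received : ∀ {a b c d e} → Pentagon a b c d e →
    twiceHalf (flagged a) (flagged b) (flagged c) (flagged d) (flagged e) ≤ receive a
  direct-received {a} p = ≤-trans (≤-reflexive (sym (gate-true (≡⇒≡ᵇ (deg G (tail a)) 5 (Pentagon.deg5 p)))))
    (m≤n⇒m≤n+o _ (m≤m+n (direct a) _))

  incomes pettyIncomes : (a b c d e : Flagged ℕ) → ℕ
  incomes (a , _) (b , _) (c , _) (d , _) (e , _) = income a b c d e
  pettyIncomes (a , _) (b , _) (c , _) (d , _) (e , _) = petties a b c d e

  triangulated-received : ∀ {a b c d e} → T (triangulated? (tail a)) → Pentagon a b c d e →
    incomes (flagged a) (flagged b) (flagged c) (flagged d) (flagged e) +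
    pettyIncomes (flagged a) (flagged b) (flagged c) (flagged d) (flagged e) ≤ receive a
  triangulated-received {a} t p@(pentagon deg5 refl refl refl refl ea) = ≤-reflexive (begin
    (half ha * (2 + (ge6 he + ge6 hb)) + (pay ha hb hc hd he + pay ha he hd hc hb)) + petties ha hb hc hd he
      ≡⟨ cong (λ z → (z + (pay ha hb hc hd he + pay ha he hd hc hb)) + petties ha hb hc hd he) (expand (half ha) (6 ≤ᵇ he) (6 ≤ᵇ hb)) ⟩
    ((2 * half ha + (gate (6 ≤ᵇ hb) (half ha) + gate (6 ≤ᵇ he) (half ha))) + (pay ha hb hc hd he + pay ha he hd hc hb)) + petties ha hb hc hd he
      ≡⟨ +-assoc (2 * half ha + (gate (6 ≤ᵇ hb) (half ha) + gate (6 ≤ᵇ he) (half ha))) _ _ ⟩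
    (2 * half ha + (gate (6 ≤ᵇ hb) (half ha) + gate (6 ≤ᵇ he) (half ha))) + ((pay ha hb hc hd he + pay ha he hd hc hb) + petties ha hb hc hd he)
      ≡⟨ sym (cong₂ _+_ (cong₂ _+_ (gate-true t₅) (cong₂ _+_ bᴿ bᴸ)) (cong₂ _+_ (cong₂ _+_ pᴿ pᴸ) pp)) ⟩
    receive a ∎)
    where
    open ≡-Reasoning
    ha = h a
    hb = h (rot a)
    hc = h (rot (rot a))
    hd = h (rot (rot (rot a)))
    he = h (rot (rot (rot (rot a))))
    t₅ : T (five? a)
    t₅ = ≡⇒≡ᵇ (deg G (tail a)) 5 deg5
    e≡ : h (rot⁻¹ a) ≡ he
    e≡ = cong h (Pentagon.ae p)
    d≡ : h (rot⁻¹ (rot⁻¹ a)) ≡ hd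
    d≡ = cong h (trans (cong rot⁻¹ (Pentagon.ae p)) (rot⁻¹-rot _))
    expand : ∀ m e b → m * (2 + (gate e 1 + gate b 1)) ≡ 2 * m + (gate b m + gate e m)
    expand m true true = eq m
      where
      eq : ∀ m → m * 4 ≡ 2 * m + (m + m)
      eq = solve-∀
    expand m true false = eq m
      where
      eq : ∀ m → m * 3 ≡ 2 * m + m
      eq = solve-∀
    expand m false true = eq m
      where
      eq : ∀ m → m * 3 ≡ 2 * m + (m + 0)
      eq = solve-∀
    expand m false false = eq m
      where
      eq : ∀ m → m * 2 ≡ 2 * m + 0
      eq = solve-∀
    drop-true : ∀ {p q} n → T p → gate (p ∧ q) n ≡ gate q n
    drop-true {true} n _ = refl
    bᴿ : bonusᴿ a ≡ gate (6 ≤ᵇ hb) (half ha)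
    bᴿ = trans (drop-true (half ha) t₅) (drop-true (half ha) (¬⇒T-not (Openᴿ.closed⁺ (triangleᴿ a t))))
    bᴸ : bonusᴸ a ≡ gate (6 ≤ᵇ he) (half ha)
    bᴸ = trans (drop-true (half ha) t₅) (trans (drop-true (half ha) (¬⇒T-not (Openᴸ.closed⁺ (triangleᴸ a t))))
      (cong (λ k → gate (6 ≤ᵇ k) (half ha)) e≡))
    pᴿ : Right.paid a ≡ pay ha hb hc hd he
    pᴿ = trans (drop-true _ t₅) (trans (drop-true _ t) (cong₂ (λ d e → gate (isPay ha hb hc d e) (amt ha hb)) d≡ e≡))
    pᴸ : Left.paid a ≡ pay ha he hd hc hb
    pᴸ = trans (drop-true _ t₅) (trans (drop-true _ t) (cong₂ (λ d e → gate (isPay ha e d hc hb) (amt ha e)) d≡ e≡))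
    pp : fromPetty a ≡ petties ha hb hc hd he
    pp = trans (drop-true _ t₅) (trans (drop-true _ t) (cong₂ (λ d e → gate (petty ha hb hc d e) 6) d≡ e≡))

  -- A 5-vertex that makes gifts lives on direct shares and open corners. Otherwise it sends
  -- nothing, and either all its corners are triangular and the search applies, or an open corner
  -- brings 84 and direct shares bring `2 * 42`.
  five-vertex : ∀ {a b c d e} → Pentagon a b c d e →
    168 + at (tail a) send ≤ at (tail a) receive + 84 * at (tail a) opened
  five-vertex {a} {b} {c} {d} {e} p =
    [ (λ enough → begin
        168 + at (tail a) send              ≤⟨ +-monoʳ-≤ 168 sent ⟩
        168 + cyc gifts fa fb fc fd fe      ≤⟨ enough ⟩
        cyc twiceHalf fa fb fc fd fe + 84 * cyc opens fa fb fc fd fe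
                                            ≤⟨ +-mono-≤ doubled (≤-reflexive (cong (84 *_) (sym (at-five p opened)))) ⟩
        at (tail a) receive + 84 * at (tail a) opened ∎)
    , (λ none → subst (λ s → 168 + s ≤ at (tail a) receive + 84 * at (tail a) opened)
        (sym (n≤0⇒n≡0 (≤-trans sent (≤-reflexive none)))) (by-corners (at (tail a) opened) refl)) ]′
    (gifts-affordable fa fb fc fd fe (H-Deg _) (H-Deg _) (H-Deg _) (H-Deg _) (H-Deg _))
    where
    open ≤-Reasoning
    fa = flagged a
    fb = flagged b
    fc = flagged c
    fd = flagged d
    fe = flagged e
    sent : at (tail a) send ≤ cyc gifts fa fb fc fd fe
    sent = at≤cyc {send} {gifts} send≤gifts p
    doubled : cyc twiceHalf fa fb fc fd fe ≤ at (tail a) receive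
    doubled = cyc≤at {receive} {twiceHalf} p (λ p _ → direct-received p)
    by-corners : ∀ k → at (tail a) opened ≡ k → 168 + 0 ≤ at (tail a) receive + 84 * k
    by-corners zero none = begin
      168 ≤⟨ triangulated-income (H-Deg _) (H-Deg _) (H-Deg _) (H-Deg _) (H-Deg _) (¬excluded p) ⟩
      cyc incomes fa fb fc fd fe + cyc pettyIncomes fa fb fc fd fe
        ≡⟨ sym (cyc-+ incomes pettyIncomes fa fb fc fd fe) ⟩
      cyc (λ a b c d e → incomes a b c d e + pettyIncomes a b c d e) fa fb fc fd fe
        ≤⟨ cyc≤at {receive} {λ a b c d e → incomes a b c d e + pettyIncomes a b c d e} p
             (λ p eq → triangulated-received (subst (λ v → T (triangulated? v)) (sym eq) (≡⇒≡ᵇ (at (tail a) opened) 0 none)) p) ⟩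
      at (tail a) receive ≡⟨ sym (+-identityʳ _) ⟩
      at (tail a) receive + 0 ∎
    by-corners (suc k) _ = begin
      168 ≤⟨ +-mono-≤ (*-monoʳ-≤ 2 (half-income (H-Deg _) (H-Deg _) (H-Deg _) (H-Deg _) (H-Deg _) (¬light p))) (m≤m*n 84 (suc k)) ⟩
      2 * cycHalf (h a) (h b) (h c) (h d) (h e) + 84 * suc k
        ≡⟨ cong (_+ 84 * suc k) (sym (cyc-* 2 (λ a _ _ _ _ → half a) (h a) (h b) (h c) (h d) (h e))) ⟩
      cyc twiceHalf fa fb fc fd fe + 84 * suc k ≤⟨ +-monoˡ-≤ (84 * suc k) doubled ⟩
      at (tail a) receive + 84 * suc k ∎

  -- The balance of vertices of degree at least 6

  window : ∀ v (p : Fin D → Bool) (σ : Fin D → Fin D) → (∀ f → at v (λ c → f (σ c)) ≡ at v f) →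
    (∀ c → T (p c) → ¬ T (p (σ c))) → (∀ c → T (p c) → ¬ T (p (σ (σ c)))) →
    3 * at v (λ c → gate (p c) 1) ≤ deg G v
  window v p σ at-σ step₁ step₂ = begin
    3 * K ≡⟨ three K ⟩
    K + (K + K)
      ≡⟨ sym (trans (at-+ v f (λ c → f (σ c) + f (σ (σ c)))) (cong (K +_) (trans (at-+ v (λ c → f (σ c)) (λ c → f (σ (σ c))))
           (cong₂ _+_ (at-σ f) (trans (at-σ (λ c → f (σ c))) (at-σ f)))))) ⟩
    at v (λ c → f c + (f (σ c) + f (σ (σ c))))
      ≤⟨ at-mono (λ c _ → one (p c) (p (σ c)) (p (σ (σ c))) (step₁ c) (step₁ (σ c)) (step₂ c)) ⟩
    at v (λ _ → 1) ≡⟨ sym (deg-at v) ⟩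
    deg G v ∎
    where
    open ≤-Reasoning
    f : Fin D → ℕ
    f c = gate (p c) 1
    K = at v f
    three : ∀ k → 3 * k ≡ k + (k + k)
    three = solve-∀
    one : ∀ a b c → (T a → ¬ T b) → (T b → ¬ T c) → (T a → ¬ T c) → gate a 1 + (gate b 1 + gate c 1) ≤ 1
    one true true c ab _ _ = ⊥-elim (ab tt tt)
    one true false true _ _ ac = ⊥-elim (ac tt tt)
    one true false false _ _ _ = ≤-refl
    one false true true _ bc _ = ⊥-elim (bc tt tt)
    one false true false _ _ _ = ≤-refl
    one false false true _ _ _ = ≤-refl
    one false false false _ _ _ = z≤n

  hubsᴿ hubsᴸ : Fin n → ℕ
  hubsᴿ v = at v (λ c → gate (Right.hub? (rev c)) 1)
  hubsᴸ v = at v (λ c → gate (Left.hub? (rev c)) 1)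

  windowᴿ : ∀ v → 3 * hubsᴿ v ≤ deg G v
  windowᴿ v = window v (λ c → Right.hub? (rev c)) rot (at-rot v) (λ c → Right.hub-step₁ {c}) (λ c → Right.hub-step₂ {c})

  windowᴸ : ∀ v → 3 * hubsᴸ v ≤ deg G v
  windowᴸ v = window v (λ c → Left.hub? (rev c)) rot⁻¹ (at-rot⁻¹ v) (λ c → Left.hub-step₁ {c}) (λ c → Left.hub-step₂ {c})

  -- The number `l` plays the role of the integer part of `k / 3`, which bounds the hubs of each
  -- orientation. Petty vertices take from 7-vertices only.
  constant-demands : ∀ {v k m l} → deg G v ≡ k → k ≤ 23 → k ≢ 7 → k < 3 * suc l → (∀ x → amt k x ≤ m) → at v demands ≤ m * l + m * l
  constant-demands {v} {k} {m} {l} dv k≤23 k≢7 k<3l amt≤m = begin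
    at v demands
      ≤⟨ at-mono (λ c tc → bound c (trans (h-rev c) (trans (cong H tc) (deg≡⇒H≡ (m≤n⇒m≤1+n k≤23) dv)))) ⟩
    at v (λ c → m * gate (Right.hub? (rev c)) 1 + m * gate (Left.hub? (rev c)) 1)
      ≡⟨ trans (at-+ v (λ c → m * gate (Right.hub? (rev c)) 1) (λ c → m * gate (Left.hub? (rev c)) 1))
           (cong₂ _+_ (at-* v m (λ c → gate (Right.hub? (rev c)) 1)) (at-* v m (λ c → gate (Left.hub? (rev c)) 1))) ⟩
    m * hubsᴿ v + m * hubsᴸ v
      ≤⟨ +-mono-≤ (*-monoʳ-≤ m (few (windowᴿ v))) (*-monoʳ-≤ m (few (windowᴸ v))) ⟩
    m * l + m * l ∎
    where
    open ≤-Reasoning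
    few : ∀ {K} → 3 * K ≤ deg G v → K ≤ l
    few {K} 3K≤ = s≤s⁻¹ (*-cancelˡ-< 3 K (suc l) (≤-trans (s≤s 3K≤) (subst (λ k → suc k ≤ 3 * suc l) (sym dv) k<3l)))
    gate≤m : ∀ b {a} → a ≤ m → gate b a ≤ m * gate b 1
    gate≤m true a≤m = ≤-trans a≤m (≤-reflexive (sym (*-identityʳ m)))
    gate≤m false _ = z≤n
    bound : ∀ c → h (rev c) ≡ k → demands c ≤ m * gate (Right.hub? (rev c)) 1 + m * gate (Left.hub? (rev c)) 1
    bound c eq = ≤-trans (≤-reflexive (trans (cong ((Right.fromHub (rev c) + Left.fromHub (rev c)) +_)
        (gate-false λ t → k≢7 (trans (sym eq) (petty-seven t)))) (+-identityʳ _)))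
      (+-mono-≤ (gate≤m (Right.hub? (rev c)) (subst (λ y → amt y (h (rot (rev c))) ≤ m) (sym eq) (amt≤m (h (rot (rev c))))))
        (gate≤m (Left.hub? (rev c)) (subst (λ y → amt y (h (rot⁻¹ (rev c))) ≤ m) (sym eq) (amt≤m (h (rot⁻¹ (rev c)))))))

  petty-reverse : ∀ {y a b c d} → T (petty y a b c d) → T (petty y d c b a)
  petty-reverse {y} {a} {b} {c} {d} t with ∧⁻ {y ≡ᵇ 7} t
  ... | t₇ , t = ∧⁺ {y ≡ᵇ 7} t₇ ([ ∨ʳ {petty½ d c b a} , ∨ˡ ]′ (∨⁻ {petty½ a b c d} t))

  module Rightʰ = Right.Heptagonal petty? petty-five petty-triangulated petty-view
  module Leftʰ = Left.Heptagonal petty? petty-five petty-triangulated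
    (λ {d} t → petty-reverse {h d} {h (rot d)} {h (rot (rot d))} {h (rot⁻¹ (rot⁻¹ d))} {h (rot⁻¹ d)} (petty-view t))

  -- Evidence for a demand. Payees with x of degree at least 8 have no constructor, since `amt 7 x`
  -- vanishes for them.
  data Stake (c : Fin D) : Demand → Set where
    none  : Stake c idle
    hubR₆ : T (Right.hub? (rev c)) → h (rot (rev c)) ≤ 6 → Stake c R₆
    hubR₇ : T (Right.hub? (rev c)) → h (rot (rev c)) ≡ 7 → Stake c R₇
    hubL₆ : T (Left.hub? (rev c)) → h (rot⁻¹ (rev c)) ≤ 6 → Stake c L₆
    hubL₇ : T (Left.hub? (rev c)) → h (rot⁻¹ (rev c)) ≡ 7 → Stake c L₇
    petit : T (petty? (rev c)) → Stake c scant

  right-hub : ∀ {c s} → Stake c s → T (right s) → T (Right.hub? (rev c))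
  right-hub (hubR₆ t _) _ = t
  right-hub (hubR₇ t _) _ = t

  left-hub : ∀ {c s} → Stake c s → T (left s) → T (Left.hub? (rev c))
  left-hub (hubL₆ t _) _ = t
  left-hub (hubL₇ t _) _ = t

  active-five : ∀ {c s} → Stake c s → T (active s) → h c ≡ 5
  active-five (hubR₆ t _) _ = deg≡⇒H≡ 5≤24 (Right.Payee.deg5 (proj₁ (Right.hub⁻ t)))
  active-five (hubR₇ t _) _ = deg≡⇒H≡ 5≤24 (Right.Payee.deg5 (proj₁ (Right.hub⁻ t)))
  active-five (hubL₆ t _) _ = deg≡⇒H≡ 5≤24 (Left.Payee.deg5 (proj₁ (Left.hub⁻ t)))
  active-five (hubL₇ t _) _ = deg≡⇒H≡ 5≤24 (Left.Payee.deg5 (proj₁ (Left.hub⁻ t)))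
  active-five (petit t) _ = deg≡⇒H≡ 5≤24 (petty-five t)

  exclude : ∀ {p q} → (T p → T q → ⊥) → T (not (p ∧ q))
  exclude {p} f = ¬⇒T-not λ t → f (proj₁ (∧⁻ {p} t)) (proj₂ (∧⁻ {p} t))

  apart₂ : ∀ {c s s′} → Stake c s → Stake (rot (rot c)) s′ → T (next₂ s s′)
  apart₂ {c} {s} {s′} k k′ = ∧⁺ (exclude {right s} λ r r′ → Right.hub-step₂ {c} (right-hub k r) (right-hub k′ r′))
    (exclude {left s} λ l l′ → Left.hub-step₂ {rot (rot c)} (left-hub k′ l′)
      (subst (λ e → T (Left.hub? (rev e))) (sym (trans (cong rot⁻¹ (rot⁻¹-rot (rot c))) (rot⁻¹-rot c))) (left-hub k l)))

  apart₁ : ∀ {c s s′} → H (tail c) ≡ 7 → Stake c s → Stake (rot c) s′ → T (next₁ s s′)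
  apart₁ {c} {s} {s′} y≡7 k k′ =
    ∧⁺ {next₂ s s′} (∧⁺ (exclude {right s} λ r r′ → Right.hub-step₁ {c} (right-hub k r) (right-hub k′ r′))
      (exclude {left s} λ l l′ → Left.hub-step₁ {rot c} (left-hub k′ l′)
        (subst (λ e → T (Left.hub? (rev e))) (sym (rot⁻¹-rot c)) (left-hub k l))))
    (∧⁺ (exclude {isR₆ s} λ r p → R-scant k k′ r p) (∧⁺ (exclude {isScant s} λ p r → scant-R k k′ p r)
    (∧⁺ (exclude {isL₆ s} λ l p → L-scant k k′ l p) (∧⁺ (exclude {isScant s} λ p l → scant-L k k′ p l)
    (∧⁺ (exclude {active s} λ a r → before-R₇ k k′ a r) (exclude {isL₇ s} λ l a → after-L₇ k k′ l a))))))
    where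
    seven : h (rev c) ≡ 7
    seven = trans (h-rev c) y≡7
    seven′ : h (rev (rot c)) ≡ 7
    seven′ = trans (h-rev (rot c)) (trans (cong H (rot-tail c)) y≡7)
    back : ∀ {P : Fin D → Set} → P c → P (rot⁻¹ (rot c))
    back {P} = subst P (sym (rot⁻¹-rot c))
    R-scant : ∀ {s s′} → Stake c s → Stake (rot c) s′ → T (isR₆ s) → T (isScant s′) → ⊥
    R-scant (hubR₆ t x≤6) (petit p) _ _ = Rightʰ.hub-¬petty-next t seven x≤6 p
    scant-R : ∀ {s s′} → Stake c s → Stake (rot c) s′ → T (isScant s) → T (isR₆ s′) → ⊥
    scant-R (petit p) (hubR₆ t _) _ _ = Rightʰ.hub-¬petty-prev t seven′ (back {λ e → T (petty? (rev e))} p)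
    L-scant : ∀ {s s′} → Stake c s → Stake (rot c) s′ → T (isL₆ s) → T (isScant s′) → ⊥
    L-scant (hubL₆ t _) (petit p) _ _ = Leftʰ.hub-¬petty-prev t seven p
    scant-L : ∀ {s s′} → Stake c s → Stake (rot c) s′ → T (isScant s) → T (isL₆ s′) → ⊥
    scant-L (petit p) (hubL₆ t x≤6) _ _ = Leftʰ.hub-¬petty-next t seven′ x≤6 (back {λ e → T (petty? (rev e))} p)
    7≢5 : 7 ≢ 5
    7≢5 ()
    -- The head of `c` is the vertex x of that payee, of degree 7, while vertices with a demand have
    -- degree 5.
    before-R₇ : ∀ {s s′} → Stake c s → Stake (rot c) s′ → T (active s) → T (isR₇ s′) → ⊥
    before-R₇ k (hubR₇ t x≡7) a _ = 7≢5 (trans (sym x≡7)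
      (trans (sym (Right.Hub.h-σ⁻¹ {rot c} (proj₁ (Right.hub⁻ t)))) (trans (cong h (rot⁻¹-rot c)) (active-five k a))))
    after-L₇ : ∀ {s s′} → Stake c s → Stake (rot c) s′ → T (isL₇ s) → T (active s′) → ⊥
    after-L₇ (hubL₇ t x≡7) k′ _ a = 7≢5 (trans (sym x≡7)
      (trans (sym (Left.Hub.h-σ⁻¹ {c} (proj₁ (Left.hub⁻ t)))) (active-five k′ a)))

  amt₇≤42 : ∀ x → amt 7 x ≤ 42
  amt₇≤42 x with x ≤ᵇ 6
  ... | true = ≤-refl
  ... | false with x ≡ᵇ 7
  ...   | true = m≤m+n 30 12
  ...   | false = z≤n

  amt₇-large : ∀ {x} → 7 < x → amt 7 x ≡ 0
  amt₇-large {x} 7<x = subst (λ x → amt 7 x ≡ 0) (m+[n∸m]≡n 7<x) refl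

  data Claim (hub? : Bool) (x : ℕ) (claim : ℕ) : Set where
    claim₆ : T hub? → x ≤ 6 → claim ≤ 42 → Claim hub? x claim
    claim₇ : T hub? → x ≡ 7 → claim ≤ 30 → Claim hub? x claim
    claim₀ : claim ≡ 0 → Claim hub? x claim

  claim : ∀ hub? {y x} → y ≡ 7 → Claim hub? x (gate hub? (amt y x))
  claim false _ = claim₀ refl
  claim true {x = x} refl with <-cmp x 7
  ... | tri< x<7 _ _ = claim₆ tt (s≤s⁻¹ x<7) (amt₇≤42 x)
  ... | tri≈ _ refl _ = claim₇ tt refl ≤-refl
  ... | tri> _ _ 7<x = claim₀ (amt₇-large 7<x)

  -- Reversing the orientation exchanges u, of degree 5, with M, of degree at least 6.
  one-sided : ∀ {d} → T (Right.hub? d) → ¬ T (Left.hub? d)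
  one-sided t t′ = <⇒≱ (Left.Payee.6≤M (proj₁ (Left.hub⁻ t′))) (≤-reflexive (Right.Payee.u≡5 (proj₁ (Right.hub⁻ t))))

  module _ {c : Fin D} {m : ℕ} (y≡7 : H (tail c) ≡ 7) where

    only-right : T (Right.hub? (rev c)) → h (rot (rev c)) ≤ 7 → Right.fromHub (rev c) ≤ m → demands c ≤ m
    only-right t x≤7 r≤m = ≤-trans (≤-reflexive (trans (cong₂ _+_ (cong (Right.fromHub (rev c) +_) (gate-false (one-sided t)))
      (gate-false (Rightʰ.hub-¬petty t (trans (h-rev c) y≡7) x≤7))) (trans (+-identityʳ _) (+-identityʳ _)))) r≤m

    only-left : Right.fromHub (rev c) ≡ 0 → T (Left.hub? (rev c)) → h (rot⁻¹ (rev c)) ≤ 7 → Left.fromHub (rev c) ≤ m → demands c ≤ m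
    only-left r≡0 t x≤7 l≤m = ≤-trans (≤-reflexive (trans (cong₂ _+_ (cong (_+ Left.fromHub (rev c)) r≡0)
      (gate-false (Leftʰ.hub-¬petty t (trans (h-rev c) y≡7) x≤7))) (+-identityʳ _))) l≤m

  stake : ∀ c → H (tail c) ≡ 7 → Σ Demand λ s → Stake c s × demands c ≤ demand s
  stake c y≡7 with claim (Right.hub? (rev c)) {x = h (rot (rev c))} (trans (h-rev c) y≡7)
                 | claim (Left.hub? (rev c)) {x = h (rot⁻¹ (rev c))} (trans (h-rev c) y≡7)
  ... | claim₆ t x≤6 r≤ | _ = R₆ , hubR₆ t x≤6 , only-right y≡7 t (m≤n⇒m≤1+n x≤6) r≤
  ... | claim₇ t x≡7 r≤ | _ = R₇ , hubR₇ t x≡7 , only-right y≡7 t (≤-reflexive x≡7) r≤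
  ... | claim₀ r≡0 | claim₆ t x≤6 l≤ = L₆ , hubL₆ t x≤6 , only-left y≡7 r≡0 t (m≤n⇒m≤1+n x≤6) l≤
  ... | claim₀ r≡0 | claim₇ t x≡7 l≤ = L₇ , hubL₇ t x≡7 , only-left y≡7 r≡0 t (≤-reflexive x≡7) l≤
  ... | claim₀ r≡0 | claim₀ l≡0 with T? (petty? (rev c))
  ...   | yes p = scant , petit p , +-mono-≤ (≤-reflexive (cong₂ _+_ r≡0 l≡0)) (gate-≤ (petty? (rev c)) 6)
  ...   | no ¬p = idle , none , ≤-reflexive (cong₂ _+_ (cong₂ _+_ r≡0 l≡0) (gate-false ¬p))

  seven-demands : ∀ c → deg G (tail c) ≡ 7 → at (tail c) demands ≤ 168
  seven-demands c deg7 = begin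
    at (tail c) demands
      ≡⟨ subst (λ k → at (tail c) demands ≡ sum {k} (λ i → demands (iter (toℕ i) rot c))) deg7 (Turn.total (turn c) demands) ⟩
    demands (d 0) + (demands (d 1) + (demands (d 2) + (demands (d 3) + (demands (d 4) + (demands (d 5) + (demands (d 6) + 0))))))
      ≤⟨ +-mono-≤ (bound 0) (+-mono-≤ (bound 1) (+-mono-≤ (bound 2) (+-mono-≤ (bound 3) (+-mono-≤ (bound 4)
          (+-mono-≤ (bound 5) (≤-trans (≤-reflexive (+-identityʳ _)) (bound 6))))))) ⟩
    demand (s 0) + (demand (s 1) + (demand (s 2) + (demand (s 3) + (demand (s 4) + (demand (s 5) + demand (s 6))))))
      ≤⟨ heptagon (s 0) (s 1) (s 2) (s 3) (s 4) (s 5) (s 6)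
          (a₁ 0) (a₁ 1) (a₁ 2) (a₁ 3) (a₁ 4) (a₁ 5) (apart₁ (seven 6) (k 6) (around {0} (k 0)))
          (a₂ 0) (a₂ 1) (a₂ 2) (a₂ 3) (a₂ 4) (apart₂ (k 5) (around {0} (k 0))) (apart₂ (k 6) (around {1} (k 1))) ⟩
    168 ∎
    where
    open ≤-Reasoning
    d : ℕ → Fin D
    d i = iter i rot c
    seven : ∀ i → H (tail (d i)) ≡ 7
    seven i = trans (cong H (iter-tail i c)) (deg≡⇒H≡ (m≤m+n 7 17) deg7)
    s : ℕ → Demand
    s i = proj₁ (stake (d i) (seven i))
    k : ∀ i → Stake (d i) (s i)
    k i = proj₁ (proj₂ (stake (d i) (seven i)))
    bound : ∀ i → demands (d i) ≤ demand (s i)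
    bound i = proj₂ (proj₂ (stake (d i) (seven i)))
    a₁ : ∀ i → T (next₁ (s i) (s (suc i)))
    a₁ i = apart₁ (seven i) (k i) (k (suc i))
    a₂ : ∀ i → T (next₂ (s i) (s (suc (suc i))))
    a₂ i = apart₂ (k i) (k (suc (suc i)))
    around : ∀ {i s} → Stake (d i) s → Stake (d (i + 7)) s
    around {i} {s} = subst (λ e → Stake e s) (sym (trans (iter-+ rot i 7 c)
      (cong (iter i rot) (trans (cong (λ k → iter k rot c) (sym deg7)) (Turn.closed (turn c))))))

  mid-cases : ∀ {y} → T (isMid y) → y ≡ 7 ⊎ y ≡ 8 ⊎ y ≡ 9
  mid-cases {7} _ = inj₁ refl
  mid-cases {8} _ = inj₂ (inj₁ refl)
  mid-cases {9} _ = inj₂ (inj₂ refl)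
  mid-cases {suc (suc (suc (suc (suc (suc (suc (suc (suc (suc _)))))))))} t with () ← t

  mid-deg : ∀ v → T (isMid (H v)) → deg G v ≡ 7 ⊎ deg G v ≡ 8 ⊎ deg G v ≡ 9
  mid-deg v t = [ (λ eq → inj₁ (H≡⇒deg≡ (m≤m+n 7 16) eq)) ,
    [ (λ eq → inj₂ (inj₁ (H≡⇒deg≡ (m≤m+n 8 15) eq))) , (λ eq → inj₂ (inj₂ (H≡⇒deg≡ (m≤m+n 9 14) eq))) ]′ ]′ (mid-cases {H v} t)

  dart-at : ∀ v → ∃ λ d → tail d ≡ v
  dart-at v with any? (λ d → tail d F.≟ v)
  ... | yes found = found
  ... | no ∄dart = ⊥-elim (n≮0 (≤-trans (minDeg v) (≤-reflexive (trans (deg-at v)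
    (trans (sum-cong-≗ λ d → gate-false {eqF (tail d) v} λ t → ∄dart (d , eqF⁻ t)) (sum-zero D))))))

  at-const : ∀ v k → at v (λ _ → k) ≡ deg G v * k
  at-const v k = trans (sum-cong-≗ λ d → cong (gate (eqF (tail d) v)) (sym (*-identityʳ k)))
    (trans (at-* v k (λ _ → 1)) (trans (cong (k *_) (sym (deg-at v))) (*-comm k (deg G v))))

  send≤demands : ∀ v → deg G v ≢ 5 → at v send ≤ deg G v * (2 * half (H v)) + at v demands
  send≤demands v ≢5 = ≤-trans (at-mono pointwise) (≤-reflexive (trans (at-+ v (λ _ → 2 * half (H v)) demands) (cong (_+ at v demands) (at-const v (2 * half (H v))))))
    where
    -- An edge gives its whole share to a head of degree 5 or one half to either side, never both.
    split : ∀ b b′ x → (T b → T b′ → ⊥) → gate b (2 * x) + (gate b′ x + gate b′ x) ≤ 2 * x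
    split true true x f = ⊥-elim (f tt tt)
    split true false x _ = ≤-reflexive (+-identityʳ (2 * x))
    split false true x _ = ≤-reflexive (cong (x +_) (sym (+-identityʳ x)))
    split false false x _ = z≤n
    pointwise : ∀ c → tail c ≡ v → send c ≤ 2 * half (H v) + demands c
    pointwise c refl = +-mono-≤
      (split (deg G (head G c) ≡ᵇ 5) (6 ≤ᵇ h c) (half (H (tail c))) λ t t′ →
        <⇒≱ (≤ᵇ⇒≤ 6 (h c) t′) (≤-reflexive (deg≡⇒H≡ 5≤24 (≡ᵇ⇒≡ (deg G (head G c)) 5 t))))
      (≤-reflexive (trans (cong (demands c +_) (donations-zero c ≢5)) (+-identityʳ (demands c))))

  large-vertex : ∀ v → deg G v ≢ 5 → 1008 + at v send ≤ 168 * deg G v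
  large-vertex v ≢5 = ≤-trans (+-monoʳ-≤ 1008 (send≤demands v ≢5)) (by-degree (deg G v ≟ 7) (deg G v ≟ 8) (deg G v ≟ 9))
    where
    budget : ∀ k b → deg G v ≡ k → k ≤ 24 → at v demands ≤ b → T (1008 + (k * (2 * half k) + b) ≤ᵇ 168 * k) →
      1008 + (deg G v * (2 * half (H v)) + at v demands) ≤ 168 * deg G v
    budget k b dv k≤24 demands≤ t = ≤-trans (+-monoʳ-≤ 1008 (+-mono-≤
        (≤-reflexive (cong₂ (λ d t → d * (2 * half t)) dv (deg≡⇒H≡ k≤24 dv))) demands≤))
      (≤-trans (≤ᵇ⇒≤ (1008 + (k * (2 * half k) + b)) (168 * k) t) (≤-reflexive (cong (168 *_) (sym dv))))
    -- At degrees 7, 8, 9 the charges 168, 336, 504 are spent as 0 + 168, 224 + 112 and 432 + 72.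
    by-degree : Dec (deg G v ≡ 7) → Dec (deg G v ≡ 8) → Dec (deg G v ≡ 9) →
      1008 + (deg G v * (2 * half (H v)) + at v demands) ≤ 168 * deg G v
    by-degree (yes d7) _ _ with dart-at v
    ... | c , refl = budget 7 168 d7 (m≤m+n 7 17) (seven-demands c d7) tt
    by-degree _ (yes d8) _ = budget 8 112 d8 (m≤m+n 8 16)
      (constant-demands {l = 2} d8 (m≤m+n 8 15) (λ ()) ≤-refl (λ _ → ≤-refl)) tt
    by-degree _ _ (yes d9) = budget 9 72 d9 (m≤m+n 9 15)
      (constant-demands {l = 3} d9 (m≤m+n 9 14) (λ ()) (m≤m+n 10 2) (λ _ → ≤-refl)) tt
    by-degree (no ≢7) (no ≢8) (no ≢9) = ≤-trans (+-monoʳ-≤ 1008 (≤-reflexive (trans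
        (cong (deg G v * (2 * half (H v)) +_) idle-demands) (+-identityʳ _))))
      (half-affordable (deg G v) (≤∧≢⇒< (minDeg v) (λ eq → ≢5 (sym eq))))
      where
      idle-demands : at v demands ≡ 0
      idle-demands = n≤0⇒n≡0 (≤-trans (at-mono {f = demands} {g = λ _ → 0} λ c tc → ≤-reflexive (demands-zero c λ t →
        [ ≢7 , [ ≢8 , ≢9 ]′ ]′ (mid-deg v (subst (λ w → T (isMid (H w))) tc t))))
        (≤-reflexive (trans (at-const v 0) (*-zeroʳ (deg G v)))))

  -- Summation and contradiction

  vertex : ∀ v → 1008 + at v send ≤ 168 * deg G v + (at v receive + 84 * at v opened)
  vertex v with deg G v ≟ 5
  ... | no ≢5 = ≤-trans (large-vertex v ≢5) (m≤m+n _ _)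
  ... | yes d5 with dart-at v
  -- 1008 is split into 840 = 168 · 5, matched by the degree, and the deficit 168.
  ...   | a , refl = ≤-trans (+-monoʳ-≤ 840 (five-vertex (at-dart a d5)))
    (≤-reflexive (cong (λ d → 168 * d + (at v receive + 84 * at v opened)) (sym d5)))

  -- The corner after `d` belongs to the face traced from `rot d`: the two threefold compositions
  -- are conjugate under `rot`.
  open-face : ∀ d → Openᴿ.open? d ≡ face-open (rot d)
  open-face d = cong not (T-iff {eqF corner d} {eqF (rot corner) (rot d)}
      (λ t → eqF⁺ (cong rot (eqF⁻ t))) (λ t → eqF⁺ (rot-inj corner d (eqF⁻ t))))
    where corner = rev (rot (rev (rot (rev (rot d)))))

  opened-corners : sum opened ≡ openCorners
  opened-corners = trans (sum-cong-≗ λ d → cong (λ b → gate b 1) (open-face d)) (sum-rot (λ d → gate (face-open d) 1))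

  sum-const : ∀ k c → sum {k} (λ _ → c) ≡ k * c
  sum-const zero c = refl
  sum-const (suc k) c = cong (c +_) (sum-const k c)

  sum-deg : sum (deg G) ≡ D
  sum-deg = trans (sum-cong-≗ deg-at) (trans (sum-at (λ _ → 1)) (trans (sum-const D 1) (*-identityʳ D)))

  discharged : n * 1008 + sum send ≤ 168 * D + (sum receive + 84 * openCorners)
  discharged = begin
    n * 1008 + sum send
      ≡⟨ sym (trans (∑-distrib-+ (λ _ → 1008) (λ v → at v send)) (cong₂ _+_ (sum-const n 1008) (sum-at send))) ⟩
    sum (λ v → 1008 + at v send)
      ≤⟨ sum-mono vertex ⟩
    sum (λ v → 168 * deg G v + (at v receive + 84 * at v opened))
      ≡⟨ trans (∑-distrib-+ (λ v → 168 * deg G v) (λ v → at v receive + 84 * at v opened))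
           (cong₂ _+_ (trans (sym (*-distribˡ-sum 168 (deg G))) (cong (168 *_) sum-deg))
             (trans (∑-distrib-+ (λ v → at v receive) (λ v → 84 * at v opened))
               (cong₂ _+_ (sum-at receive) (trans (sym (*-distribˡ-sum 84 (λ v → at v opened)))
                 (cong (84 *_) (trans (sum-at opened) opened-corners)))))) ⟩
    168 * D + (sum receive + 84 * openCorners) ∎
    where open ≤-Reasoning

  impossible : 0 < n → ⊥
  impossible 0<n = <⇒≱ (m<n+m (84 * (12 * n)) {84 * 24} (s≤s z≤n)) (begin
    84 * 24 + 84 * (12 * n)
      ≤⟨ +-monoʳ-≤ (84 * 24) (+-cancelʳ-≤ (sum send) (84 * (12 * n)) _ (≤-trans (≤-reflexive (cong (_+ sum send) (scale₁ n)))
           (≤-trans discharged (≤-trans (+-monoʳ-≤ (168 * D) (+-monoˡ-≤ (84 * openCorners) received≤sent))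
             (≤-reflexive (scale₂ D openCorners (sum send))))))) ⟩
    84 * 24 + 84 * (2 * D + openCorners)
      ≡⟨ scale₃ (2 * D + openCorners) ⟩
    84 * (2 * D + openCorners + 24)
      ≤⟨ *-monoʳ-≤ 84 (euler-bound 0<n) ⟩
    84 * (12 * n) ∎)
    where
    open ≤-Reasoning
    scale₁ : ∀ n → 84 * (12 * n) ≡ n * 1008
    scale₁ n = trans (sym (*-assoc 84 12 n)) (*-comm 1008 n)
    scale₂ : ∀ d o s → 168 * d + (s + 84 * o) ≡ 84 * (2 * d + o) + s
    scale₂ = solve-∀
    scale₃ : ∀ x → 84 * 24 + 84 * x ≡ 84 * (x + 24)
    scale₃ x = trans (+-comm (84 * 24) (84 * x)) (sym (*-distribˡ-+ 84 x 24))

theorem14 : (G : RotSys) → IsSimplePlane G → 0 < RotSys.n G →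
    ((v : Fin (RotSys.n G)) → 5 ≤ deg G v) →
    ¬ HasStar G (fin 5) (fin 6) (fin 6) (fin 5) ∞ →
    ¬ HasStar G (fin 5) (fin 6) (fin 7) (fin 5) (fin 23) →
    HasMinor5Star G 45 17
theorem14 G plane 0<n minDeg ¬star₁ ¬star₂ with minor? G 45 17
... | yes minor = minor
... | no ¬minor = ⊥-elim (Counterexample.impossible G plane minDeg ¬star₁ ¬star₂ ¬minor 0<n)
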